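{- Let $\sigma=\sigma(n)\ge 2$ be a non-decreasing integer function of $n$ with $\sigma \le O(n)$, and let $k=k(n)\ge 0$ be an integer function of $n$ with $k=o(\log_\sigma n)$. For any string $T[1,n]$ over the alphabet $\{1,2,\ldots,\sigma\}$ and any ReLZ parsing of $T$ (i.e., the ReLZ parsing for any prefix parameter $\ell\in\{0,1,\ldots,n\}$), the rightmost encoding of this parsing in which every pair $(d_j,\ell_j)$ corresponding to a copying phrase takes $\log d_j + O(1+\log\log d_j+\log \ell_j)$ bits occupies at most $nH_k(T)+o(n\log\sigma)$ bits. (The $o(n\log\sigma)$ term is as $n\to\infty$, uniformly over $T$ and $\ell$.)
   Context: All logarithms are base 2 unless stated otherwise; $\log\log d$ is read as $0$ when $d=1$. $T[i]$ is the $i$th symbol of $T$ and $T[i,j]=T[i]T[i+1]\cdots T[j]$. The constants hidden in the $O(\cdot)$ of the encoding are fixed absolute constants. Empirical entropy. $H_0(T)=\sum_{c}\frac{n_c}{n}\log\frac{n}{n_c}$, where $c$ ranges over the alphabet, $n_c$ is the number of occurrences of symbol $c$ in $T[1,n]$, and terms with $n_c=0$ are $0$. For a string $W$, $T_W$ is the concatenation of all symbols immediately following occurrences of $W$ in $T$ (e.g. $T_{ab}=aac$ for $T=abababc$). $H_k(T)=\sum_{W\in\Sigma^k}\frac{|T_W|}{n}H_0(T_W)$, where $\Sigma=\{1,\ldots,\sigma\}$ (empty $T_W$ contributes $0$). LZ parsing. $\mathit{LZ}(T)=(P_1,\ldots,P_z)$ is the factorization $T=P_1\cdots P_z$ into non-empty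 phrases built greedily: if $P_1,\ldots,P_{j-1}$ parse $T[1,i-1]$, then $P_j$ is the longest prefix of $T[i,n]$ that has an occurrence in $T$ starting at a position smaller than $i$ (overlaps allowed); $P_j$ is then a copying phrase and the previous occurrence is its source. If this longest prefix is empty, $P_j=T[i]$ is a literal phrase. RLZ parsing. For a reference string $R$, $\mathit{RLZ}(T,R)=(P_1,\ldots,P_z)$ is the factorization of $T$ where $P_j$ is the longest prefix of the remaining suffix $T[i,n]$ that is a substring of $R$ (copying phrase), or, if this is empty, $P_j=T[i]$ (literal phrase). ReLZ parsing with prefix parameter $\ell$. First compute the sequence of phrases $(P_1,\ldots,P_{z'})=\mathit{LZ}(T[1,\ell])\cdot \mathit{RLZ}(T[\ell+1,n],T[1,\ell])$, so $T=P_1\cdots P_{z'}$. Regard phrases as atomic metasymbols: let $T'[1,z']$ be a string with $T'[i]=T'[j]$ iff $P_i=P_j$. Compute $\mathit{LZ}(T')=(P'_1,\ldots,P'_{\hat z})$. The ReLZ parsing of $T$ has $\hat z$ phrases: each literal phrase $P'_j$ of $T'$ corresponds to a single phrase $P_i$ and is left unchanged (as a copying or literal phrase); each copying phrase $P'_j$ with source $T'[p,q]$ becomes a copying phrase of $T$ (the concatenation of the $P_i$'s it covers) with source $T[p',q']$, $p'=|P_1\cdots P_{p-1}|+1$, $q'=|P_1\cdots P_q|$. Encoding. Given a parsing into phrases $P_1,P_2,\ldots$ of $T$, each copying phrase $P_j$ is encoded by a pair $(d_j,\ell_j)$ with $\ell_j=|P_j|$ and $d_j\ge1$ such that $P_j$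 is a prefix of $T[|P_1\cdots P_{j-1}|-d_j+1,n]$, i.e. $d_j$ is the distance from the start of $P_j$ to the start of its source. Each literal phrase $c$ is encoded as a pair $(c,0)$ storing the symbol $c$ as an integer, taking $\log\sigma+O(1+\log\log\sigma)$ bits. The encoding is rightmost if all $d_j$ are minimized, i.e. the rightmost possible earlier-starting occurrence is chosen as the source of each copying phrase. -}

module Defs where

import Algebra.Definitions.RawSemiring
open import Data.Fin.Base using (Fin)
import Data.Fin.Properties as Fin
open import Data.Integer.Base as ℤ using (ℤ; +_; -[1+_]; +[1+_])
import Data.Integer.Properties as ℤ
open import Data.List.Base as List
  using (List; []; _∷_; [_]; _++_; length; map; take; drop; foldr; allFin; filter;
         concat; cartesianProductWith)
open import Data.List.Relation.Binary.Infix.Heterogeneous using (Infix)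
open import Data.List.Relation.Binary.Prefix.Heterogeneous using (Prefix)
open import Data.Nat.Base as ℕ using (ℕ; zero; suc; NonTrivial)
import Data.Nat.Coprimality as ℕ
import Data.Nat.Properties as ℕ
open import Data.Product.Base using (∃-syntax; _×_; _,_)
open import Data.Rational.Base as ℚ
  using (ℚ; mkℚ; 0ℚ; 1ℚ; ↥_; ↧ₙ_; 1/_; NonNegative; Positive)
open import Data.Rational.Literals using (fromℤ)
import Data.Rational.Properties as ℚ
open import Data.Rational.Solver using (module +-*-Solver)
open import Relation.Binary.PropositionalEquality
  using (_≡_; _≢_; refl; sym; trans; cong; cong₂; subst; subst₂; module ≡-Reasoning)
open import Relation.Nullary.Decidable using (yes; no; from-yes)
open import Relation.Nullary.Negation using (contradiction)

open Algebra.Definitions.RawSemiring ℚ.+-*-rawSemiring using (_^_)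

-- A real number is its lower Dedekind cut {q ∈ ℚ | q < x}.  Only sums,
-- products with non-negative rationals, and logarithms are needed, and
-- for these lower cuts suffice.

record ℝ : Set₁ where
  field
    _∋_       : ℚ → Set
    inhabited : ∃[ q ] _∋_ q
    bounded   : ∃[ u ] (∀ {q} → _∋_ q → q ℚ.< u)
    downward  : ∀ {p q} → p ℚ.< q → _∋_ q → _∋_ p
    rounded   : ∀ {p} → _∋_ p → ∃[ q ] (p ℚ.< q × _∋_ q)

open ℝ public using (_∋_)

infix 4 _≤ʳ_
infixl 6 _+ʳ_
infixr 7 _·_

_≤ʳ_ : ℝ → ℝ → Set
x ≤ʳ y = ∀ {q} → x ∋ q → y ∋ q

fromℕ : ℕ → ℚ
fromℕ n = fromℤ (+ n)

p-1<p : ∀ p → p ℚ.- 1ℚ ℚ.< p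
p-1<p p = subst (p ℚ.- 1ℚ ℚ.<_) (ℚ.+-identityʳ p)
  (ℚ.+-monoʳ-< p (from-yes ((ℚ.- 1ℚ) ℚ.<? 0ℚ)))

fromℚ : ℚ → ℝ
fromℚ c = record
  { _∋_       = ℚ._< c
  ; inhabited = c ℚ.- 1ℚ , p-1<p c
  ; bounded   = c , λ q<c → q<c
  ; downward  = ℚ.<-trans
  ; rounded   = ℚ.<-dense
  }

0ʳ : ℝ
0ʳ = fromℚ 0ℚ

_+ʳ_ : ℝ → ℝ → ℝ
x +ʳ y = record
  { _∋_       = λ q → ∃[ a ] ∃[ b ] (x ∋ a × y ∋ b × q ℚ.< a ℚ.+ b)
  ; inhabited = let a , a∈ = ℝ.inhabited x
                    b , b∈ = ℝ.inhabited y
                in (a ℚ.+ b) ℚ.- 1ℚ , a , b , a∈ , b∈ , p-1<p (a ℚ.+ b)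
  ; bounded   = let u , <u = ℝ.bounded x
                    v , <v = ℝ.bounded y
                in u ℚ.+ v , λ (a , b , a∈ , b∈ , q<) →
                     ℚ.<-trans q< (ℚ.+-mono-< (<u a∈) (<v b∈))
  ; downward  = λ p<q (a , b , a∈ , b∈ , q<) → a , b , a∈ , b∈ , ℚ.<-trans p<q q<
  ; rounded   = λ (a , b , a∈ , b∈ , p<) →
                  let q , p<q , q< = ℚ.<-dense p< in q , p<q , a , b , a∈ , b∈ , q<
  }

_·_ : (c : ℚ) .{{_ : NonNegative c}} → ℝ → ℝ
c · x = record
  { _∋_       = λ q → ∃[ a ] (x ∋ a × q ℚ.< c ℚ.* a)
  ; inhabited = let a , a∈ = ℝ.inhabited x
                in (c ℚ.* a) ℚ.- 1ℚ , a , a∈ , p-1<p (c ℚ.* a)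
  ; bounded   = let u , <u = ℝ.bounded x
                in c ℚ.* u , λ (a , a∈ , q<) →
                     ℚ.<-≤-trans q< (ℚ.*-monoˡ-≤-nonNeg c (ℚ.<⇒≤ (<u a∈)))
  ; downward  = λ p<q (a , a∈ , q<) → a , a∈ , ℚ.<-trans p<q q<
  ; rounded   = λ (a , a∈ , p<) →
                  let q , p<q , q< = ℚ.<-dense p< in q , p<q , a , a∈ , q<
  }

sumʳ : List ℝ → ℝ
sumʳ = foldr _+ʳ_ 0ʳ

infixr 8 _^ℤ_

_^ℤ_ : (b : ℕ) .{{_ : ℕ.NonZero b}} → ℤ → ℚ
b ^ℤ (+ m)    = fromℕ b ^ m
b ^ℤ -[1+ m ] = (1/ fromℕ b) ^ suc m

-- For r > 0 this says b ^ p ≤ r, cleared of the denominator of p.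

_^_≼_ : (b : ℕ) .{{_ : ℕ.NonZero b}} → ℚ → ℚ → Set
b ^ p ≼ r = b ^ℤ (↥ p) ℚ.≤ r ^ (↧ₙ p)

fromℕ-mono-≤ : ∀ {m n} → m ℕ.≤ n → fromℕ m ℚ.≤ fromℕ n
fromℕ-mono-≤ {m} {n} m≤n = ℚ.*≤* (ℤ.*-monoʳ-≤-nonNeg (+ 1) (ℤ.+≤+ m≤n))

fromℕ-mono-< : ∀ {m n} → m ℕ.< n → fromℕ m ℚ.< fromℕ n
fromℕ-mono-< {m} {n} m<n = ℚ.*<* (ℤ.*-monoʳ-<-pos (+ 1) (ℤ.+<+ m<n))

fromℕ-* : ∀ m n → fromℕ (m ℕ.* n) ≡ fromℕ m ℚ.* fromℕ n
fromℕ-* m n = trans (sym (ℚ.fromℚᵘ-toℚᵘ (fromℕ (m ℕ.* n))))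
  (cong (ℚ._/ 1) (ℤ.pos-* m n))

fromℕ-^ : ∀ b m → fromℕ (b ℕ.^ m) ≡ fromℕ b ^ m
fromℕ-^ b zero    = refl
fromℕ-^ b (suc m) = trans (fromℕ-* b (b ℕ.^ m)) (cong (fromℕ b ℚ.*_) (fromℕ-^ b m))

^-nonNeg : ∀ r → 0ℚ ℚ.≤ r → ∀ n → 0ℚ ℚ.≤ r ^ n
^-nonNeg r 0≤r zero    = from-yes (0ℚ ℚ.≤? 1ℚ)
^-nonNeg r 0≤r (suc n) = subst (ℚ._≤ r ℚ.* r ^ n) (ℚ.*-zeroʳ r)
  (ℚ.*-monoˡ-≤-nonNeg r {{ℚ.nonNegative 0≤r}} (^-nonNeg r 0≤r n))

^-mono-≤ : ∀ {r s} → 0ℚ ℚ.≤ r → r ℚ.≤ s → ∀ n → r ^ n ℚ.≤ s ^ n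
^-mono-≤         0≤r r≤s zero    = ℚ.≤-refl
^-mono-≤ {r} {s} 0≤r r≤s (suc n) = ℚ.≤-trans
  (ℚ.*-monoʳ-≤-nonNeg (r ^ n) {{ℚ.nonNegative (^-nonNeg r 0≤r n)}} r≤s)
  (ℚ.*-monoˡ-≤-nonNeg s {{ℚ.nonNegative (ℚ.≤-trans 0≤r r≤s)}} (^-mono-≤ 0≤r r≤s n))

n<b^n : ∀ b .{{_ : NonTrivial b}} n → n ℕ.< b ℕ.^ n
n<b^n b zero    = ℕ.s≤s ℕ.z≤n
n<b^n b (suc n) = ℕ.≤-<-trans (n<b^n b n)
  (ℕ.^-monoʳ-< b (ℕ.nonTrivial⇒n>1 b) (ℕ.n<1+n n))

1/b^n*b^n : ∀ b .{{_ : ℕ.NonZero b}} n → (1/ fromℕ b) ^ n ℚ.* fromℕ b ^ n ≡ 1ℚ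
1/b^n*b^n b zero    = refl
1/b^n*b^n b (suc n) = begin
  (i ℚ.* i ^ n) ℚ.* (c ℚ.* c ^ n)
    ≡⟨ solve 4 (λ w x y z → ((w :* x) :* (y :* z)) := ((w :* y) :* (x :* z)))
         refl i (i ^ n) c (c ^ n) ⟩
  (i ℚ.* c) ℚ.* (i ^ n ℚ.* c ^ n) ≡⟨ cong₂ ℚ._*_ (ℚ.*-inverseˡ c) (1/b^n*b^n b n) ⟩
  1ℚ                              ∎
  where
    open ≡-Reasoning
    open +-*-Solver
    c = fromℕ b
    i = 1/ c

≤∣↥∣ : ∀ u → u ℚ.≤ fromℕ ℤ.∣ ↥ u ∣
≤∣↥∣ (mkℚ (+ n) d _)    = ℚ.*≤* (ℤ.*-monoˡ-≤-nonNeg (+ n) (ℤ.+≤+ (ℕ.s≤s ℕ.z≤n)))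
≤∣↥∣ (mkℚ -[1+ n ] d _) = ℚ.*≤* ℤ.-≤+

-- b ^ (- D) ≤ r, where D is the denominator of r.
log-inhabited : ∀ b .{{_ : NonTrivial b}} r → 0ℚ ℚ.< r →
                ∃[ p ] (_^_≼_ b {{ℕ.nonTrivial⇒nonZero b}} p r)
log-inhabited b r@(mkℚ +[1+ s ] d _) 0<r = fromℤ -[1+ d ] , goal
  where
    instance _ = ℕ.nonTrivial⇒nonZero b
    c = fromℕ b
    D = suc d
    c^D≡ = fromℕ-^ b D
    1/D : ℚ
    1/D = 1/ fromℕ D
    1/D≤r : 1/D ℚ.≤ r
    1/D≤r = ℚ.*≤* (ℤ.*-monoʳ-≤-nonNeg (+ D) (ℤ.+≤+ (ℕ.s≤s (ℕ.z≤n {s}))))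
    1≤ : fromℕ D ℚ.* 1/D ℚ.≤ c ^ D ℚ.* 1/D
    1≤ = ℚ.*-monoʳ-≤-nonNeg 1/D (subst (fromℕ D ℚ.≤_) c^D≡ (fromℕ-mono-≤ (ℕ.<⇒≤ (n<b^n b D))))
    0<c^D : 0ℚ ℚ.< c ^ D
    0<c^D = subst (0ℚ ℚ.<_) c^D≡ (fromℕ-mono-< (ℕ.m^n>0 b D))
    step : (1/ c) ^ D ℚ.* c ^ D ℚ.≤ 1/D ℚ.* c ^ D
    step = subst₂ ℚ._≤_ (trans (ℚ.*-inverseʳ (fromℕ D)) (sym (1/b^n*b^n b D)))
             (ℚ.*-comm (c ^ D) 1/D) 1≤
    goal : (1/ c) ^ D ℚ.≤ r ^ 1
    goal = subst ((1/ c) ^ D ℚ.≤_) (sym (ℚ.*-identityʳ r))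
      (ℚ.≤-trans (ℚ.*-cancelʳ-≤-pos (c ^ D) {{ℚ.positive 0<c^D}} step) 1/D≤r)
log-inhabited b (mkℚ (+ 0) d _) (ℚ.*<* (ℤ.+<+ ()))
log-inhabited b (mkℚ -[1+ s ] d _) (ℚ.*<* ())

log-bounded : ∀ b .{{_ : NonTrivial b}} M p r → 0ℚ ℚ.< r → r ℚ.≤ fromℕ M →
              _^_≼_ b {{ℕ.nonTrivial⇒nonZero b}} p r → p ℚ.< fromℕ M
log-bounded b M p r 0<r r≤M b^p≤r with p ℚ.<? fromℕ M
... | yes p<M = p<M
... | no  p≮M = contradiction (bad p (ℚ.≮⇒≥ p≮M) b^p≤r) λ ()
  where
    instance _ = ℕ.nonTrivial⇒nonZero b
    bad : ∀ p → fromℕ M ℚ.≤ p → b ^ p ≼ r → 0 ≡ 1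
    bad p@(mkℚ (+ a) d _) (ℚ.*≤* M≤p) b^p≤r = contradiction
      (ℚ.<-≤-trans M^D<b^a (ℚ.≤-trans b^p≤r r^D≤M^D)) (ℚ.<-irrefl refl)
      where
        D = suc d
        MD≤a : M ℕ.* D ℕ.≤ a
        MD≤a = ℤ.drop‿+≤+ (subst₂ ℤ._≤_ (sym (ℤ.pos-* M D)) (ℤ.*-identityʳ (+ a)) M≤p)
        r^D≤M^D : r ^ D ℚ.≤ fromℕ M ^ D
        r^D≤M^D = ^-mono-≤ (ℚ.<⇒≤ 0<r) r≤M D
        nat : M ℕ.^ D ℕ.< b ℕ.^ a
        nat = ℕ.<-≤-trans (ℕ.^-monoˡ-< D (n<b^n b M))
          (subst (ℕ._≤ b ℕ.^ a) (sym (ℕ.^-*-assoc b M D)) (ℕ.^-monoʳ-≤ b MD≤a))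
        M^D<b^a : fromℕ M ^ D ℚ.< fromℕ b ^ a
        M^D<b^a = subst₂ ℚ._<_ (fromℕ-^ M D) (fromℕ-^ b a) (fromℕ-mono-< nat)
    bad p@(mkℚ -[1+ _ ] _ _) M≤p _
      with ℚ.≤-trans (fromℕ-mono-≤ {0} {M} ℕ.z≤n) M≤p
    ... | ℚ.*≤* ()

-- q < log_b x iff b ^ p ≤ r for some rationals p > q and 0 < r < x.

logBase : (b : ℕ) .{{_ : NonTrivial b}} (x : ℝ) → x ∋ 0ℚ → ℝ
logBase b x x>0 = record
  { _∋_       = λ q → ∃[ p ] ∃[ r ] (q ℚ.< p × 0ℚ ℚ.< r × x ∋ r × b ^ p ≼ r)
  ; inhabited = let r , 0<r , r∈ = ℝ.rounded x x>0
                    p , b^p≤r    = log-inhabited b r 0<r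
                in p ℚ.- 1ℚ , p , r , p-1<p p , 0<r , r∈ , b^p≤r
  ; bounded   = let u , <u = ℝ.bounded x
                    M      = ℤ.∣ ↥ u ∣
                in fromℕ M , λ (p , r , q<p , 0<r , r∈ , b^p≤r) →
                     ℚ.<-trans q<p
                       (log-bounded b M p r 0<r (ℚ.≤-trans (ℚ.<⇒≤ (<u r∈)) (≤∣↥∣ u)) b^p≤r)
  ; downward  = λ q′<q (p , r , q<p , rest) → p , r , ℚ.<-trans q′<q q<p , rest
  ; rounded   = λ (p , r , q<p , rest) →
                  let q′ , q<q′ , q′<p = ℚ.<-dense q<p in q′ , q<q′ , p , r , q′<p , rest
  }
  where instance _ = ℕ.nonTrivial⇒nonZero b

log : (x : ℝ) → x ∋ 0ℚ → ℝ
log = logBase 2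

-- The value at n = 0 is a dummy.

logBaseℕ : (b : ℕ) .{{_ : NonTrivial b}} → ℕ → ℝ
logBaseℕ b zero      = 0ʳ
logBaseℕ b n@(suc _) = logBase b (fromℚ (fromℕ n)) (fromℕ-mono-< (ℕ.s≤s ℕ.z≤n))

logℕ : ℕ → ℝ
logℕ = logBaseℕ 2

-- log (log n), read as 0 for n = 1; the value at n = 0 is a dummy.

loglogℕ : ℕ → ℝ
loglogℕ (suc (suc n)) = log (logℕ (suc (suc n))) 0<log
  where
    3/2 = + 3 ℚ./ 2
    0<log : logℕ (suc (suc n)) ∋ 0ℚ
    0<log = ℚ.½ , 3/2 , from-yes (0ℚ ℚ.<? ℚ.½) , from-yes (0ℚ ℚ.<? 3/2)
          , ℚ.<-≤-trans (from-yes (3/2 ℚ.<? fromℕ 2)) (fromℕ-mono-≤ (ℕ.s≤s (ℕ.s≤s ℕ.z≤n)))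
          , from-yes (2 ^ℤ (↥ ℚ.½) ℚ.≤? 3/2 ^ 2)
loglogℕ _ = 0ʳ

-- f = o(g), for non-negative f and g.

IsLittleO : (f g : ℕ → ℝ) → Set
IsLittleO f g = ∀ ε .{{_ : Positive ε}} →
  ∃[ N ] ∀ n → N ℕ.≤ n → f n ≤ʳ _·_ ε {{ℚ.pos⇒nonNeg ε}} (g n)

-- (m / n) x; the value at n = 0 is a dummy.

share : (m n : ℕ) → ℝ → ℝ
share m zero      x = 0ʳ
share m n@(suc _) x = _·_ (+ m ℚ./ n) {{ℚ.normalize-nonNeg m n}} x

-- (m / n) log (n / m), and 0 for m = 0; the value at n = 0 is a dummy.

entropyTerm : (m n : ℕ) → ℝ
entropyTerm m@(suc _) n@(suc _) =
  share m n (log (fromℚ (+ n ℚ./ m)) (ℚ.positive⁻¹ _ {{ℚ.normalize-pos n m}}))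
entropyTerm _ _ = 0ʳ

module _ {σ : ℕ} where

  count : Fin σ → List (Fin σ) → ℕ
  count c T = length (filter (c Fin.≟_) T)

  H₀ : List (Fin σ) → ℝ
  H₀ T = sumʳ (map (λ c → entropyTerm (count c T) (length T)) (allFin σ))

  -- The symbol following W when W is a prefix of the string (as a list
  -- of length at most 1).

  next : List (Fin σ) → List (Fin σ) → List (Fin σ)
  next []      []      = []
  next []      (c ∷ _) = [ c ]
  next (_ ∷ _) []      = []
  next (w ∷ W) (c ∷ T) with w Fin.≟ c
  ... | yes _ = next W T
  ... | no  _ = []

  -- T_W

  following : List (Fin σ) → List (Fin σ) → List (Fin σ)
  following W []        = []
  following W T@(_ ∷ T′) = next W T ++ following W T′

  Σ^ : ℕ → List (List (Fin σ))
  Σ^ zero    = [ [] ]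
  Σ^ (suc k) = cartesianProductWith _∷_ (allFin σ) (Σ^ k)

  H : ℕ → List (Fin σ) → ℝ
  H k T = sumʳ (map (λ W → share (length (following W T)) (length T) (H₀ (following W T))) (Σ^ k))

data Phrase {a} (A : Set a) : Set a where
  literal : A → Phrase A
  copying : List A → Phrase A

module _ {A : Set} where

  infix 4 _IsPrefixOf_ _IsSubstringOf_

  _IsPrefixOf_ : List A → List A → Set
  _IsPrefixOf_ = Prefix _≡_

  _IsSubstringOf_ : List A → List A → Set
  _IsSubstringOf_ = Infix _≡_

  content : Phrase A → List A
  content (literal c) = [ c ]
  content (copying w) = w

  -- Greedy S i u ps: the string u, which starts after i symbols of the
  -- text, is parsed into ps by repeatedly taking the longest prefix w of
  -- the remaining string such that S i w holds at its position i, or a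
  -- literal if only the empty prefix qualifies.

  data Greedy (S : ℕ → List A → Set) : ℕ → List A → List (Phrase A) → Set where
    end  : ∀ {i} → Greedy S i [] []
    copy : ∀ {i u w v ps} → u ≡ w ++ v → w ≢ [] → S i w →
           (∀ {w′} → w′ IsPrefixOf u → S i w′ → length w′ ℕ.≤ length w) →
           Greedy S (i ℕ.+ length w) v ps →
           Greedy S i u (copying w ∷ ps)
    lit  : ∀ {i c v ps} →
           (∀ {w′} → w′ IsPrefixOf (c ∷ v) → S i w′ → w′ ≡ []) →
           Greedy S (suc i) v ps →
           Greedy S i (c ∷ v) (literal c ∷ ps)

  -- Positions are 0-based: w occurs at position j of T when w is a prefix
  -- of drop j T.

  OccursBefore : List A → ℕ → List A → Set
  OccursBefore T i w = ∃[ j ] (j ℕ.< i × w IsPrefixOf drop j T)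

  LZ : List A → List (Phrase A) → Set
  LZ T = Greedy (OccursBefore T) 0 T

  RLZ : List A → List A → List (Phrase A) → Set
  RLZ T R = Greedy (λ _ w → w IsSubstringOf R) 0 T

  -- Turns a parsing of the metasymbol string map content ps into a
  -- parsing of the text.

  expand : List (Phrase (List A)) → List (Phrase A) → List (Phrase A)
  expand (literal _  ∷ qs) (p ∷ ps) = p ∷ expand qs ps
  expand (copying ws ∷ qs) ps       = copying (concat ws) ∷ expand qs (drop (length ws) ps)
  expand _                 _        = []

-- The metasymbol of a phrase is its content, so two metasymbols are equal
-- iff the phrases are equal as strings.

record ReLZ {A : Set} (ℓ : ℕ) (T : List A) (result : List (Phrase A)) : Set where
  field
    {prefixPhrases} : List (Phrase A)
    {suffixPhrases} : List (Phrase A)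
    {metaPhrases}   : List (Phrase (List A))
    prefixParsed : LZ (take ℓ T) prefixPhrases
    suffixParsed : RLZ (drop ℓ T) (take ℓ T) suffixPhrases
    metaParsed   : LZ (map content (prefixPhrases ++ suffixPhrases)) metaPhrases
    expanded     : result ≡ expand metaPhrases (prefixPhrases ++ suffixPhrases)

-- symbol c stands for the pair (c , 0).

data Code (A : Set) : Set where
  symbol : A → Code A
  pair   : (d ℓ : ℕ) → Code A

module _ {A : Set} where

  -- The phrase w at (0-based) position i has a source at distance d.

  SourceAt : List A → ℕ → List A → ℕ → Set
  SourceAt T i w d = 1 ℕ.≤ d × d ℕ.≤ i × w IsPrefixOf drop (i ℕ.∸ d) T

  data RightmostFrom (T : List A) : ℕ → List (Phrase A) → List (Code A) → Set where
    end  : ∀ {i} → RightmostFrom T i [] []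
    lit  : ∀ {i c ps es} →
           RightmostFrom T (suc i) ps es →
           RightmostFrom T i (literal c ∷ ps) (symbol c ∷ es)
    copy : ∀ {i w d ps es} →
           SourceAt T i w d →
           (∀ {d′} → SourceAt T i w d′ → d ℕ.≤ d′) →
           RightmostFrom T (i ℕ.+ length w) ps es →
           RightmostFrom T i (copying w ∷ ps) (pair d (length w) ∷ es)

  RightmostEncoding : List A → List (Phrase A) → List (Code A) → Set
  RightmostEncoding T = RightmostFrom T 0

-- bits e is the number of bits taken by the pair e; C is the constant
-- hidden in O(·).

record BitBound (C σ : ℕ) (bits : Code (Fin σ) → ℝ) : Set where
  field
    literalBits : ∀ c → bits (symbol c) ≤ʳ
      logℕ σ +ʳ fromℕ C · (fromℚ 1ℚ +ʳ loglogℕ σ)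
    copyingBits : ∀ d ℓ → 1 ℕ.≤ d → 1 ℕ.≤ ℓ → bits (pair d ℓ) ≤ʳ
      logℕ d +ʳ fromℕ C · (fromℚ 1ℚ +ʳ loglogℕ d +ʳ logℕ ℓ)

{-# OPTIONS --safe #-}
module Submission where

-- Let w be the phrases, z their number, and D the distance of a phrase (σ for a literal).  The source
-- of a phrase is at most as far away as the previous phrase with the same content, so for each word
-- the distances of its phrases add up to at most n + σ.  Hence ∑ D Q(w) ≤ n + σ = O(n) for every
-- probability distribution Q on words, and since log y ≤ t + y / 2 ^ t this gives
-- ∑ log D ≤ ∑ log (1 / Q(w)) + t z + O(n / 2 ^ t).  Take for Q the order-k empirical model of T, started
-- with k uniform symbols; then ∑ log (1 / Q(w)) ≤ n H_k(T) + z k log σ + (small terms).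
-- Finally z = O(n / log_σ n): the concatenations of two consecutive phrases are distinct, for the LZ
-- parses by maximality, and from metasymbols to strings because an RLZ parse is determined by the
-- parsed string.  With t ≈ log log n all error terms are o(n log σ).

open import Defs
import Algebra.Definitions.RawSemiring
import Algebra.Properties.CommutativeSemiring.Exp as CExp
import Algebra.Properties.Semiring.Exp as Exp
import Algebra.Properties.Semiring.Sum as Sum
import Algebra.Bundles
open import Data.Bool.Base using (true; false; if_then_else_)
open import Data.Fin.Base as Fin using (Fin)
import Data.Fin.Properties as Fin
open import Data.Integer.Base as ℤ using (ℤ; +_; -[1+_]; +[1+_])
import Data.Integer.Properties as ℤ
import Data.Integer.Tactic.RingSolver as ℤSolver
open import Data.List.Base as List
  using (List; []; _∷_; [_]; _++_; length; map; take; drop; foldr; allFin; filter;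
         concat; cartesianProductWith)
import Data.List.Properties as List
open import Data.List.Membership.Propositional using (_∈_)
open import Data.List.Membership.Propositional.Properties
  using (∈-cartesianProductWith⁺; ∈-allFin; ∈-∃++; ∈-++⁻; ∈-++⁺ˡ; ∈-++⁺ʳ; ∈-filter⁻)
open import Data.List.Relation.Binary.Prefix.Heterogeneous using ([]; _∷_)
open import Data.List.Relation.Unary.All as All using (All; []; _∷_)
open import Data.List.Relation.Unary.AllPairs using ([]; _∷_)
open import Data.List.Relation.Unary.Any using (here; there)
open import Data.List.Relation.Unary.Unique.Propositional using (Unique)
import Data.List.Relation.Unary.All.Properties as All
import Data.List.Relation.Unary.Unique.Propositional.Properties as Unique
open import Data.Maybe.Base as Maybe using (Maybe; just; nothing)
open import Data.Nat.Base as ℕ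
  using (ℕ; zero; suc; _≤_; _<_; _+_; _*_; _∸_; NonTrivial; n>1⇒nonTrivial; z≤n; s≤s)
open import Data.Nat.ListAction using (sum; product)
import Data.Nat.Properties as ℕ
import Data.Nat.DivMod as ℕ
open import Data.Nat.Tactic.RingSolver using (solve-∀)
open import Data.Product.Base using (∃-syntax; _×_; _,_; proj₁; proj₂)
open import Data.Rational.Base as ℚ
  using (ℚ; mkℚ; 0ℚ; 1ℚ; ½; ↥_; ↧ₙ_; 1/_; Positive; NonNegative)
open import Data.Rational.Literals using (fromℤ)
open import Data.Rational.Properties as ℚ using (pos⇒nonNeg)
open import Data.Rational.Solver using (module +-*-Solver)
import Data.Rational.Unnormalised.Base as ℚᵘ
import Data.Rational.Unnormalised.Properties as ℚᵘ
open import Data.Sum.Base using (_⊎_; inj₁; inj₂)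
open import Function.Base using (_∘_)
open import Relation.Binary.PropositionalEquality
  using (_≡_; _≢_; refl; sym; trans; cong; cong₂; subst; subst₂; module ≡-Reasoning)
open import Relation.Nullary.Decidable using (Dec; does; yes; no; from-yes)
open import Relation.Nullary.Negation using (¬_; contradiction)

open Algebra.Definitions.RawSemiring ℚ.+-*-rawSemiring using (_^_)

-- Powers of rationals

-- Reals are only lower cuts, without subtraction, so the inequality between sums of logarithms is
-- proved as one between rational products: twice the product of the distances is at most a power of
-- 2 times `entropyProduct`, the rational form of 2 ^ (n H_k(T)). The passage back to reals needs
-- log (r s) ≤ log r + log s. For lower cuts this is the harder half of additivity, because
-- approximations of both logarithms have to be produced from one of their sum; `LogAbove-split`
-- does this. Phrases differ in length, so Q must be a distribution on words of all lengths. The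
-- length weights 1 / ((i + 1) (i + 2)) cost O(log |w|) bits per phrase, no more than the O-terms of
-- the encoding itself. The bound log y ≤ t + y / 2 ^ t takes the place of concavity: its variable
-- part is linear in D Q(w), so only the sum of these products matters. Metasymbols of the prefix do
-- not come from an RLZ parse. The phrases of the metastring that begin among them are therefore
-- charged to the LZ phrases of the prefix, and only the remaining ones are compared as strings.

<⇒≱ : ∀ {p q} → p ℚ.< q → ¬ (q ℚ.≤ p)
<⇒≱ p<q q≤p = ℚ.<-irrefl refl (ℚ.<-≤-trans p<q q≤p)

≤-byDiff : ∀ {p q r} → 0ℚ ℚ.≤ r → q ≡ p ℚ.+ r → p ℚ.≤ q
≤-byDiff {p} {r = r} 0≤r refl = subst (ℚ._≤ p ℚ.+ r) (ℚ.+-identityʳ p) (ℚ.+-monoʳ-≤ p 0≤r)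

<-byDiff : ∀ {p q r} → 0ℚ ℚ.< r → q ≡ p ℚ.+ r → p ℚ.< q
<-byDiff {p} {r = r} 0<r refl = subst (ℚ._< p ℚ.+ r) (ℚ.+-identityʳ p) (ℚ.+-monoʳ-< p 0<r)

0≤diff : ∀ {p q} → p ℚ.≤ q → 0ℚ ℚ.≤ q ℚ.- p
0≤diff {p} {q} p≤q = subst (ℚ._≤ q ℚ.- p) (ℚ.+-inverseʳ p) (ℚ.+-monoˡ-≤ (ℚ.- p) p≤q)

0<diff : ∀ {p q} → p ℚ.< q → 0ℚ ℚ.< q ℚ.- p
0<diff {p} {q} p<q = subst (ℚ._< q ℚ.- p) (ℚ.+-inverseʳ p) (ℚ.+-monoˡ-< (ℚ.- p) p<q)

*-mono : ∀ {a b c d} → 0ℚ ℚ.≤ a → a ℚ.≤ b → 0ℚ ℚ.≤ c → c ℚ.≤ d → a ℚ.* c ℚ.≤ b ℚ.* d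
*-mono {a} {b} {c} {d} 0≤a a≤b 0≤c c≤d = ℚ.≤-trans
  (ℚ.*-monoʳ-≤-nonNeg c {{ℚ.nonNegative 0≤c}} a≤b)
  (ℚ.*-monoˡ-≤-nonNeg b {{ℚ.nonNegative (ℚ.≤-trans 0≤a a≤b)}} c≤d)

*-monoˡ : ∀ {a b c} → 0ℚ ℚ.≤ c → a ℚ.≤ b → c ℚ.* a ℚ.≤ c ℚ.* b
*-monoˡ {c = c} 0≤c = ℚ.*-monoˡ-≤-nonNeg c {{ℚ.nonNegative 0≤c}}

*-monoʳ : ∀ {a b c} → 0ℚ ℚ.≤ c → a ℚ.≤ b → a ℚ.* c ℚ.≤ b ℚ.* c
*-monoʳ {c = c} 0≤c = ℚ.*-monoʳ-≤-nonNeg c {{ℚ.nonNegative 0≤c}}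

*-monoˡ-< : ∀ {a b c} → 0ℚ ℚ.< c → a ℚ.< b → c ℚ.* a ℚ.< c ℚ.* b
*-monoˡ-< {c = c} 0<c = ℚ.*-monoʳ-<-pos c {{ℚ.positive 0<c}}

*-monoʳ-< : ∀ {a b c} → 0ℚ ℚ.< c → a ℚ.< b → a ℚ.* c ℚ.< b ℚ.* c
*-monoʳ-< {c = c} 0<c = ℚ.*-monoˡ-<-pos c {{ℚ.positive 0<c}}

*-cancelʳ : ∀ {a b c} → 0ℚ ℚ.< c → a ℚ.* c ℚ.≤ b ℚ.* c → a ℚ.≤ b
*-cancelʳ {c = c} 0<c = ℚ.*-cancelʳ-≤-pos c {{ℚ.positive 0<c}}

*-cancelʳ-< : ∀ {a b c} → 0ℚ ℚ.≤ c → a ℚ.* c ℚ.< b ℚ.* c → a ℚ.< b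
*-cancelʳ-< {c = c} 0≤c = ℚ.*-cancelʳ-<-nonNeg c {{ℚ.nonNegative 0≤c}}

0≤* : ∀ {a b} → 0ℚ ℚ.≤ a → 0ℚ ℚ.≤ b → 0ℚ ℚ.≤ a ℚ.* b
0≤* {a} {b} 0≤a 0≤b = subst (ℚ._≤ a ℚ.* b) (ℚ.*-zeroʳ a) (*-monoˡ 0≤a 0≤b)

0<* : ∀ {a b} → 0ℚ ℚ.< a → 0ℚ ℚ.< b → 0ℚ ℚ.< a ℚ.* b
0<* {a} {b} 0<a 0<b = subst (ℚ._< a ℚ.* b) (ℚ.*-zeroʳ a) (*-monoˡ-< 0<a 0<b)

1≤* : ∀ {a b} → 1ℚ ℚ.≤ a → 1ℚ ℚ.≤ b → 1ℚ ℚ.≤ a ℚ.* b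
1≤* 1≤a 1≤b = *-mono 0≤1 1≤a 0≤1 1≤b
  where 0≤1 = from-yes (0ℚ ℚ.≤? 1ℚ)

0≤+ : ∀ {a b} → 0ℚ ℚ.≤ a → 0ℚ ℚ.≤ b → 0ℚ ℚ.≤ a ℚ.+ b
0≤+ {a} {b} 0≤a 0≤b = subst (ℚ._≤ a ℚ.+ b) (ℚ.+-identityˡ 0ℚ) (ℚ.+-mono-≤ 0≤a 0≤b)

0≤+0< : ∀ {a b} → 0ℚ ℚ.≤ a → 0ℚ ℚ.< b → 0ℚ ℚ.< a ℚ.+ b
0≤+0< {a} {b} 0≤a 0<b = subst (ℚ._< a ℚ.+ b) (ℚ.+-identityˡ 0ℚ) (ℚ.+-mono-≤-< 0≤a 0<b)

0<1ℚ : 0ℚ ℚ.< 1ℚ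
0<1ℚ = from-yes (0ℚ ℚ.<? 1ℚ)

0≤1ℚ : 0ℚ ℚ.≤ 1ℚ
0≤1ℚ = ℚ.<⇒≤ 0<1ℚ

0≤fromℕ : ∀ n → 0ℚ ℚ.≤ fromℕ n
0≤fromℕ n = fromℕ-mono-≤ {0} {n} z≤n

0<fromℕ : ∀ {n} → 0 < n → 0ℚ ℚ.< fromℕ n
0<fromℕ = fromℕ-mono-<

fromℕ-+ : ∀ m n → fromℕ (m + n) ≡ fromℕ m ℚ.+ fromℕ n
fromℕ-+ m n = trans (sym (ℚ.fromℚᵘ-toℚᵘ (fromℕ (m + n))))
  (cong (ℚ._/ 1) (trans (ℤ.pos-+ m n)
    (cong₂ ℤ._+_ (sym (ℤ.*-identityʳ (+ m))) (sym (ℤ.*-identityʳ (+ n))))))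

fromℕ-cancel-≤ : ∀ {m n} → fromℕ m ℚ.≤ fromℕ n → m ≤ n
fromℕ-cancel-≤ m≤n = ℕ.≮⇒≥ λ n<m → <⇒≱ (fromℕ-mono-< n<m) m≤n

ℚ-semiring = Algebra.Bundles.CommutativeRing.commutativeSemiring ℚ.+-*-commutativeRing

open Exp (Algebra.Bundles.CommutativeSemiring.semiring ℚ-semiring)
  using (^-homo-*; ^-assocʳ)
open CExp ℚ-semiring using (^-distrib-*)

0≤^ : ∀ {r} → 0ℚ ℚ.≤ r → ∀ n → 0ℚ ℚ.≤ r ^ n
0≤^ {r} = ^-nonNeg r

0<^ : ∀ {r} → 0ℚ ℚ.< r → ∀ n → 0ℚ ℚ.< r ^ n
0<^ 0<r zero    = 0<1ℚ
0<^ 0<r (suc n) = 0<* 0<r (0<^ 0<r n)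

1≤^ : ∀ {r} → 1ℚ ℚ.≤ r → ∀ n → 1ℚ ℚ.≤ r ^ n
1≤^ 1≤r zero    = ℚ.≤-refl
1≤^ 1≤r (suc n) = 1≤* 1≤r (1≤^ 1≤r n)

^-monoˡ-< : ∀ {r s} → 0ℚ ℚ.≤ r → r ℚ.< s → ∀ n → r ^ suc n ℚ.< s ^ suc n
^-monoˡ-< {r} {s} 0≤r r<s zero    = subst₂ ℚ._<_ (sym (ℚ.*-identityʳ r)) (sym (ℚ.*-identityʳ s)) r<s
^-monoˡ-< {r} {s} 0≤r r<s (suc n) = ℚ.≤-<-trans
  (*-monoˡ 0≤r (ℚ.<⇒≤ (^-monoˡ-< 0≤r r<s n)))
  (*-monoʳ-< (0<^ (ℚ.≤-<-trans 0≤r r<s) (suc n)) r<s)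

^-cancel-≤ : ∀ {r s} → 0ℚ ℚ.≤ s → ∀ n .{{_ : ℕ.NonZero n}} → r ^ n ℚ.≤ s ^ n → r ℚ.≤ s
^-cancel-≤ {r} {s} 0≤s (suc n) r^n≤s^n with r ℚ.≤? s
... | yes r≤s = r≤s
... | no  r≰s = contradiction r^n≤s^n (<⇒≱ (^-monoˡ-< 0≤s (ℚ.≰⇒> r≰s) n))

-- b ^ (m - n) ≤ r ^ D without negative exponents.
Pow : (b m n D : ℕ) → ℚ → Set
Pow b m n D r = fromℕ b ^ m ℚ.≤ r ^ D ℚ.* fromℕ b ^ n

fromℕ^-mono : ∀ b .{{_ : ℕ.NonZero b}} {m n} → m ≤ n → fromℕ b ^ m ℚ.≤ fromℕ b ^ n
fromℕ^-mono b {m} {n} m≤n =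
  subst₂ ℚ._≤_ (fromℕ-^ b m) (fromℕ-^ b n) (fromℕ-mono-≤ (ℕ.^-monoʳ-≤ b m≤n))

fromℕ^-reflect : ∀ b .{{_ : NonTrivial b}} {m n} →
                 fromℕ b ^ m ℚ.< fromℕ b ^ n → m < n
fromℕ^-reflect b {m} {n} lt = ℕ.≰⇒> λ n≤m →
  <⇒≱ lt (fromℕ^-mono b {{ℕ.nonTrivial⇒nonZero b}} n≤m)

-- The hypothesis on the exponents says (m - n) / D ≤ (m′ - n′) / D′.
Pow-rescale : ∀ b .{{_ : ℕ.NonZero b}} {m n D m′ n′ D′ r} .{{_ : ℕ.NonZero D′}} → 0ℚ ℚ.< r →
              m * D′ + n′ * D ≤ m′ * D + n * D′ →
              Pow b m′ n′ D′ r → Pow b m n D r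
Pow-rescale b {m} {n} {D} {m′} {n′} {D′} {r} 0<r le pow =
  -- Comparing D′-th powers, multiplied by B ^ (n′ * D), allows the D-th power of the hypothesis to
  -- be used without roots or negative exponents.
  ^-cancel-≤ (0≤* (0≤^ (ℚ.<⇒≤ 0<r) D) (0≤^ 0≤B n)) D′
    (*-cancelʳ (0<^ 0<B (n′ * D)) (begin
      (B ^ m) ^ D′ ℚ.* B ^ (n′ * D)
        ≡⟨ cong (ℚ._* B ^ (n′ * D)) (^-assocʳ B m D′) ⟩
      B ^ (m * D′) ℚ.* B ^ (n′ * D)
        ≡⟨ ^-homo-* B (m * D′) (n′ * D) ⟨
      B ^ (m * D′ + n′ * D)
        ≤⟨ fromℕ^-mono b le ⟩
      B ^ (m′ * D + n * D′)
        ≡⟨ ^-homo-* B (m′ * D) (n * D′) ⟩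
      B ^ (m′ * D) ℚ.* B ^ (n * D′)
        ≡⟨ cong (ℚ._* B ^ (n * D′)) (^-assocʳ B m′ D) ⟨
      (B ^ m′) ^ D ℚ.* B ^ (n * D′)
        ≤⟨ *-monoʳ (0≤^ 0≤B (n * D′)) (^-mono-≤ (0≤^ 0≤B m′) pow D) ⟩
      (r ^ D′ ℚ.* B ^ n′) ^ D ℚ.* B ^ (n * D′)
        ≡⟨ cong (ℚ._* B ^ (n * D′)) (^-distrib-* (r ^ D′) (B ^ n′) D) ⟩
      ((r ^ D′) ^ D ℚ.* (B ^ n′) ^ D) ℚ.* B ^ (n * D′)
        ≡⟨ cong₂ (λ x y → x ℚ.* y ℚ.* B ^ (n * D′))
             (trans (^-assocʳ r D′ D) (trans (cong (r ^_) (ℕ.*-comm D′ D)) (sym (^-assocʳ r D D′))))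
             (^-assocʳ B n′ D) ⟩
      ((r ^ D) ^ D′ ℚ.* B ^ (n′ * D)) ℚ.* B ^ (n * D′)
        ≡⟨ solve 3 (λ x y z → (x :* y) :* z := (x :* z) :* y) refl
             ((r ^ D) ^ D′) (B ^ (n′ * D)) (B ^ (n * D′)) ⟩
      ((r ^ D) ^ D′ ℚ.* B ^ (n * D′)) ℚ.* B ^ (n′ * D)
        ≡⟨ cong (λ x → (r ^ D) ^ D′ ℚ.* x ℚ.* B ^ (n′ * D)) (^-assocʳ B n D′) ⟨
      ((r ^ D) ^ D′ ℚ.* (B ^ n) ^ D′) ℚ.* B ^ (n′ * D)
        ≡⟨ cong (ℚ._* B ^ (n′ * D)) (^-distrib-* (r ^ D) (B ^ n) D′) ⟨
      (r ^ D ℚ.* B ^ n) ^ D′ ℚ.* B ^ (n′ * D) ∎))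
  where
    open ℚ.≤-Reasoning
    open +-*-Solver
    B = fromℕ b
    0<B : 0ℚ ℚ.< B
    0<B = 0<fromℕ (ℕ.>-nonZero⁻¹ b)
    0≤B = ℚ.<⇒≤ 0<B

-- Logarithms

p*↧p≡↥p : ∀ p → p ℚ.* fromℕ (↧ₙ p) ≡ fromℤ (↥ p)
p*↧p≡↥p p@record{} = ℚ.toℚᵘ-injective (ℚᵘ.≃-trans (ℚ.toℚᵘ-homo-* p (fromℕ (↧ₙ p)))
  (ℚᵘ.*≡* (lem (↥ p) (+ ↧ₙ p))))
  where
    lem : ∀ a d → (a ℤ.* d) ℤ.* + 1 ≡ a ℤ.* (d ℤ.* + 1)
    lem = ℤSolver.solve-∀

archimedean : ∀ {x} → 0ℚ ℚ.< x → ∃[ K ] 1ℚ ℚ.≤ x ℚ.* fromℕ (suc K)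
archimedean {x@(mkℚ +[1+ n ] d _)} _ = d , subst (1ℚ ℚ.≤_) (sym (p*↧p≡↥p x)) (fromℕ-mono-≤ {1} {suc n} (s≤s z≤n))
archimedean {mkℚ (+ 0) d _} (ℚ.*<* (ℤ.+<+ ()))
archimedean {mkℚ -[1+ _ ] d _} (ℚ.*<* ())

posPart negPart : ℤ → ℕ
posPart (+ m)    = m
posPart -[1+ _ ] = 0
negPart (+ _)    = 0
negPart -[1+ m ] = suc m

fromℤ-parts : ∀ z → fromℤ z ≡ fromℕ (posPart z) ℚ.- fromℕ (negPart z)
fromℤ-parts (+ m)    = sym (ℚ.+-identityʳ (fromℕ m))
fromℤ-parts -[1+ m ] = sym (ℚ.+-identityˡ (fromℤ -[1+ m ]))

≼⇒Pow : ∀ b .{{_ : ℕ.NonZero b}} p {r} → b ^ p ≼ r →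
        Pow b (posPart (↥ p)) (negPart (↥ p)) (↧ₙ p) r
≼⇒Pow b (mkℚ (+ m) d _) {r} b^p≤r = subst (fromℕ b ^ m ℚ.≤_) (sym (ℚ.*-identityʳ (r ^ suc d))) b^p≤r
≼⇒Pow b (mkℚ -[1+ m ] d _) {r} b^p≤r = subst (ℚ._≤ r ^ suc d ℚ.* fromℕ b ^ suc m) (1/b^n*b^n b (suc m))
  (*-monoʳ (0≤^ (0≤fromℕ b) (suc m)) b^p≤r)

Pow⇒≼ : ∀ b .{{_ : ℕ.NonZero b}} p {r} →
        Pow b (posPart (↥ p)) (negPart (↥ p)) (↧ₙ p) r → b ^ p ≼ r
Pow⇒≼ b (mkℚ (+ m) d _) {r} pow = subst (fromℕ b ^ m ℚ.≤_) (ℚ.*-identityʳ (r ^ suc d)) pow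
Pow⇒≼ b (mkℚ -[1+ m ] d _) {r} pow = *-cancelʳ (0<^ (0<fromℕ (ℕ.>-nonZero⁻¹ b)) (suc m))
  (subst (ℚ._≤ r ^ suc d ℚ.* fromℕ b ^ suc m) (sym (1/b^n*b^n b (suc m))) pow)

-- A witness that q < log_b x: q < (m - n) / D and b ^ (m - n) ≤ r ^ D for some r < x.
record LogAbove (b : ℕ) (x q : ℚ) : Set where
  constructor logAbove
  field
    {m n D-1}  : ℕ
    {r}        : ℚ
    0<r        : 0ℚ ℚ.< r
    r<x        : r ℚ.< x
    below      : q ℚ.* fromℕ (suc D-1) ℚ.+ fromℕ n ℚ.< fromℕ m
    pow        : Pow b m n (suc D-1) r

module _ {b : ℕ} .{{_ : NonTrivial b}} {x : ℚ} {x>0 : 0ℚ ℚ.< x} where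

  private instance
    b≢0 : ℕ.NonZero b
    b≢0 = ℕ.nonTrivial⇒nonZero b

  log⇒LogAbove : ∀ {q} → logBase b (fromℚ x) x>0 ∋ q → LogAbove b x q
  log⇒LogAbove {q} (p , r , q<p , 0<r , r<x , b^p≤r) = logAbove 0<r r<x below (≼⇒Pow b p {r} b^p≤r)
    where
      open ℚ.≤-Reasoning
      open +-*-Solver
      a = fromℕ (posPart (↥ p))
      c = fromℕ (negPart (↥ p))
      below : q ℚ.* fromℕ (↧ₙ p) ℚ.+ c ℚ.< a
      below = begin-strict
        q ℚ.* fromℕ (↧ₙ p) ℚ.+ c <⟨ ℚ.+-monoˡ-< c (*-monoʳ-< (0<fromℕ (s≤s z≤n)) q<p) ⟩
        p ℚ.* fromℕ (↧ₙ p) ℚ.+ c ≡⟨ cong (ℚ._+ c) (trans (p*↧p≡↥p p) (fromℤ-parts (↥ p))) ⟩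
        (a ℚ.- c) ℚ.+ c          ≡⟨ solve 2 (λ a c → (a :- c) :+ c := a) refl a c ⟩
        a ∎

  -- `logBase` speaks of an exponent in lowest terms, the witness of arbitrary m, n and D. Both
  -- describe the same rational, so the condition of `Pow-rescale` holds with equality.
  LogAbove⇒log : ∀ {q} → LogAbove b x q → logBase b (fromℚ x) x>0 ∋ q
  LogAbove⇒log {q} (logAbove {m} {n} {D-1} {r} 0<r r<x below pow) =
    p , r , q<p , 0<r , r<x ,
    Pow⇒≼ b p {r} (Pow-rescale b {posPart (↥ p)} {negPart (↥ p)} {↧ₙ p} {m} {n} {suc D-1} 0<r (fromℕ-cancel-≤ (ℚ.≤-reflexive exps)) pow)
    where
      open +-*-Solver
      D = fromℕ (suc D-1)
      1/D = 1/ D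
      p = (fromℕ m ℚ.- fromℕ n) ℚ.* 1/D
      p*D : p ℚ.* D ≡ fromℕ m ℚ.- fromℕ n
      p*D = trans (ℚ.*-assoc (fromℕ m ℚ.- fromℕ n) 1/D D)
        (trans (cong ((fromℕ m ℚ.- fromℕ n) ℚ.*_) (ℚ.*-inverseˡ D)) (ℚ.*-identityʳ (fromℕ m ℚ.- fromℕ n)))
      q<p : q ℚ.< p
      q<p = *-cancelʳ-< (0≤fromℕ (suc D-1)) (<-byDiff (0<diff below) (trans p*D
        (solve 3 (λ x n m → m :- n := x :+ (m :- (x :+ n))) refl (q ℚ.* D) (fromℕ n) (fromℕ m))))
      a = posPart (↥ p)
      c = negPart (↥ p)
      d = ↧ₙ p
      exps : fromℕ (a * suc D-1 + n * d) ≡ fromℕ (m * d + c * suc D-1)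
      exps = begin
        fromℕ (a * suc D-1 + n * d)
          ≡⟨ trans (fromℕ-+ (a * suc D-1) (n * d)) (cong₂ ℚ._+_ (fromℕ-* a (suc D-1)) (fromℕ-* n d)) ⟩
        fromℕ a ℚ.* D ℚ.+ fromℕ n ℚ.* fromℕ d
          ≡⟨ solve 5 (λ a c D n d → a :* D :+ n :* d := (a :- c) :* D :+ (c :* D :+ n :* d)) refl
               (fromℕ a) (fromℕ c) D (fromℕ n) (fromℕ d) ⟩
        (fromℕ a ℚ.- fromℕ c) ℚ.* D ℚ.+ (fromℕ c ℚ.* D ℚ.+ fromℕ n ℚ.* fromℕ d)
          ≡⟨ cong (λ x → x ℚ.* D ℚ.+ (fromℕ c ℚ.* D ℚ.+ fromℕ n ℚ.* fromℕ d))
               (sym (trans (p*↧p≡↥p p) (fromℤ-parts (↥ p)))) ⟩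
        (p ℚ.* fromℕ d) ℚ.* D ℚ.+ (fromℕ c ℚ.* D ℚ.+ fromℕ n ℚ.* fromℕ d)
          ≡⟨ solve 5 (λ p d D c n → (p :* d) :* D :+ (c :* D :+ n :* d) := (p :* D) :* d :+ (c :* D :+ n :* d)) refl
               p (fromℕ d) D (fromℕ c) (fromℕ n) ⟩
        (p ℚ.* D) ℚ.* fromℕ d ℚ.+ (fromℕ c ℚ.* D ℚ.+ fromℕ n ℚ.* fromℕ d)
          ≡⟨ cong (λ x → x ℚ.* fromℕ d ℚ.+ (fromℕ c ℚ.* D ℚ.+ fromℕ n ℚ.* fromℕ d)) p*D ⟩
        (fromℕ m ℚ.- fromℕ n) ℚ.* fromℕ d ℚ.+ (fromℕ c ℚ.* D ℚ.+ fromℕ n ℚ.* fromℕ d)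
          ≡⟨ solve 5 (λ m n d c D → (m :- n) :* d :+ (c :* D :+ n :* d) := m :* d :+ c :* D) refl
               (fromℕ m) (fromℕ n) (fromℕ d) (fromℕ c) D ⟩
        fromℕ m ℚ.* fromℕ d ℚ.+ fromℕ c ℚ.* D
          ≡⟨ trans (fromℕ-+ (m * d) (c * suc D-1)) (cong₂ ℚ._+_ (fromℕ-* m d) (fromℕ-* c (suc D-1))) ⟨
        fromℕ (m * d + c * suc D-1) ∎
        where open ≡-Reasoning

LogAbove-mono : ∀ {b x y q} → x ℚ.≤ y → LogAbove b x q → LogAbove b y q
LogAbove-mono x≤y (logAbove 0<r r<x below pow) = logAbove 0<r (ℚ.<-≤-trans r<x x≤y) below pow

-- The two witnesses are brought to a common denominator and multiplied. This is the easy half of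
-- additivity; `LogAbove-split` is the other.
LogAbove-* : ∀ {b} .{{_ : ℕ.NonZero b}} {x y q₁ q₂} → LogAbove b x q₁ → LogAbove b y q₂ →
             LogAbove b (x ℚ.* y) (q₁ ℚ.+ q₂)
LogAbove-* {b} {x} {y} {q₁} {q₂} (logAbove {m₁} {n₁} {d₁} {r} 0<r r<x below₁ pow₁)
                         (logAbove {m₂} {n₂} {d₂} {s} 0<s s<y below₂ pow₂) =
  logAbove {m = m₁ * suc d₂ + m₂ * suc d₁} {n = n₁ * suc d₂ + n₂ * suc d₁} {D-1 = d₂ + d₁ * suc d₂}
    (0<* 0<r 0<s)
    (ℚ.<-trans (*-monoʳ-< 0<s r<x) (*-monoˡ-< (ℚ.<-trans 0<r r<x) s<y))
    below (begin
      B ^ (m₁ * suc d₂ + m₂ * suc d₁)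
        ≡⟨ ^-homo-* B (m₁ * suc d₂) (m₂ * suc d₁) ⟩
      B ^ (m₁ * suc d₂) ℚ.* B ^ (m₂ * suc d₁)
        ≤⟨ *-mono (0≤^ 0≤B (m₁ * suc d₂))
             (Pow-rescale b {m₁ * suc d₂} {n₁ * suc d₂} {E} {m₁} {n₁} {suc d₁} 0<r (ℕ.≤-reflexive (lem₁ m₁ n₁ (suc d₁) (suc d₂))) pow₁)
             (0≤^ 0≤B (m₂ * suc d₁))
             (Pow-rescale b {m₂ * suc d₁} {n₂ * suc d₁} {E} {m₂} {n₂} {suc d₂} 0<s (ℕ.≤-reflexive (lem₂ m₂ n₂ (suc d₁) (suc d₂))) pow₂) ⟩
      (r ^ E ℚ.* B ^ (n₁ * suc d₂)) ℚ.* (s ^ E ℚ.* B ^ (n₂ * suc d₁))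
        ≡⟨ solve 4 (λ w x y z → (w :* x) :* (y :* z) := (w :* y) :* (x :* z)) refl
             (r ^ E) (B ^ (n₁ * suc d₂)) (s ^ E) (B ^ (n₂ * suc d₁)) ⟩
      (r ^ E ℚ.* s ^ E) ℚ.* (B ^ (n₁ * suc d₂) ℚ.* B ^ (n₂ * suc d₁))
        ≡⟨ cong₂ ℚ._*_ (^-distrib-* r s E) (^-homo-* B (n₁ * suc d₂) (n₂ * suc d₁)) ⟨
      (r ℚ.* s) ^ E ℚ.* B ^ (n₁ * suc d₂ + n₂ * suc d₁) ∎)
  where
    open ℚ.≤-Reasoning
    open +-*-Solver
    B = fromℕ b
    0≤B = 0≤fromℕ b
    E = suc d₁ * suc d₂
    D₁ = fromℕ (suc d₁)
    D₂ = fromℕ (suc d₂)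
    lem₁ : ∀ m n d e → (m * e) * d + n * (d * e) ≡ m * (d * e) + (n * e) * d
    lem₁ = solve-∀
    lem₂ : ∀ m n d e → (m * d) * e + n * (d * e) ≡ m * (d * e) + (n * d) * e
    lem₂ = solve-∀
    expand-ℚ : ∀ m₁ m₂ → fromℕ (m₁ * suc d₂ + m₂ * suc d₁) ≡ fromℕ m₁ ℚ.* D₂ ℚ.+ fromℕ m₂ ℚ.* D₁
    expand-ℚ m₁ m₂ = trans (fromℕ-+ (m₁ * suc d₂) (m₂ * suc d₁)) (cong₂ ℚ._+_ (fromℕ-* m₁ (suc d₂)) (fromℕ-* m₂ (suc d₁)))
    below : (q₁ ℚ.+ q₂) ℚ.* fromℕ E ℚ.+ fromℕ (n₁ * suc d₂ + n₂ * suc d₁) ℚ.< fromℕ (m₁ * suc d₂ + m₂ * suc d₁)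
    below = begin-strict
      (q₁ ℚ.+ q₂) ℚ.* fromℕ E ℚ.+ fromℕ (n₁ * suc d₂ + n₂ * suc d₁)
        ≡⟨ cong₂ (λ u v → (q₁ ℚ.+ q₂) ℚ.* u ℚ.+ v) (fromℕ-* (suc d₁) (suc d₂)) (expand-ℚ n₁ n₂) ⟩
      (q₁ ℚ.+ q₂) ℚ.* (D₁ ℚ.* D₂) ℚ.+ (fromℕ n₁ ℚ.* D₂ ℚ.+ fromℕ n₂ ℚ.* D₁)
        ≡⟨ solve 6 (λ q₁ q₂ D₁ D₂ n₁ n₂ → (q₁ :+ q₂) :* (D₁ :* D₂) :+ (n₁ :* D₂ :+ n₂ :* D₁)
                := (q₁ :* D₁ :+ n₁) :* D₂ :+ (q₂ :* D₂ :+ n₂) :* D₁) refl q₁ q₂ D₁ D₂ (fromℕ n₁) (fromℕ n₂) ⟩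
      (q₁ ℚ.* D₁ ℚ.+ fromℕ n₁) ℚ.* D₂ ℚ.+ (q₂ ℚ.* D₂ ℚ.+ fromℕ n₂) ℚ.* D₁
        <⟨ ℚ.+-mono-< (*-monoʳ-< (0<fromℕ (s≤s z≤n)) below₁) (*-monoʳ-< (0<fromℕ (s≤s z≤n)) below₂) ⟩
      fromℕ m₁ ℚ.* D₂ ℚ.+ fromℕ m₂ ℚ.* D₁ ≡⟨ expand-ℚ m₁ m₂ ⟨
      fromℕ (m₁ * suc d₂ + m₂ * suc d₁) ∎

floorLog≥1 : ∀ M {y} → 1ℚ ℚ.≤ y → y ℚ.< fromℕ 2 ^ M →
             ∃[ a ] (fromℕ 2 ^ a ℚ.≤ y × y ℚ.< fromℕ 2 ^ suc a)
floorLog≥1 zero    1≤y y<1 = contradiction 1≤y (<⇒≱ y<1)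
floorLog≥1 (suc M) {y} 1≤y y<2^ with y ℚ.<? fromℕ 2 ^ M
... | yes y<  = floorLog≥1 M 1≤y y<
... | no  y≮  = M , ℚ.≮⇒≥ y≮ , y<2^

<2^ : ∀ y → ∃[ M ] y ℚ.< fromℕ 2 ^ M
<2^ y = ℤ.∣ ↥ y ∣ , ℚ.≤-<-trans (≤∣↥∣ y)
  (subst (fromℕ ℤ.∣ ↥ y ∣ ℚ.<_) (fromℕ-^ 2 ℤ.∣ ↥ y ∣) (fromℕ-mono-< (n<b^n 2 ℤ.∣ ↥ y ∣)))

-- The factor 2 ^ c lifts x to at least 1, so that a can be a natural number; the floor of log x is
-- a - c.
floorLog : ∀ {x} → 0ℚ ℚ.< x → ∃[ a ] ∃[ c ]
           (fromℕ 2 ^ a ℚ.≤ x ℚ.* fromℕ 2 ^ c × x ℚ.* fromℕ 2 ^ c ℚ.< fromℕ 2 ^ suc a)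
floorLog {x} 0<x =
  let K , 1≤xK = archimedean 0<x
      c = suc K
      1≤ : 1ℚ ℚ.≤ x ℚ.* fromℕ 2 ^ c
      1≤ = ℚ.≤-trans 1≤xK (*-monoˡ (ℚ.<⇒≤ 0<x)
             (subst (fromℕ c ℚ.≤_) (fromℕ-^ 2 c) (fromℕ-mono-≤ (ℕ.<⇒≤ (n<b^n 2 c)))))
      M , y<2^M = <2^ (x ℚ.* fromℕ 2 ^ c)
      a , lo , hi = floorLog≥1 M 1≤ y<2^M
  in a , c , lo , hi

-- Choose t between u / s and r, then v between u / t and s.
split-< : ∀ {u r s} → 0ℚ ℚ.< u → 0ℚ ℚ.< r → 0ℚ ℚ.< s → u ℚ.< r ℚ.* s →
          ∃[ t ] ∃[ v ] (0ℚ ℚ.< t × 0ℚ ℚ.< v × t ℚ.< r × v ℚ.< s × u ℚ.≤ t ℚ.* v)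
split-< {u} {r} {s} 0<u 0<r 0<s u<rs =
  t , v , 0<t , ℚ.<-trans (0<* 0<u (0<1/ 0<t)) u/t<v , t<r , v<s , (begin
    u                       ≡⟨ /* 0<t u ⟨
    (u ℚ.* inv 0<t) ℚ.* t   ≡⟨ ℚ.*-comm _ t ⟩
    t ℚ.* (u ℚ.* inv 0<t)   ≤⟨ *-monoˡ (ℚ.<⇒≤ 0<t) (ℚ.<⇒≤ u/t<v) ⟩
    t ℚ.* v                 ∎)
  where
    open ℚ.≤-Reasoning
    inv : ∀ {x} → 0ℚ ℚ.< x → ℚ
    inv {x} 0<x = (1/ x) {{ℚ.>-nonZero 0<x}}
    0<1/ : ∀ {x} (0<x : 0ℚ ℚ.< x) → 0ℚ ℚ.< inv 0<x
    0<1/ {x} 0<x = ℚ.positive⁻¹ _ {{ℚ.1/pos⇒pos x {{ℚ.positive 0<x}}}}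
    /* : ∀ {x} (0<x : 0ℚ ℚ.< x) y → (y ℚ.* inv 0<x) ℚ.* x ≡ y
    /* {x} 0<x y = trans (ℚ.*-assoc y (inv 0<x) x)
      (trans (cong (y ℚ.*_) (ℚ.*-inverseˡ x {{ℚ.>-nonZero 0<x}})) (ℚ.*-identityʳ y))
    u/s<r : u ℚ.* inv 0<s ℚ.< r
    u/s<r = *-cancelʳ-< (ℚ.<⇒≤ 0<s) (subst (ℚ._< r ℚ.* s) (sym (/* 0<s u)) u<rs)
    t = proj₁ (ℚ.<-dense u/s<r)
    u/s<t = proj₁ (proj₂ (ℚ.<-dense u/s<r))
    t<r = proj₂ (proj₂ (ℚ.<-dense u/s<r))
    0<t : 0ℚ ℚ.< t
    0<t = ℚ.<-trans (0<* 0<u (0<1/ 0<s)) u/s<t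
    u/t<s : u ℚ.* inv 0<t ℚ.< s
    u/t<s = *-cancelʳ-< (ℚ.<⇒≤ 0<t) (subst₂ ℚ._<_ (trans (/* 0<s u) (sym (/* 0<t u))) (ℚ.*-comm t s) (*-monoʳ-< 0<s u/s<t))
    v = proj₁ (ℚ.<-dense u/t<s)
    u/t<v = proj₁ (proj₂ (ℚ.<-dense u/t<s))
    v<s = proj₂ (proj₂ (ℚ.<-dense u/t<s))

-- t and v are approximated with the precision 1 / E, where E = D K and K is so large that 3 / K
-- is below the slack in q D + n < m.
LogAbove-split : ∀ {r s q} → 0ℚ ℚ.< r → 0ℚ ℚ.< s → LogAbove 2 (r ℚ.* s) q →
  ∃[ q₁ ] ∃[ q₂ ] (LogAbove 2 r q₁ × LogAbove 2 s q₂ × q ℚ.< q₁ ℚ.+ q₂)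
LogAbove-split {r} {s} {q} 0<r 0<s (logAbove {m} {n} {d} {u} 0<u u<rs below pow) =
  let t , v , 0<t , 0<v , t<r , v<s , u≤tv = split-< 0<u 0<r 0<s u<rs
      k , 1≤δk = archimedean (0<diff below)
      -- Each floor loses less than 1 in its exponent, and another 1 is subtracted in q₁ and in q₂
      -- to make their witnesses strict. As `key` is strict between natural numbers, the total loss
      -- is at most 3, whereas K times the slack is at least 4.
      K = 4 * suc k
      -- Chosen so that `suc e` unfolds to E, the form in which `logAbove` takes its denominator.
      e = k + 3 * suc k + d * K
      E = suc d * K
      a , c , lo , hi = floorLog (0<^ 0<t E)
      a′ , c′ , lo′ , hi′ = floorLog (0<^ 0<v E)
      q₁ = (fromℕ a ℚ.- fromℕ c ℚ.- 1ℚ) ℚ.* 1/ fromℕ E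
      q₂ = (fromℕ a′ ℚ.- fromℕ c′ ℚ.- 1ℚ) ℚ.* 1/ fromℕ E
      key : m * K + (c + c′) < (suc a + suc a′) + n * K
      key = fromℕ^-reflect 2 (begin-strict
        B ^ (m * K + (c + c′))              ≡⟨ ^-homo-* B (m * K) (c + c′) ⟩
        B ^ (m * K) ℚ.* B ^ (c + c′)
          ≤⟨ *-monoʳ (0≤^ 0≤B (c + c′)) (Pow-rescale 2 {m * K} {n * K} {E} {m} {n} {suc d} 0<u
               (ℕ.≤-reflexive (rescaleLem m n (suc d) K)) pow) ⟩
        (u ^ E ℚ.* B ^ (n * K)) ℚ.* B ^ (c + c′)
          ≤⟨ *-monoʳ (0≤^ 0≤B (c + c′)) (*-monoʳ (0≤^ 0≤B (n * K)) (^-mono-≤ (ℚ.<⇒≤ 0<u) u≤tv E)) ⟩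
        ((t ℚ.* v) ^ E ℚ.* B ^ (n * K)) ℚ.* B ^ (c + c′)
          ≡⟨ cong₂ (λ x y → (x ℚ.* B ^ (n * K)) ℚ.* y) (^-distrib-* t v E) (^-homo-* B c c′) ⟩
        ((t ^ E ℚ.* v ^ E) ℚ.* B ^ (n * K)) ℚ.* (B ^ c ℚ.* B ^ c′)
          ≡⟨ solve 5 (λ t v n c d → ((t :* v) :* n) :* (c :* d) := ((t :* c) :* (v :* d)) :* n) refl
               (t ^ E) (v ^ E) (B ^ (n * K)) (B ^ c) (B ^ c′) ⟩
        ((t ^ E ℚ.* B ^ c) ℚ.* (v ^ E ℚ.* B ^ c′)) ℚ.* B ^ (n * K)
          <⟨ *-monoʳ-< (0<^ 0<B (n * K)) (ℚ.<-trans
               (*-monoʳ-< (0<* (0<^ 0<v E) (0<^ 0<B c′)) hi)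
               (*-monoˡ-< (0<^ 0<B (suc a)) hi′)) ⟩
        (B ^ suc a ℚ.* B ^ suc a′) ℚ.* B ^ (n * K)
          ≡⟨ trans (^-homo-* B (suc a + suc a′) (n * K)) (cong (ℚ._* B ^ (n * K)) (^-homo-* B (suc a) (suc a′))) ⟨
        B ^ ((suc a + suc a′) + n * K)      ∎)
      bound : ∀ {r} t a c → 0ℚ ℚ.< t → t ℚ.< r → fromℕ 2 ^ a ℚ.≤ t ^ E ℚ.* fromℕ 2 ^ c →
              LogAbove 2 r ((fromℕ a ℚ.- fromℕ c ℚ.- 1ℚ) ℚ.* 1/ fromℕ E)
      bound t a c 0<t t<r lo = logAbove {m = a} {n = c} {D-1 = e} {r = t} 0<t t<r
        (<-byDiff 0<1ℚ (trans
          (solve 2 (λ a c → a := (a :- c :- con 1ℚ) :+ c :+ con 1ℚ) refl (fromℕ a) (fromℕ c))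
          (cong (λ x → x ℚ.+ fromℕ c ℚ.+ 1ℚ) (sym (/* (fromℕ a ℚ.- fromℕ c ℚ.- 1ℚ) E)))))
        lo
  in q₁ , q₂ , bound t a c 0<t t<r lo , bound v a′ c′ 0<v v<s lo′ ,
     *-cancelʳ-< (0≤fromℕ E) (begin-strict
       q ℚ.* fromℕ E ≡⟨ cong (q ℚ.*_) (trans (fromℕ-* (suc d) K) (cong (fromℕ (suc d) ℚ.*_) (fromℕ-* 4 (suc k)))) ⟩
       q ℚ.* (fromℕ (suc d) ℚ.* (fromℕ 4 ℚ.* fromℕ (suc k)))
         <⟨ <-byDiff {r = (fromℕ 4 ℚ.* ((fromℕ m ℚ.- (q ℚ.* fromℕ (suc d) ℚ.+ fromℕ n)) ℚ.* fromℕ (suc k) ℚ.- 1ℚ)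
                      ℚ.+ (fromℕ ((suc a + suc a′) + n * K) ℚ.- fromℕ (suc (m * K + (c + c′))))) ℚ.+ 1ℚ}
              (0≤+0< (0≤+ (0≤* (0≤fromℕ 4) (0≤diff 1≤δk)) (0≤diff (fromℕ-mono-≤ key))) 0<1ℚ)
              (trans (solve 9 (λ q D k m n a c a′ c′ →
                      (a :- c :- con 1ℚ) :+ (a′ :- c′ :- con 1ℚ)
                      := q :* (D :* (con (fromℕ 4) :* k)) :+
                         ((con (fromℕ 4) :* ((m :- (q :* D :+ n)) :* k :- con 1ℚ) :+
                         (((con 1ℚ :+ a :+ (con 1ℚ :+ a′)) :+ n :* (con (fromℕ 4) :* k))
                           :- (con 1ℚ :+ (m :* (con (fromℕ 4) :* k) :+ (c :+ c′))))) :+ con 1ℚ)) refl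
                   q (fromℕ (suc d)) (fromℕ (suc k)) (fromℕ m) (fromℕ n) (fromℕ a) (fromℕ c) (fromℕ a′) (fromℕ c′))
                 (cong₂ (λ x y → q ℚ.* (fromℕ (suc d) ℚ.* (fromℕ 4 ℚ.* fromℕ (suc k))) ℚ.+
                     ((fromℕ 4 ℚ.* ((fromℕ m ℚ.- (q ℚ.* fromℕ (suc d) ℚ.+ fromℕ n)) ℚ.* fromℕ (suc k) ℚ.- 1ℚ)
                      ℚ.+ (x ℚ.- y)) ℚ.+ 1ℚ))
                   (sym (trans (fromℕ-+ (suc a + suc a′) (n * K)) (cong₂ ℚ._+_
                     (trans (fromℕ-+ (suc a) (suc a′)) (cong₂ ℚ._+_ (fromℕ-+ 1 a) (fromℕ-+ 1 a′)))
                     (trans (fromℕ-* n K) (cong (fromℕ n ℚ.*_) (fromℕ-* 4 (suc k)))))))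
                   (sym (trans (fromℕ-+ 1 (m * K + (c + c′))) (cong (1ℚ ℚ.+_)
                     (trans (fromℕ-+ (m * K) (c + c′)) (cong₂ ℚ._+_
                       (trans (fromℕ-* m K) (cong (fromℕ m ℚ.*_) (fromℕ-* 4 (suc k)))) (fromℕ-+ c c′)))))))) ⟩
       (fromℕ a ℚ.- fromℕ c ℚ.- 1ℚ) ℚ.+ (fromℕ a′ ℚ.- fromℕ c′ ℚ.- 1ℚ)
         ≡⟨ cong₂ ℚ._+_ (/* (fromℕ a ℚ.- fromℕ c ℚ.- 1ℚ) E) (/* (fromℕ a′ ℚ.- fromℕ c′ ℚ.- 1ℚ) E) ⟨
       q₁ ℚ.* fromℕ E ℚ.+ q₂ ℚ.* fromℕ E ≡⟨ ℚ.*-distribʳ-+ (fromℕ E) q₁ q₂ ⟨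
       (q₁ ℚ.+ q₂) ℚ.* fromℕ E ∎)
  where
    open ℚ.≤-Reasoning
    open +-*-Solver
    B = fromℕ 2
    0<B : 0ℚ ℚ.< B
    0<B = 0<fromℕ (s≤s z≤n)
    0≤B = 0≤fromℕ 2
    rescaleLem : ∀ m n d K → (m * K) * d + n * (d * K) ≡ m * (d * K) + (n * K) * d
    rescaleLem = solve-∀
    /* : ∀ y D .{{_ : ℕ.NonZero D}} → (y ℚ.* 1/ fromℕ D) ℚ.* fromℕ D ≡ y
    /* y D@(suc _) = trans (ℚ.*-assoc y (1/ fromℕ D) (fromℕ D))
      (trans (cong (y ℚ.*_) (ℚ.*-inverseˡ (fromℕ D))) (ℚ.*-identityʳ y))

LogAbove-2^ : ∀ A {x q} → x ℚ.≤ fromℕ 2 ^ A → LogAbove 2 x q → q ℚ.< fromℕ A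
LogAbove-2^ A {x} {q} x≤2^A (logAbove {m} {n} {d} {r} 0<r r<x below pow) =
  *-cancelʳ-< (0≤fromℕ (suc d)) (<-byDiff {r = (fromℕ m ℚ.- (q ℚ.* D ℚ.+ fromℕ n)) ℚ.+ (fromℕ (A * suc d + n) ℚ.- fromℕ m)}
    (subst (0ℚ ℚ.<_) (ℚ.+-comm (fromℕ (A * suc d + n) ℚ.- fromℕ m) _)
      (0≤+0< (0≤diff (fromℕ-mono-≤ m≤)) (0<diff below)))
    (trans (solve 5 (λ A D q n m → A :* D := q :* D :+ ((m :- (q :* D :+ n)) :+ ((A :* D :+ n) :- m))) refl
             (fromℕ A) D q (fromℕ n) (fromℕ m))
           (cong (λ x → q ℚ.* D ℚ.+ ((fromℕ m ℚ.- (q ℚ.* D ℚ.+ fromℕ n)) ℚ.+ (x ℚ.- fromℕ m)))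
             (sym (trans (fromℕ-+ (A * suc d) n) (cong (ℚ._+ fromℕ n) (fromℕ-* A (suc d))))))))
  where
    open +-*-Solver
    D = fromℕ (suc d)
    B = fromℕ 2
    m≤ : m ≤ A * suc d + n
    m≤ = ℕ.≮⇒≥ λ lt → <⇒≱ (subst₂ ℚ._<_ (fromℕ-^ 2 (A * suc d + n)) (fromℕ-^ 2 m)
                              (fromℕ-mono-< (ℕ.^-monoʳ-< 2 (s≤s (s≤s z≤n)) lt)))
      (begin
        B ^ m                          ≤⟨ pow ⟩
        r ^ suc d ℚ.* B ^ n            ≤⟨ *-monoʳ (0≤^ (0≤fromℕ 2) n) (^-mono-≤ (ℚ.<⇒≤ 0<r) (ℚ.≤-trans (ℚ.<⇒≤ r<x) x≤2^A) (suc d)) ⟩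
        (B ^ A) ^ suc d ℚ.* B ^ n      ≡⟨ cong (ℚ._* B ^ n) (^-assocʳ B A (suc d)) ⟩
        B ^ (A * suc d) ℚ.* B ^ n      ≡⟨ ^-homo-* B (A * suc d) n ⟨
        B ^ (A * suc d + n)            ∎)
      where open ℚ.≤-Reasoning

-- log r ≤ x, stated without a proof that r is positive.
LogBelow : ℚ → ℝ → Set
LogBelow r x = ∀ {q} → LogAbove 2 r q → x ∋ q

-- Shows that c · 0ʳ still contains every negative rational. Dividing q by some K > c instead of c
-- covers c = 0 as well.
scale-neg : ∀ c → 0ℚ ℚ.≤ c → ∀ {q} → q ℚ.< 0ℚ → ∃[ a ] (a ℚ.< 0ℚ × q ℚ.< c ℚ.* a)
scale-neg c 0≤c {q} q<0 = a , a<0 , <-byDiff (0<* (0<diff c<K) (0<-neg a<0)) eq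
  where
    open +-*-Solver
    K = suc ℤ.∣ ↥ c ∣
    c<K : c ℚ.< fromℕ K
    c<K = ℚ.≤-<-trans (≤∣↥∣ c) (fromℕ-mono-< (ℕ.n<1+n _))
    0<-neg : ∀ {x} → x ℚ.< 0ℚ → 0ℚ ℚ.< ℚ.- x
    0<-neg {x} x<0 = subst (0ℚ ℚ.<_) (ℚ.+-identityˡ (ℚ.- x)) (0<diff x<0)
    a = q ℚ.* 1/ fromℕ K
    a*K : a ℚ.* fromℕ K ≡ q
    a*K = trans (ℚ.*-assoc q (1/ fromℕ K) (fromℕ K))
      (trans (cong (q ℚ.*_) (ℚ.*-inverseˡ (fromℕ K))) (ℚ.*-identityʳ q))
    a<0 : a ℚ.< 0ℚ
    a<0 = *-cancelʳ-< (0≤fromℕ K) (subst₂ ℚ._<_ (sym a*K) (sym (ℚ.*-zeroˡ (fromℕ K))) q<0)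
    eq : c ℚ.* a ≡ q ℚ.+ (fromℕ K ℚ.- c) ℚ.* (ℚ.- a)
    eq = trans (solve 3 (λ c a K → c :* a := a :* K :+ (K :- c) :* (:- a)) refl c a (fromℕ K))
               (cong (ℚ._+ (fromℕ K ℚ.- c) ℚ.* (ℚ.- a)) a*K)

module _ (c : ℚ) .{{_ : NonNegative c}} where

  logBelow-1 : LogBelow 1ℚ (c · 0ʳ)
  logBelow-1 above = scale-neg c (ℚ.nonNegative⁻¹ c) (LogAbove-2^ 0 ℚ.≤-refl above)

  logBelow-* : ∀ {r s x y} → 0ℚ ℚ.< r → 0ℚ ℚ.< s →
               LogBelow r (c · x) → LogBelow s (c · y) → LogBelow (r ℚ.* s) (c · (x +ʳ y))
  logBelow-* {r} {s} {x} {y} 0<r 0<s rx sy above =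
    let q₁ , q₂ , above₁ , above₂ , q< = LogAbove-split 0<r 0<s above
        a , a∈ , q₁<ca = rx above₁
        b , b∈ , q₂<cb = sy above₂
        -- A sum of cuts contains only numbers strictly below a sum of members, so a + b is a member
        -- only after a has been enlarged.
        a′ , a<a′ , a′∈ = ℝ.rounded x a∈
    in a ℚ.+ b , (a′ , b , a′∈ , b∈ , ℚ.+-monoˡ-< b a<a′)
     , ℚ.<-trans q< (subst (q₁ ℚ.+ q₂ ℚ.<_) (sym (ℚ.*-distribˡ-+ c a b)) (ℚ.+-mono-< q₁<ca q₂<cb))

  logBelow-∏ : ∀ {I : Set} (f : I → ℚ) (x : I → ℝ) → (∀ i → 0ℚ ℚ.< f i) →
               (∀ i → LogBelow (f i) (c · x i)) → ∀ is →
               0ℚ ℚ.< foldr (λ i → f i ℚ.*_) 1ℚ is ×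
               LogBelow (foldr (λ i → f i ℚ.*_) 1ℚ is) (c · sumʳ (map x is))
  logBelow-∏ f x 0<f below []       = 0<1ℚ , logBelow-1
  logBelow-∏ f x 0<f below (i ∷ is) =
    let 0<r , rest = logBelow-∏ f x 0<f below is
    in 0<* (0<f i) 0<r , logBelow-* {x = x i} {y = sumʳ (map x is)} (0<f i) 0<r (below i) rest

-- A member of a multiple of x is witnessed by a single member of x; the larger of a and b serves
-- for both.
scale-suc : ∀ x m {a b q} → x ∋ a → x ∋ b → q ℚ.< a ℚ.+ fromℕ m ℚ.* b → (fromℕ (suc m) · x) ∋ q
scale-suc x m {a} {b} {q} a∈ b∈ q< = a ℚ.⊔ b , max∈ (ℚ.≤-total a b) , ℚ.<-≤-trans q< (begin
    a ℚ.+ fromℕ m ℚ.* b                    ≤⟨ ℚ.+-mono-≤ (ℚ.p≤p⊔q a b) (*-monoˡ (0≤fromℕ m) (ℚ.p≤q⊔p a b)) ⟩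
    (a ℚ.⊔ b) ℚ.+ fromℕ m ℚ.* (a ℚ.⊔ b)    ≡⟨ 1+* (a ℚ.⊔ b) ⟩
    (1ℚ ℚ.+ fromℕ m) ℚ.* (a ℚ.⊔ b)         ≡⟨ cong (ℚ._* (a ℚ.⊔ b)) (fromℕ-+ 1 m) ⟨
    fromℕ (suc m) ℚ.* (a ℚ.⊔ b)            ∎)
  where
    open ℚ.≤-Reasoning
    1+* : ∀ y → y ℚ.+ fromℕ m ℚ.* y ≡ (1ℚ ℚ.+ fromℕ m) ℚ.* y
    1+* y = trans (cong (ℚ._+ fromℕ m ℚ.* y) (sym (ℚ.*-identityˡ y))) (sym (ℚ.*-distribʳ-+ y 1ℚ (fromℕ m)))
    max∈ : a ℚ.≤ b ⊎ b ℚ.≤ a → x ∋ (a ℚ.⊔ b)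
    max∈ (inj₁ a≤b) = subst (x ∋_) (sym (ℚ.p≤q⇒p⊔q≡q a≤b)) b∈
    max∈ (inj₂ b≤a) = subst (x ∋_) (sym (ℚ.p≥q⇒p⊔q≡p b≤a)) a∈

logBelow-^ : ∀ {r x} → 0ℚ ℚ.< r → LogBelow r x → ∀ m → LogBelow (r ^ m) (fromℕ m · x)
logBelow-^ {r} {x} 0<r rx zero {q} above =
  let a , a∈ = ℝ.inhabited x
  in a , a∈ , subst (q ℚ.<_) (sym (ℚ.*-zeroˡ a)) (LogAbove-2^ 0 ℚ.≤-refl above)
logBelow-^ {r} {x} 0<r rx (suc m) {q} above =
  let q₁ , q₂ , above₁ , above₂ , q< = LogAbove-split 0<r (0<^ 0<r m) above
      b , b∈ , q₂<mb = logBelow-^ {r} {x} 0<r rx m above₂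
  in scale-suc x m (rx above₁) b∈ (ℚ.<-trans q< (ℚ.+-monoʳ-< q₁ q₂<mb))

-- Empirical entropies weight by fractions such as |T_W| / n, while exponents of products are the
-- integers |T_W|. This moves the factor n outside.
logBelow-rescale : ∀ {r x} (d e : ℚ) .{{_ : NonNegative d}} .{{_ : NonNegative e}} n →
                   d ≡ fromℕ (suc n) ℚ.* e → LogBelow r (d · x) → LogBelow r (fromℕ (suc n) · (e · x))
logBelow-rescale {r} {x} d e n d≡ rx {q} above =
  let a , a∈ , q<da = rx above
      q/N = q ℚ.* 1/ N
      q/N*N : N ℚ.* q/N ≡ q
      q/N*N = trans (ℚ.*-comm N q/N) (trans (ℚ.*-assoc q (1/ N) N)
        (trans (cong (q ℚ.*_) (ℚ.*-inverseˡ N)) (ℚ.*-identityʳ q)))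
      q/N<ea : q/N ℚ.< e ℚ.* a
      q/N<ea = ℚ.*-cancelˡ-<-nonNeg N (subst₂ ℚ._<_ (sym q/N*N)
        (trans (cong (ℚ._* a) d≡) (ℚ.*-assoc N e a)) q<da)
      b , q/N<b , b<ea = ℚ.<-dense q/N<ea
  in b , (a , a∈ , b<ea) , subst (ℚ._< N ℚ.* b) q/N*N (*-monoˡ-< (0<fromℕ (s≤s z≤n)) q/N<b)
  where N = fromℕ (suc n)

-- Empirical entropy as the logarithm of a rational product

*-/ : ∀ n m .{{_ : ℕ.NonZero m}} → fromℕ m ℚ.* (+ n ℚ./ m) ≡ fromℕ n
*-/ n m@(suc m-1) = ℚ.toℚᵘ-injective (ℚᵘ.≃-trans (ℚ.toℚᵘ-homo-* (fromℕ m) (+ n ℚ./ m))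
  (ℚᵘ.≃-trans (ℚᵘ.*-congˡ {ℚ.toℚᵘ (fromℕ m)} (ℚ.toℚᵘ-fromℚᵘ (ℚᵘ.mkℚᵘ (+ n) m-1)))
    (ℚᵘ.*≡* (lem (+ m) (+ n)))))
  where
    lem : ∀ m n → (m ℤ.* n) ℤ.* + 1 ≡ n ℤ.* (+ 1 ℤ.* m)
    lem = ℤSolver.solve-∀

-- The inverse of an empirical probability. The default 1 keeps all products positive and every
-- ratio with m ≤ N at least 1.
ratio : (m N : ℕ) → ℚ
ratio m@(suc _) N@(suc _) = + N ℚ./ m
ratio _         _         = 1ℚ

0<ratio : ∀ m N → 0ℚ ℚ.< ratio m N
0<ratio (suc m) (suc N) = ℚ.positive⁻¹ _ {{ℚ.normalize-pos (suc N) (suc m)}}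
0<ratio zero    _       = 0<1ℚ
0<ratio (suc _) zero    = 0<1ℚ

1^ : ∀ n → 1ℚ ^ n ≡ 1ℚ
1^ zero    = refl
1^ (suc n) = trans (ℚ.*-identityˡ (1ℚ ^ n)) (1^ n)

logBelow-entropyTerm : ∀ m N → LogBelow (ratio m N ^ m) (fromℕ N · entropyTerm m N)
logBelow-entropyTerm zero    N above = logBelow-1 (fromℕ N) above
logBelow-entropyTerm (suc m) zero above = logBelow-1 (fromℕ 0) (subst (λ r → LogAbove 2 r _) (1^ (suc m)) above)
logBelow-entropyTerm (suc m) (suc N) =
  logBelow-rescale {x = log (fromℚ (+ suc N ℚ./ suc m)) (0<ratio (suc m) (suc N))} (fromℕ (suc m)) (+ suc m ℚ./ suc N)
    {{_}} {{ℚ.normalize-nonNeg (suc m) (suc N)}} N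
    (sym (*-/ (suc m) (suc N)))
    (logBelow-^ {x = log (fromℚ (+ suc N ℚ./ suc m)) (0<ratio (suc m) (suc N))} (0<ratio (suc m) (suc N)) (LogAbove⇒log {x>0 = 0<ratio (suc m) (suc N)}) (suc m))

module _ {σ : ℕ} where

  -- For `Σ^ k` and the strings T_W this is 2 ^ (n H_k(T)): the product of (|T_W| / n_c) ^ n_c over
  -- all contexts W and symbols c, where n_c counts c in T_W.
  entropyProduct : List (List (Fin σ)) → (List (Fin σ) → List (Fin σ)) → ℚ
  entropyProduct Ws U =
    foldr (λ W → foldr (λ c → ratio (count c (U W)) (length (U W)) ^ count c (U W) ℚ.*_) 1ℚ (allFin σ) ℚ.*_) 1ℚ Ws

  logBelow-H : ∀ k T → 1 ≤ length T →
    0ℚ ℚ.< entropyProduct (Σ^ k) (λ W → following W T) ×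
    LogBelow (entropyProduct (Σ^ k) (λ W → following W T)) (fromℕ (length T) · H k T)
  logBelow-H k T@(_ ∷ T′) _ = logBelow-∏ (fromℕ (length T))
    (λ W → foldr (λ c → ratio (count c (following W T)) (length (following W T)) ^ count c (following W T) ℚ.*_) 1ℚ (allFin σ))
    (λ W → share (length (following W T)) (length T) (H₀ (following W T)))
    (λ W → proj₁ (symbols (following W T)))
    (λ W → logBelow-rescale {x = H₀ (following W T)} (fromℕ (length (following W T))) (+ length (following W T) ℚ./ length T)
       {{_}} {{ℚ.normalize-nonNeg (length (following W T)) (length T)}} (length T′)
       (sym (*-/ (length (following W T)) (length T)))
       (proj₂ (symbols (following W T))))
    (Σ^ k)
    where
      symbols : ∀ U → 0ℚ ℚ.< foldr (λ c → ratio (count c U) (length U) ^ count c U ℚ.*_) 1ℚ (allFin σ) ×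
                LogBelow (foldr (λ c → ratio (count c U) (length U) ^ count c U ℚ.*_) 1ℚ (allFin σ)) (fromℕ (length U) · H₀ U)
      symbols U = logBelow-∏ (fromℕ (length U)) (λ c → ratio (count c U) (length U) ^ count c U)
        (λ c → entropyTerm (count c U) (length U))
        (λ c → 0<^ (0<ratio (count c U) (length U)) (count c U))
        (λ c → logBelow-entropyTerm (count c U) (length U)) (allFin σ)

-- Upper bounds for the bits of the codes

fromℚ-mono : ∀ {u v} → u ℚ.≤ v → fromℚ u ≤ʳ fromℚ v
fromℚ-mono u≤v q<u = ℚ.<-≤-trans q<u u≤v

+ʳ-≤-fromℕ : ∀ x y u v → x ≤ʳ fromℚ (fromℕ u) → y ≤ʳ fromℚ (fromℕ v) → x +ʳ y ≤ʳ fromℚ (fromℕ (u + v))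
+ʳ-≤-fromℕ x y u v x≤ y≤ (a , b , a∈ , b∈ , q<) =
  ℚ.<-trans q< (subst (a ℚ.+ b ℚ.<_) (sym (fromℕ-+ u v)) (ℚ.+-mono-< (x≤ a∈) (y≤ b∈)))

·-≤-fromℕ : ∀ c x u → x ≤ʳ fromℚ (fromℕ u) → fromℕ c · x ≤ʳ fromℚ (fromℕ (c * u))
·-≤-fromℕ c x u x≤ (a , a∈ , q<) =
  ℚ.<-≤-trans q< (subst (fromℕ c ℚ.* a ℚ.≤_) (sym (fromℕ-* c u)) (*-monoˡ (0≤fromℕ c) (ℚ.<⇒≤ (x≤ a∈))))

fromℕ-≤-2^ : ∀ {d} A → d ≤ 2 ℕ.^ A → fromℕ d ℚ.≤ fromℕ 2 ^ A
fromℕ-≤-2^ {d} A d≤ = subst (fromℕ d ℚ.≤_) (fromℕ-^ 2 A) (fromℕ-mono-≤ d≤)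

logℕ-≤ : ∀ d A → d ≤ 2 ℕ.^ A → logℕ d ≤ʳ fromℚ (fromℕ A)
logℕ-≤ zero    A _  = fromℚ-mono (0≤fromℕ A)
logℕ-≤ (suc d) A d≤ = LogAbove-2^ A (fromℕ-≤-2^ A d≤) ∘ log⇒LogAbove {x>0 = 0<fromℕ (s≤s z≤n)}

loglogℕ-≤ : ∀ d h → d ≤ 2 ℕ.^ (2 ℕ.^ h) → loglogℕ d ≤ʳ fromℚ (fromℕ h)
loglogℕ-≤ zero          h _  = fromℚ-mono (0≤fromℕ h)
loglogℕ-≤ (suc zero)    h _  = fromℚ-mono (0≤fromℕ h)
loglogℕ-≤ (suc (suc d)) h d≤ (p , r , q<p , 0<r , r∈ , 2^p≤r) =
  LogAbove-2^ h (fromℕ-≤-2^ h ℕ.≤-refl)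
    (log⇒LogAbove {x>0 = 0<fromℕ (ℕ.m^n>0 2 h)} (p , r , q<p , 0<r , logℕ-≤ (suc (suc d)) (2 ℕ.^ h) d≤ r∈ , 2^p≤r))

-- x ≤ log r + e
record LogPlus (r e : ℚ) (x : ℝ) : Set where
  constructor logPlus
  field
    bound : ∀ {q} → x ∋ q → ∃[ a ] (LogAbove 2 r a × q ℚ.< a ℚ.+ e)

-- The slack factor 2 avoids roots of rationals: log 1 ∋ q needs a rational r < 1 close to 1.
logPlus-0 : LogPlus (fromℕ 2) 0ℚ 0ʳ
logPlus-0 = logPlus λ {q} q<0 →
  let a , q<a , a<0 = ℚ.<-dense q<0
  in a , logAbove {m = 0} {n = 0} {D-1 = 0} 0<1ℚ (fromℕ-mono-< (s≤s (s≤s z≤n)))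
           (subst (ℚ._< 0ℚ) (sym (trans (ℚ.+-identityʳ (a ℚ.* 1ℚ)) (ℚ.*-identityʳ a))) a<0) ℚ.≤-refl
       , subst (q ℚ.<_) (sym (ℚ.+-identityʳ a)) q<a

logPlus-+ : ∀ {r s e f x y} → LogPlus r e x → LogPlus s f y → LogPlus (r ℚ.* s) (e ℚ.+ f) (x +ʳ y)
logPlus-+ {e = e} {f} (logPlus bx) (logPlus by) = logPlus λ (a , b , a∈ , b∈ , q<) →
  let u , above₁ , a< = bx a∈
      v , above₂ , b< = by b∈
  in u ℚ.+ v , LogAbove-* above₁ above₂ , ℚ.<-trans q< (subst (a ℚ.+ b ℚ.<_)
       (solve 4 (λ u e v f → (u :+ e) :+ (v :+ f) := (u :+ v) :+ (e :+ f)) refl u e v f)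
       (ℚ.+-mono-< a< b<))
  where open +-*-Solver

logPlus-logℕ : ∀ {d e x y} → 1 ≤ d → x ≤ʳ logℕ d +ʳ y → y ≤ʳ fromℚ e → LogPlus (fromℕ d) e x
logPlus-logℕ {suc d} {e} {x} {y} _ x≤ y≤ = logPlus λ q∈ →
  let a , b , a∈ , b∈ , q< = x≤ q∈
  in a , log⇒LogAbove {x>0 = 0<fromℕ (s≤s z≤n)} a∈ , ℚ.<-trans q< (ℚ.+-monoʳ-< a (y≤ b∈))

infixl 7 _/2^_

_/2^_ : ℕ → ℕ → ℕ
x /2^ t = (x ℕ./ 2 ℕ.^ t) {{ℕ.m^n≢0 2 t}}

/2^-* : ∀ x t → x /2^ t * 2 ℕ.^ t ≤ x
/2^-* x t = ℕ.m/n*n≤m x (2 ℕ.^ t) {{ℕ.m^n≢0 2 t}}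

-- The excess of log x over t is linear in x with the small slope 2 ^ - t, so it adds up to o(n) over all phrases.
<2^[t+] : ∀ t x → x < 2 ℕ.^ (t + x /2^ t)
<2^[t+] t x = begin-strict
  x                                 ≡⟨ ℕ.m≡m%n+[m/n]*n x D ⟩
  x ℕ.% D + x /2^ t * D             <⟨ ℕ.+-monoˡ-< (x /2^ t * D) (ℕ.m%n<n x D) ⟩
  suc (x /2^ t) * D                 ≤⟨ ℕ.*-monoˡ-≤ D (n<b^n 2 (x /2^ t)) ⟩
  2 ℕ.^ (x /2^ t) * D               ≡⟨ ℕ.*-comm (2 ℕ.^ (x /2^ t)) D ⟩
  D * 2 ℕ.^ (x /2^ t)               ≡⟨ ℕ.^-distribˡ-+-* 2 t (x /2^ t) ⟨
  2 ℕ.^ (t + x /2^ t)               ∎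
  where
    open ℕ.≤-Reasoning
    D = 2 ℕ.^ t
    instance _ = ℕ.m^n≢0 2 t

module _ {σ : ℕ} where

  -- A literal counts as a copy from distance σ, which is O(n).
  distance span : Code (Fin σ) → ℕ
  distance (symbol _) = σ
  distance (pair d _) = d
  span (symbol _) = 1
  span (pair _ ℓ) = ℓ

  -- Bounds the O-term of a code: h stands for log log of the distance, and `<2^[t+]` bounds the
  -- logarithm of the length.
  overhead : (C h t : ℕ) → Code (Fin σ) → ℕ
  overhead C h t e = C * (1 + h + (t + span e /2^ t))

  Moderate : ℕ → Code (Fin σ) → Set
  Moderate h e = 1 ≤ distance e × distance e ≤ 2 ℕ.^ (2 ℕ.^ h) × 1 ≤ span e

  -- The logarithms of the distances are merged into one by `logPlus-+`; the factor 2 is the slack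
  -- of `logPlus-0` at the end of the list.
  codes-≤ : ∀ C h t {bits} → BitBound C σ bits → ∀ {codes} → All (Moderate h) codes →
            LogPlus (fromℕ (2 * product (map distance codes)))
                    (fromℕ (sum (map (overhead C h t) codes)))
                    (sumʳ (map bits codes))
  codes-≤ C h t bound [] = logPlus-0
  codes-≤ C h t {bits} bound {e ∷ codes} (mod ∷ mods) =
    subst₂ (λ r f → LogPlus r f (sumʳ (map bits (e ∷ codes))))
      (trans (sym (fromℕ-* (distance e) (2 * product (map distance codes))))
        (cong fromℕ (lem (distance e) (product (map distance codes)))))
      (sym (fromℕ-+ (overhead C h t e) (sum (map (overhead C h t) codes))))
      (logPlus-+ {x = bits e} (code mod) (codes-≤ C h t bound mods))
    where
      lem : ∀ d p → d * (2 * p) ≡ 2 * (d * p)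
      lem = solve-∀
      1≤1 : fromℚ 1ℚ ≤ʳ fromℚ (fromℕ 1)
      1≤1 q<1 = q<1
      code : ∀ {e} → Moderate h e → LogPlus (fromℕ (distance e)) (fromℕ (overhead C h t e)) (bits e)
      code {symbol c} (1≤σ , σ≤ , _) =
        logPlus-logℕ {y = fromℕ C · (fromℚ 1ℚ +ʳ loglogℕ σ)} 1≤σ (BitBound.literalBits bound c)
          (λ {q} q∈ → fromℚ-mono (fromℕ-mono-≤ (ℕ.*-monoʳ-≤ C (ℕ.m≤m+n (1 + h) (t + 1 /2^ t))))
            (·-≤-fromℕ C (fromℚ 1ℚ +ʳ loglogℕ σ) (1 + h)
              (+ʳ-≤-fromℕ (fromℚ 1ℚ) (loglogℕ σ) 1 h 1≤1 (loglogℕ-≤ σ h σ≤)) {q} q∈))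
      code {pair d ℓ} (1≤d , d≤ , 1≤ℓ) =
        logPlus-logℕ {y = fromℕ C · (fromℚ 1ℚ +ʳ loglogℕ d +ʳ logℕ ℓ)} 1≤d (BitBound.copyingBits bound d ℓ 1≤d 1≤ℓ)
          (·-≤-fromℕ C (fromℚ 1ℚ +ʳ loglogℕ d +ʳ logℕ ℓ) (1 + h + (t + ℓ /2^ t))
            (+ʳ-≤-fromℕ (fromℚ 1ℚ +ʳ loglogℕ d) (logℕ ℓ) (1 + h) (t + ℓ /2^ t)
              (+ʳ-≤-fromℕ (fromℚ 1ℚ) (loglogℕ d) 1 h 1≤1 (loglogℕ-≤ d h d≤))
              (logℕ-≤ ℓ (t + ℓ /2^ t) (ℕ.<⇒≤ (<2^[t+] t ℓ)))))

open Sum (Algebra.Bundles.CommutativeSemiring.semiring ℚ-semiring)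
  using () renaming (sum to ∑; *-distribʳ-sum to *-distribʳ-∑)

-- Random words

∑-mono : ∀ {n} {f g : Fin n → ℚ} → (∀ i → f i ℚ.≤ g i) → ∑ f ℚ.≤ ∑ g
∑-mono {zero}  f≤g = ℚ.≤-refl
∑-mono {suc n} f≤g = ℚ.+-mono-≤ (f≤g Fin.zero) (∑-mono (f≤g ∘ Fin.suc))

∑-bump : ∀ {n} {f g : Fin n → ℚ} {e} → (∀ i → f i ℚ.≤ g i) → ∀ c → f c ℚ.+ e ℚ.≤ g c → ∑ f ℚ.+ e ℚ.≤ ∑ g
∑-bump {suc n} {f} {g} {e} f≤g Fin.zero    bump = subst (ℚ._≤ ∑ g)
  (solve 3 (λ x e s → (x :+ e) :+ s := (x :+ s) :+ e) refl (f Fin.zero) e (∑ (f ∘ Fin.suc)))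
  (ℚ.+-mono-≤ bump (∑-mono (f≤g ∘ Fin.suc)))
  where open +-*-Solver
∑-bump {suc n} {f} {g} {e} f≤g (Fin.suc c) bump = subst (ℚ._≤ ∑ g)
  (sym (ℚ.+-assoc (f Fin.zero) (∑ (f ∘ Fin.suc)) e))
  (ℚ.+-mono-≤ (f≤g Fin.zero) (∑-bump (f≤g ∘ Fin.suc) c bump))

∑-const : ∀ n x → ∑ {n} (λ _ → x) ≡ fromℕ n ℚ.* x
∑-const zero    x = sym (ℚ.*-zeroˡ x)
∑-const (suc n) x = trans (cong (x ℚ.+_) (∑-const n x)) (trans
  (solve 2 (λ x n → x :+ n :* x := (con 1ℚ :+ n) :* x) refl x (fromℕ n))
  (cong (ℚ._* x) (sym (fromℕ-+ 1 n))))
  where open +-*-Solver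

∑-cong : ∀ {n} {f g : Fin n → ℚ} → (∀ i → f i ≡ g i) → ∑ f ≡ ∑ g
∑-cong {zero}  f≡g = refl
∑-cong {suc n} f≡g = cong₂ ℚ._+_ (f≡g Fin.zero) (∑-cong (f≡g ∘ Fin.suc))

∑-+ : ∀ {n} (f g : Fin n → ℚ) → ∑ (λ i → f i ℚ.+ g i) ≡ ∑ f ℚ.+ ∑ g
∑-+ {zero}  f g = refl
∑-+ {suc n} f g = trans (cong (f Fin.zero ℚ.+ g Fin.zero ℚ.+_) (∑-+ (f ∘ Fin.suc) (g ∘ Fin.suc)))
  (solve 4 (λ a b c d → (a :+ b) :+ (c :+ d) := (a :+ c) :+ (b :+ d)) refl
    (f Fin.zero) (g Fin.zero) (∑ (f ∘ Fin.suc)) (∑ (g ∘ Fin.suc)))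
  where open +-*-Solver

unit : ℕ → ℚ
unit i = 1/ fromℕ (suc i)

0<unit : ∀ i → 0ℚ ℚ.< unit i
0<unit i = ℚ.positive⁻¹ (unit i) {{ℚ.1/pos⇒pos (fromℕ (suc i))}}

unit-inverse : ∀ i → unit i ℚ.* fromℕ (suc i) ≡ 1ℚ
unit-inverse i = ℚ.*-inverseˡ (fromℕ (suc i))

halt : ℕ → ℚ
halt i = unit i ℚ.* unit (suc i)

0<halt : ∀ i → 0ℚ ℚ.< halt i
0<halt i = 0<* (0<unit i) (0<unit (suc i))

-- The telescoping step: `unit i` is the total weight of all lengths from i on.
halt+unit : ∀ i → halt i ℚ.+ unit (suc i) ≡ unit i
halt+unit i = begin
  a ℚ.* b ℚ.+ b                       ≡⟨ cong (a ℚ.* b ℚ.+_) (sym (trans (cong (ℚ._* b) (unit-inverse i)) (ℚ.*-identityˡ b))) ⟩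
  a ℚ.* b ℚ.+ (a ℚ.* x) ℚ.* b         ≡⟨ solve 3 (λ a b x → a :* b :+ (a :* x) :* b := a :* (b :* (con 1ℚ :+ x))) refl a b x ⟩
  a ℚ.* (b ℚ.* (1ℚ ℚ.+ x))            ≡⟨ cong (λ y → a ℚ.* (b ℚ.* y)) (fromℕ-+ 1 (suc i)) ⟨
  a ℚ.* (b ℚ.* fromℕ (suc (suc i)))   ≡⟨ cong (a ℚ.*_) (unit-inverse (suc i)) ⟩
  a ℚ.* 1ℚ                            ≡⟨ ℚ.*-identityʳ a ⟩
  a                                   ∎
  where
    open ≡-Reasoning
    open +-*-Solver
    a = unit i
    b = unit (suc i)
    x = fromℕ (suc i)

module _ {σ : ℕ} where

  mass : List (List (Fin σ) × ℕ) → List (Fin σ) → ℕ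
  mass []            w = 0
  mass ((w₀ , d) ∷ X) w with List.≡-dec Fin._≟_ w₀ w
  ... | yes _ = d + mass X w
  ... | no  _ = mass X w

-- Words are generated by a random walk that emits the symbol c in state s with probability p s c;
-- a word of length i has the additional weight halt i = 1 / ((i + 1) (i + 2)).  These weights telescope to 1.
module RandomWord {σ : ℕ} {S : Set} (move : S → Fin σ → S) (p : S → Fin σ → ℚ)
                  (0≤p : ∀ s c → 0ℚ ℚ.≤ p s c) (∑p≤1 : ∀ s → ∑ (p s) ℚ.≤ 1ℚ) where

  Word = List (Fin σ)

  prob : ℕ → S → Word → ℚ
  prob i s []      = halt i
  prob i s (c ∷ w) = p s c ℚ.* prob (suc i) (move s c) w

  0≤prob : ∀ i s w → 0ℚ ℚ.≤ prob i s w
  0≤prob i s []      = ℚ.<⇒≤ (0<halt i)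
  0≤prob i s (c ∷ w) = 0≤* (0≤p s c) (0≤prob (suc i) (move s c) w)

  -- Here i symbols have been emitted already, and only continuations by at most m symbols are
  -- counted, which keeps the sum finite.
  expectation : ℕ → ℕ → S → (Word → ℕ) → ℚ
  expectation zero    i s F = halt i ℚ.* fromℕ (F [])
  expectation (suc m) i s F = halt i ℚ.* fromℕ (F []) ℚ.+
    ∑ λ c → p s c ℚ.* expectation m (suc i) (move s c) (F ∘ (c ∷_))

  expectation-≥0 : ∀ m i s F → 0ℚ ℚ.≤ expectation m i s F
  expectation-≥0 zero    i s F = 0≤* (ℚ.<⇒≤ (0<halt i)) (0≤fromℕ (F []))
  expectation-≥0 (suc m) i s F = 0≤+ (0≤* (ℚ.<⇒≤ (0<halt i)) (0≤fromℕ (F [])))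
    (subst (ℚ._≤ ∑ f) (trans (∑-const σ 0ℚ) (ℚ.*-zeroʳ (fromℕ σ)))
      (∑-mono λ c → 0≤* (0≤p s c) (expectation-≥0 m (suc i) (move s c) (F ∘ (c ∷_)))))
    where
      f : Fin σ → ℚ
      f c = p s c ℚ.* expectation m (suc i) (move s c) (F ∘ (c ∷_))

  expectation-mono : ∀ m i s {F G} → (∀ w → F w ≤ G w) → expectation m i s F ℚ.≤ expectation m i s G
  expectation-mono zero    i s F≤G = *-monoˡ (ℚ.<⇒≤ (0<halt i)) (fromℕ-mono-≤ (F≤G []))
  expectation-mono (suc m) i s F≤G = ℚ.+-mono-≤
    (*-monoˡ (ℚ.<⇒≤ (0<halt i)) (fromℕ-mono-≤ (F≤G [])))
    (∑-mono λ c → *-monoˡ (0≤p s c) (expectation-mono m (suc i) (move s c) (F≤G ∘ (c ∷_))))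

  expectation-≤ : ∀ m i s {F D} → (∀ w → F w ≤ D) → expectation m i s F ℚ.≤ unit i ℚ.* fromℕ D
  expectation-≤ zero    i s {F} {D} F≤D = *-mono (ℚ.<⇒≤ (0<halt i))
    (≤-byDiff (ℚ.<⇒≤ (0<unit (suc i))) (sym (halt+unit i))) (0≤fromℕ (F [])) (fromℕ-mono-≤ (F≤D []))
  expectation-≤ (suc m) i s {F} {D} F≤D = begin
    halt i ℚ.* fromℕ (F []) ℚ.+ ∑ (λ c → p s c ℚ.* expectation m (suc i) (move s c) (F ∘ (c ∷_)))
      ≤⟨ ℚ.+-mono-≤ (*-monoˡ (ℚ.<⇒≤ (0<halt i)) (fromℕ-mono-≤ (F≤D [])))
           (∑-mono λ c → *-monoˡ (0≤p s c) (expectation-≤ m (suc i) (move s c) (F≤D ∘ (c ∷_)))) ⟩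
    halt i ℚ.* fromℕ D ℚ.+ ∑ (λ c → p s c ℚ.* (unit (suc i) ℚ.* fromℕ D))
      ≡⟨ cong (halt i ℚ.* fromℕ D ℚ.+_) (*-distribʳ-∑ (unit (suc i) ℚ.* fromℕ D) (p s)) ⟨
    halt i ℚ.* fromℕ D ℚ.+ ∑ (p s) ℚ.* (unit (suc i) ℚ.* fromℕ D)
      ≤⟨ ℚ.+-monoʳ-≤ (halt i ℚ.* fromℕ D)
           (*-monoʳ (0≤* (ℚ.<⇒≤ (0<unit (suc i))) (0≤fromℕ D)) (∑p≤1 s)) ⟩
    halt i ℚ.* fromℕ D ℚ.+ 1ℚ ℚ.* (unit (suc i) ℚ.* fromℕ D)
      ≡⟨ solve 3 (λ a b d → a :* d :+ con 1ℚ :* (b :* d) := (a :+ b) :* d) refl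
           (halt i) (unit (suc i)) (fromℕ D) ⟩
    (halt i ℚ.+ unit (suc i)) ℚ.* fromℕ D
      ≡⟨ cong (ℚ._* fromℕ D) (halt+unit i) ⟩
    unit i ℚ.* fromℕ D ∎
    where
      open ℚ.≤-Reasoning
      open +-*-Solver

  -- The recursion follows w₀ through the tree of words; every branch off this path is only compared
  -- by monotonicity.
  expectation-bump : ∀ m i s {F G} w₀ d → (∀ w → G w ≤ F w) → d + G w₀ ≤ F w₀ → length w₀ ≤ m →
    expectation m i s G ℚ.+ fromℕ d ℚ.* prob i s w₀ ℚ.≤ expectation m i s F
  expectation-bump zero i s {F} {G} [] d G≤F bump _ = subst (ℚ._≤ halt i ℚ.* fromℕ (F []))
    (trans (cong (halt i ℚ.*_) (fromℕ-+ d (G [])))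
      (solve 3 (λ s d g → s :* (d :+ g) := s :* g :+ d :* s) refl (halt i) (fromℕ d) (fromℕ (G []))))
    (*-monoˡ (ℚ.<⇒≤ (0<halt i)) (fromℕ-mono-≤ bump))
    where open +-*-Solver
  expectation-bump (suc m) i s {F} {G} [] d G≤F bump _ =
    subst (ℚ._≤ expectation (suc m) i s F)
      (trans (cong (λ x → halt i ℚ.* x ℚ.+ rest) (fromℕ-+ d (G [])))
        (solve 4 (λ s d g r → s :* (d :+ g) :+ r := (s :* g :+ r) :+ d :* s) refl
          (halt i) (fromℕ d) (fromℕ (G [])) rest))
      (ℚ.+-mono-≤ (*-monoˡ (ℚ.<⇒≤ (0<halt i)) (fromℕ-mono-≤ bump))
        (∑-mono λ c → *-monoˡ (0≤p s c) (expectation-mono m (suc i) (move s c) (G≤F ∘ (c ∷_)))))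
    where
      open +-*-Solver
      rest = ∑ λ c → p s c ℚ.* expectation m (suc i) (move s c) (G ∘ (c ∷_))
  expectation-bump (suc m) i s {F} {G} (c ∷ w) d G≤F bump (s≤s w≤m) =
    subst (ℚ._≤ expectation (suc m) i s F) (sym (ℚ.+-assoc (halt i ℚ.* fromℕ (G [])) _ _))
      (ℚ.+-mono-≤ (*-monoˡ (ℚ.<⇒≤ (0<halt i)) (fromℕ-mono-≤ (G≤F [])))
        (∑-bump (λ c → *-monoˡ (0≤p s c) (expectation-mono m (suc i) (move s c) (G≤F ∘ (c ∷_)))) c
          (subst (ℚ._≤ p s c ℚ.* expectation m (suc i) (move s c) (F ∘ (c ∷_)))
            (solve 4 (λ p e d q → p :* (e :+ d :* q) := p :* e :+ d :* (p :* q)) refl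
              (p s c) (expectation m (suc i) (move s c) (G ∘ (c ∷_))) (fromℕ d) (prob (suc i) (move s c) w))
            (*-monoˡ (0≤p s c) (expectation-bump m (suc i) (move s c) w d (G≤F ∘ (c ∷_)) bump w≤m)))))
    where open +-*-Solver

  weighted : S → List (Word × ℕ) → ℚ
  weighted s []            = 0ℚ
  weighted s ((w , d) ∷ X) = weighted s X ℚ.+ fromℕ d ℚ.* prob 0 s w

  -- Regroups a sum over phrases into a sum over words: each entry of the list raises the mass of a
  -- single word.
  weighted≤expectation : ∀ m s {X} → All (λ x → length (proj₁ x) ≤ m) X →
                         weighted s X ℚ.≤ expectation m 0 s (mass X)
  weighted≤expectation m s []                          = expectation-≥0 m 0 s (λ _ → 0)
  weighted≤expectation m s {(w₀ , d) ∷ X} (w₀≤m ∷ X≤m) = ℚ.≤-trans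
    (ℚ.+-monoˡ-≤ (fromℕ d ℚ.* prob 0 s w₀) (weighted≤expectation m s X≤m))
    (expectation-bump m 0 s w₀ d grows bump w₀≤m)
    where
      grows : ∀ w → mass X w ≤ mass ((w₀ , d) ∷ X) w
      grows w with List.≡-dec Fin._≟_ w₀ w
      ... | yes _ = ℕ.m≤n+m (mass X w) d
      ... | no  _ = ℕ.≤-refl
      bump : d + mass X w₀ ≤ mass ((w₀ , d) ∷ X) w₀
      bump with List.≡-dec Fin._≟_ w₀ w₀
      ... | yes _     = ℕ.≤-refl
      ... | no  w₀≢w₀ = contradiction refl w₀≢w₀

  -- The weights of all words add up to at most `unit 0` = 1, so the average of the masses is at
  -- most their common bound. The sum of all lengths serves as a truncation depth that reaches every
  -- word of X.
  weighted-≤ : ∀ s X {D} → (∀ w → mass X w ≤ D) → weighted s X ℚ.≤ fromℕ D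
  weighted-≤ s X {D} mass≤D = subst (weighted s X ℚ.≤_)
    (ℚ.*-identityˡ (fromℕ D))
    (ℚ.≤-trans (weighted≤expectation (sum (map (length ∘ proj₁) X)) s (lengths X))
      (expectation-≤ (sum (map (length ∘ proj₁) X)) 0 s mass≤D))
    where
      lengths : ∀ X → All (λ x → length (proj₁ x) ≤ sum (map (length ∘ proj₁) X)) X
      lengths []            = []
      lengths ((w , d) ∷ X) = ℕ.m≤m+n (length w) _ ∷
        All.map (λ le → ℕ.≤-trans le (ℕ.m≤n+m _ (length w))) (lengths X)

-- The empirical model of order k

Occurs : ∀ {A : Set} → List A → List A → Set
Occurs T u = ∃[ a ] ∃[ b ] T ≡ a ++ u ++ b

∏-≥1 : ∀ {I : Set} {f : I → ℚ} → (∀ i → 1ℚ ℚ.≤ f i) → ∀ is → 1ℚ ℚ.≤ foldr (λ i → f i ℚ.*_) 1ℚ is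
∏-≥1 1≤f []       = ℚ.≤-refl
∏-≥1 1≤f (i ∷ is) = 1≤* (1≤f i) (∏-≥1 1≤f is)

∏-mono : ∀ {I : Set} {f g : I → ℚ} → (∀ i → 1ℚ ℚ.≤ f i) → (∀ i → f i ℚ.≤ g i) → ∀ is →
         foldr (λ i → f i ℚ.*_) 1ℚ is ℚ.≤ foldr (λ i → g i ℚ.*_) 1ℚ is
∏-mono 1≤f f≤g []       = ℚ.≤-refl
∏-mono 1≤f f≤g (i ∷ is) = *-mono (ℚ.≤-trans 0≤1ℚ (1≤f i)) (f≤g i) (ℚ.≤-trans 0≤1ℚ (∏-≥1 1≤f is)) (∏-mono 1≤f f≤g is)

∏-bump : ∀ {I : Set} {f g : I → ℚ} {e i is} → 1ℚ ℚ.≤ e → (∀ i → 1ℚ ℚ.≤ f i) → (∀ i → f i ℚ.≤ g i) →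
         i ∈ is → e ℚ.* f i ℚ.≤ g i →
         e ℚ.* foldr (λ i → f i ℚ.*_) 1ℚ is ℚ.≤ foldr (λ i → g i ℚ.*_) 1ℚ is
∏-bump {f = f} {g} {e} {i} {is = _ ∷ is} 1≤e 1≤f f≤g (here refl) bump = subst (ℚ._≤ g i ℚ.* foldr (λ i → g i ℚ.*_) 1ℚ is)
  (ℚ.*-assoc e (f i) (foldr (λ i → f i ℚ.*_) 1ℚ is))
  (*-mono (ℚ.≤-trans 0≤1ℚ (1≤* 1≤e (1≤f i))) bump (ℚ.≤-trans 0≤1ℚ (∏-≥1 1≤f is)) (∏-mono 1≤f f≤g is))
∏-bump {f = f} {g} {e} {is = j ∷ is} 1≤e 1≤f f≤g (there i∈) bump = subst (ℚ._≤ g j ℚ.* foldr (λ i → g i ℚ.*_) 1ℚ is)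
  (solve 3 (λ f e p → f :* (e :* p) := e :* (f :* p)) refl (f j) e (foldr (λ i → f i ℚ.*_) 1ℚ is))
  (*-mono (ℚ.≤-trans 0≤1ℚ (1≤f j)) (f≤g j) (ℚ.≤-trans 0≤1ℚ (1≤* 1≤e (∏-≥1 1≤f is))) (∏-bump 1≤e 1≤f f≤g i∈ bump))
  where open +-*-Solver

^-monoʳ-≤ : ∀ {r m n} → 1ℚ ℚ.≤ r → m ≤ n → r ^ m ℚ.≤ r ^ n
^-monoʳ-≤ {r} {n = n} 1≤r z≤n = 1≤^ 1≤r n
^-monoʳ-≤ {r} 1≤r (s≤s m≤n) = *-monoˡ (ℚ.≤-trans 0≤1ℚ 1≤r) (^-monoʳ-≤ 1≤r m≤n)

1≤ratio : ∀ {m N} → m ≤ N → 1ℚ ℚ.≤ ratio m N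
1≤ratio {zero}          m≤N = ℚ.≤-refl
1≤ratio {suc m} {suc N} m≤N = *-cancelʳ (0<fromℕ {suc m} (s≤s z≤n))
  (subst₂ ℚ._≤_ (sym (ℚ.*-identityˡ (fromℕ (suc m))))
    (trans (sym (*-/ (suc N) (suc m))) (ℚ.*-comm (fromℕ (suc m)) (+ suc N ℚ./ suc m)))
    (fromℕ-mono-≤ m≤N))

-- In a context that never occurs the model emits nothing, hence 0 where `ratio` has 1. The two are
-- inverse for 1 ≤ m ≤ N, the case that arises for substrings of T.
freq : (m N : ℕ) → ℚ
freq m zero    = 0ℚ
freq m (suc N) = + m ℚ./ suc N

0≤freq : ∀ m N → 0ℚ ℚ.≤ freq m N
0≤freq m zero    = ℚ.≤-refl
0≤freq m (suc N) = ℚ.nonNegative⁻¹ _ {{ℚ.normalize-nonNeg m (suc N)}}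

freq*ratio : ∀ {m N} → 1 ≤ m → m ≤ N → 1ℚ ℚ.≤ freq m N ℚ.* ratio m N
freq*ratio {suc m} {suc N} _ _ = *-cancelʳ (0<fromℕ {suc m} (s≤s z≤n)) (ℚ.≤-reflexive (begin
  1ℚ ℚ.* M              ≡⟨ ℚ.*-identityˡ M ⟩
  M                     ≡⟨ *-/ (suc m) (suc N) ⟨
  fromℕ (suc N) ℚ.* x   ≡⟨ cong (ℚ._* x) (*-/ (suc N) (suc m)) ⟨
  (M ℚ.* y) ℚ.* x       ≡⟨ solve 3 (λ M y x → (M :* y) :* x := (x :* y) :* M) refl M y x ⟩
  (x ℚ.* y) ℚ.* M       ∎))
  where
    open ≡-Reasoning
    open +-*-Solver
    M = fromℕ (suc m)
    x = + suc m ℚ./ suc N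
    y = + suc N ℚ./ suc m

module _ {σ : ℕ} where

  count-++ : ∀ (c : Fin σ) U V → count c (U ++ V) ≡ count c U + count c V
  count-++ c U V = trans (cong length (List.filter-++ (c Fin.≟_) U V))
    (List.length-++ (filter (c Fin.≟_) U))

  count-≤ : ∀ (c : Fin σ) U → count c U ≤ length U
  count-≤ c U = List.length-filter (c Fin.≟_) U

  count-self : ∀ (c : Fin σ) → count c [ c ] ≡ 1
  count-self c with c Fin.≟ c
  ... | yes _  = refl
  ... | no c≢c = contradiction refl c≢c

  next-self : ∀ W (c : Fin σ) b → next W (W ++ c ∷ b) ≡ [ c ]
  next-self []      c b = refl
  next-self (w ∷ W) c b with w Fin.≟ w
  ... | yes _  = next-self W c b
  ... | no w≢w = contradiction refl w≢w

  -- Ensures that the model gives positive probability to every symbol that T has after W, as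
  -- `freq*ratio` requires.
  following-occurs : ∀ W c a b → 1 ≤ count c (following W (a ++ W ++ c ∷ b))
  following-occurs []      c [] b = subst (1 ≤_) (sym (trans (count-++ c [ c ] (following [] b))
    (cong (_+ count c (following [] b)) (count-self c)))) (s≤s z≤n)
  following-occurs W@(w ∷ W′) c [] b = subst (1 ≤_) (sym (trans
    (count-++ c (next W (W ++ c ∷ b)) (following W (W′ ++ c ∷ b)))
    (cong (_+ count c (following W (W′ ++ c ∷ b))) (trans (cong (count c) (next-self W c b)) (count-self c))))) (s≤s z≤n)
  following-occurs W c (x ∷ a) b = subst (1 ≤_)
    (sym (count-++ c (next W (x ∷ a ++ W ++ c ∷ b)) (following W (a ++ W ++ c ∷ b))))
    (ℕ.≤-trans (following-occurs W c a b) (ℕ.m≤n+m _ (count c (next W (x ∷ a ++ W ++ c ∷ b)))))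

  -- The first k + 1 symbols, split into a context of length k and the symbol after it.
  window : ℕ → List (Fin σ) → Maybe (List (Fin σ) × Fin σ)
  window k       []      = nothing
  window zero    (c ∷ u) = just ([] , c)
  window (suc k) (x ∷ u) = Maybe.map (λ (W , c) → x ∷ W , c) (window k u)

  window-++ : ∀ k u v {x} → window k u ≡ just x → window k (u ++ v) ≡ just x
  window-++ zero    (c ∷ u) v eq = eq
  window-++ (suc k) (c ∷ u) v eq with window k u in eq′
  ... | just y = trans (cong (Maybe.map _) (window-++ k u v eq′)) eq

  window-self : ∀ s c w → window (length s) (s ++ c ∷ w) ≡ just (s , c)
  window-self []      c w = refl
  window-self (x ∷ s) c w = cong (Maybe.map _) (window-self s c w)

  window-next : ∀ k u {W c} → window k u ≡ just (W , c) → next W u ≡ [ c ] × W ∈ Σ^ k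
  window-next zero    (c ∷ u) refl = refl , here refl
  window-next (suc k) (x ∷ u) eq with window k u in eq′ | eq
  ... | just (W , c) | refl with next≡ , W∈ ← window-next k u eq′ with x Fin.≟ x
  ...   | yes _  = next≡ , ∈-cartesianProductWith⁺ _∷_ (∈-allFin x) W∈
  ...   | no x≢x = contradiction refl x≢x

  ∑-indicator : ∀ {n} (x : Fin n) → ∑ (λ c → fromℕ (if does (c Fin.≟ x) then 1 else 0)) ℚ.≤ 1ℚ
  ∑-indicator {suc n} Fin.zero    = ℚ.≤-reflexive (trans (cong (1ℚ ℚ.+_)
    (trans (∑-const n 0ℚ) (ℚ.*-zeroʳ (fromℕ n)))) (ℚ.+-identityʳ 1ℚ))
  ∑-indicator {suc n} (Fin.suc x) = subst (ℚ._≤ 1ℚ)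
    (sym (ℚ.+-identityˡ (∑ (λ c → fromℕ (if does (c Fin.≟ x) then 1 else 0))))) (∑-indicator x)

  ∑-count : ∀ U → ∑ (λ c → fromℕ (count {σ} c U)) ℚ.≤ fromℕ (length U)
  ∑-count []      = ℚ.≤-reflexive (trans (∑-const σ 0ℚ) (ℚ.*-zeroʳ (fromℕ σ)))
  ∑-count (x ∷ U) = begin
    ∑ (λ c → fromℕ (count c (x ∷ U)))
      ≡⟨ ∑-cong (λ c → trans (cong fromℕ (count-∷ c)) (fromℕ-+ (if does (c Fin.≟ x) then 1 else 0) (count c U))) ⟩
    ∑ (λ c → fromℕ (if does (c Fin.≟ x) then 1 else 0) ℚ.+ fromℕ (count c U))
      ≡⟨ ∑-+ (λ c → fromℕ (if does (c Fin.≟ x) then 1 else 0)) (λ c → fromℕ (count c U)) ⟩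
    ∑ (λ c → fromℕ (if does (c Fin.≟ x) then 1 else 0)) ℚ.+ ∑ (λ c → fromℕ (count c U))
      ≤⟨ ℚ.+-mono-≤ (∑-indicator x) (∑-count U) ⟩
    1ℚ ℚ.+ fromℕ (length U) ≡⟨ fromℕ-+ 1 (length U) ⟨
    fromℕ (length (x ∷ U)) ∎
    where
      open ℚ.≤-Reasoning
      count-∷ : ∀ c → count c (x ∷ U) ≡ (if does (c Fin.≟ x) then 1 else 0) + count c U
      count-∷ c with does (c Fin.≟ x)
      ... | true  = refl
      ... | false = refl

  ∑-freq : ∀ U → ∑ (λ c → freq (count {σ} c U) (length U)) ℚ.≤ 1ℚ
  ∑-freq []        = subst (ℚ._≤ 1ℚ) (sym (trans (∑-const σ 0ℚ) (ℚ.*-zeroʳ (fromℕ σ)))) 0≤1ℚ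
  ∑-freq U@(_ ∷ _) = *-cancelʳ {c = fromℕ (length U)} (0<fromℕ (s≤s z≤n)) (begin
    ∑ (λ c → freq (count c U) (length U)) ℚ.* fromℕ (length U)
      ≡⟨ *-distribʳ-∑ (fromℕ (length U)) (λ c → freq (count c U) (length U)) ⟩
    ∑ (λ c → freq (count c U) (length U) ℚ.* fromℕ (length U))
      ≡⟨ ∑-cong (λ c → trans (ℚ.*-comm (freq (count c U) (length U)) (fromℕ (length U))) (*-/ (count c U) (length U))) ⟩
    ∑ (λ c → fromℕ (count c U)) ≤⟨ ∑-count U ⟩
    fromℕ (length U) ≡⟨ ℚ.*-identityˡ (fromℕ (length U)) ⟨
    1ℚ ℚ.* fromℕ (length U) ∎)
    where open ℚ.≤-Reasoning

-- The first k symbols of a phrase are generated uniformly, each later symbol according to its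
-- frequency in T after the k symbols before it.  The state holds the last (at most k) symbols.
module ContextModel {σ : ℕ} .{{_ : ℕ.NonZero σ}} (k : ℕ) (T : List (Fin σ)) where

  ratioAt : List (Fin σ) → Fin σ → ℚ
  ratioAt W c = ratio (count c (following W T)) (length (following W T))

  1≤ratioAt : ∀ W c → 1ℚ ℚ.≤ ratioAt W c
  1≤ratioAt W c = 1≤ratio (count-≤ c (following W T))

  1/σ : ℚ
  1/σ = + 1 ℚ./ σ

  move : List (Fin σ) → Fin σ → List (Fin σ)
  move s c with length s ℕ.<? k
  ... | yes _ = s ++ [ c ]
  -- Dropping after appending, rather than before, keeps the state empty for k = 0.
  ... | no  _ = drop 1 (s ++ [ c ])

  p : List (Fin σ) → Fin σ → ℚ
  p s c with length s ℕ.<? k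
  ... | yes _ = 1/σ
  ... | no  _ = freq (count c (following s T)) (length (following s T))

  0≤p : ∀ s c → 0ℚ ℚ.≤ p s c
  0≤p s c with length s ℕ.<? k
  ... | yes _ = ℚ.nonNegative⁻¹ 1/σ {{ℚ.normalize-nonNeg 1 σ}}
  ... | no  _ = 0≤freq (count c (following s T)) (length (following s T))

  ∑p≤1 : ∀ s → ∑ (p s) ℚ.≤ 1ℚ
  ∑p≤1 s with length s ℕ.<? k
  ... | yes _ = ℚ.≤-reflexive (trans (∑-const σ 1/σ) (*-/ 1 σ))
  ... | no  _ = ∑-freq (following s T)

  open RandomWord move p 0≤p ∑p≤1 public using (prob; 0≤prob; weighted; weighted-≤)

  partial-move : ∀ {s} → length s < k → ∀ c → move s c ≡ s ++ [ c ] × p s c ≡ 1/σ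
  partial-move {s} s<k c with length s ℕ.<? k
  ... | yes _  = refl , refl
  ... | no s≮k = contradiction s<k s≮k

  full-move : ∀ {s} → length s ≡ k → ∀ c →
    move s c ≡ drop 1 (s ++ [ c ]) × p s c ≡ freq (count c (following s T)) (length (following s T))
  full-move {s} s≡k c with length s ℕ.<? k
  ... | yes s<k = contradiction s≡k (ℕ.<⇒≢ s<k)
  ... | no  _   = refl , refl

  -- The inverse of the model probability of the symbol after the first k symbols of u, and 1 if u
  -- has no such symbol.
  factor : List (Fin σ) → ℚ
  factor u = Maybe.maybe′ (λ (W , c) → ratioAt W c) 1ℚ (window k u)

  1≤factor : ∀ u → 1ℚ ℚ.≤ factor u
  1≤factor u with window k u
  ... | just (W , c) = 1≤ratioAt W c
  ... | nothing      = ℚ.≤-refl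

  -- The inverse of the probability of all those symbols of the word that have k predecessors within
  -- the word.
  windows : List (Fin σ) → ℚ
  windows []      = 1ℚ
  windows (c ∷ u) = factor (c ∷ u) ℚ.* windows u

  1≤windows : ∀ u → 1ℚ ℚ.≤ windows u
  1≤windows []      = ℚ.≤-refl
  1≤windows (c ∷ u) = 1≤* (1≤factor (c ∷ u)) (1≤windows u)

  factor-++ : ∀ u v → factor u ℚ.≤ factor (u ++ v)
  factor-++ u v with window k u in eq
  ... | just x  = ℚ.≤-reflexive (cong (Maybe.maybe′ _ 1ℚ) (sym (window-++ k u v eq)))
  ... | nothing = 1≤factor (u ++ v)

  -- Windows across the border contribute further factors, all at least 1. This is why cutting T
  -- into phrases never exceeds the entropy product of T.
  windows-++ : ∀ u v → windows u ℚ.* windows v ℚ.≤ windows (u ++ v)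
  windows-++ []      v = ℚ.≤-reflexive (ℚ.*-identityˡ (windows v))
  windows-++ (c ∷ u) v = subst (ℚ._≤ windows (c ∷ u ++ v)) (sym (ℚ.*-assoc (factor (c ∷ u)) (windows u) (windows v)))
    (*-mono (ℚ.≤-trans 0≤1ℚ (1≤factor (c ∷ u))) (factor-++ (c ∷ u) v)
      (ℚ.≤-trans 0≤1ℚ (1≤* (1≤windows u) (1≤windows v))) (windows-++ u v))

  windows-concat : ∀ ws → foldr (λ w → windows w ℚ.*_) 1ℚ ws ℚ.≤ windows (concat ws)
  windows-concat []       = ℚ.≤-refl
  windows-concat (w ∷ ws) = ℚ.≤-trans
    (*-monoˡ (ℚ.≤-trans 0≤1ℚ (1≤windows w)) (windows-concat ws)) (windows-++ w (concat ws))

  -- The ratios stay those of T while the exponents count in U, so that the induction can take U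
  -- apart. A new window raises the exponent of its context and symbol by one.
  windows≤entropyProduct : ∀ U → windows U ℚ.≤
    foldr (λ W → foldr (λ c → ratioAt W c ^ count c (following W U) ℚ.*_) 1ℚ (allFin σ) ℚ.*_) 1ℚ (Σ^ k)
  windows≤entropyProduct [] = ∏-≥1 (λ W → ∏-≥1 (λ c → ℚ.≤-refl {1ℚ}) (allFin σ)) (Σ^ k)
  windows≤entropyProduct (x ∷ U) = ℚ.≤-trans
    (*-monoˡ (ℚ.≤-trans 0≤1ℚ (1≤factor (x ∷ U))) (windows≤entropyProduct U))
    (step′ (window k (x ∷ U)) refl)
    where
      old new : List (Fin σ) → Fin σ → ℚ
      old W c = ratioAt W c ^ count c (following W U)
      new W c = ratioAt W c ^ count c (following W (x ∷ U))
      1≤old : ∀ W c → 1ℚ ℚ.≤ old W c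
      1≤old W c = 1≤^ (1≤ratioAt W c) (count c (following W U))
      old≤new : ∀ W c → old W c ℚ.≤ new W c
      old≤new W c = ^-monoʳ-≤ (1≤ratioAt W c) (subst (count c (following W U) ≤_)
        (sym (count-++ c (next W (x ∷ U)) (following W U))) (ℕ.m≤n+m _ (count c (next W (x ∷ U)))))
      ∏c : (List (Fin σ) → Fin σ → ℚ) → List (Fin σ) → ℚ
      ∏c f W = foldr (λ c → f W c ℚ.*_) 1ℚ (allFin σ)
      step′ : ∀ m → window k (x ∷ U) ≡ m →
        Maybe.maybe′ (λ (W , c) → ratioAt W c) 1ℚ m ℚ.* foldr (λ W → ∏c old W ℚ.*_) 1ℚ (Σ^ k)
          ℚ.≤ foldr (λ W → ∏c new W ℚ.*_) 1ℚ (Σ^ k)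
      step′ nothing _ = subst (ℚ._≤ foldr (λ W → ∏c new W ℚ.*_) 1ℚ (Σ^ k))
        (sym (ℚ.*-identityˡ (foldr (λ W → ∏c old W ℚ.*_) 1ℚ (Σ^ k))))
        (∏-mono (λ W → ∏-≥1 (1≤old W) (allFin σ)) (λ W → ∏-mono (1≤old W) (old≤new W) (allFin σ)) (Σ^ k))
      step′ (just (W , c)) eq with next≡ , W∈ ← window-next k (x ∷ U) eq =
        ∏-bump (1≤ratioAt W c) (λ W → ∏-≥1 (1≤old W) (allFin σ)) (λ W → ∏-mono (1≤old W) (old≤new W) (allFin σ))
          W∈ (∏-bump (1≤ratioAt W c) (1≤old W) (old≤new W) (∈-allFin c)
            (ℚ.≤-reflexive (cong (ratioAt W c ^_) (sym (trans (count-++ c (next W (x ∷ U)) (following W U))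
              (cong (_+ count c (following W U)) (trans (cong (count c) next≡) (count-self c))))))))

  haltFactor : ℕ → ℚ
  haltFactor i = fromℕ (suc i * suc (suc i))

  halt-inverse : ∀ i → halt i ℚ.* haltFactor i ≡ 1ℚ
  halt-inverse i = begin
    (a ℚ.* b) ℚ.* fromℕ (suc i * suc (suc i)) ≡⟨ cong ((a ℚ.* b) ℚ.*_) (fromℕ-* (suc i) (suc (suc i))) ⟩
    (a ℚ.* b) ℚ.* (x ℚ.* y)  ≡⟨ solve 4 (λ a b x y → (a :* b) :* (x :* y) := (a :* x) :* (b :* y)) refl a b x y ⟩
    (a ℚ.* x) ℚ.* (b ℚ.* y)  ≡⟨ cong₂ ℚ._*_ (unit-inverse i) (unit-inverse (suc i)) ⟩
    1ℚ ∎
    where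
      open ≡-Reasoning
      open +-*-Solver
      a = unit i
      b = unit (suc i)
      x = fromℕ (suc i)
      y = fromℕ (suc (suc i))

  tail-shift : ∀ s (c : Fin σ) w → windows (s ++ c ∷ w) ≡ factor (s ++ c ∷ w) ℚ.* windows (drop 1 (s ++ [ c ]) ++ w)
  tail-shift []      c w = refl
  tail-shift (x ∷ s) c w = cong (λ u → factor (x ∷ s ++ c ∷ w) ℚ.* windows u) (sym (List.++-assoc s [ c ] w))

  occurs-tail : ∀ s (c : Fin σ) w → Occurs T (s ++ c ∷ w) → Occurs T (drop 1 (s ++ [ c ]) ++ w)
  occurs-tail [] c w (a , b , T≡) = a ++ [ c ] , b , trans T≡ (sym (List.++-assoc a [ c ] (w ++ b)))
  occurs-tail (x ∷ s) c w (a , b , T≡) = a ++ [ x ] , b , trans T≡ (trans (sym (List.++-assoc a [ x ] ((s ++ c ∷ w) ++ b)))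
    (cong (λ u → (a ++ [ x ]) ++ u ++ b) (sym (List.++-assoc s [ c ] w))))

  -- The probability of each emitted symbol cancels against the ratio of the window formed by the
  -- state and that symbol. Its frequency is positive because the state followed by the word occurs
  -- in T.
  prob-full : ∀ i s w → length s ≡ k → Occurs T (s ++ w) →
              1ℚ ℚ.≤ (prob i s w ℚ.* haltFactor (i + length w)) ℚ.* windows (s ++ w)
  prob-full i s [] s≡k occ = subst (1ℚ ℚ.≤_)
    (sym (trans (cong (ℚ._* windows (s ++ [])) (trans (cong (λ j → halt i ℚ.* haltFactor j) (ℕ.+-identityʳ i)) (halt-inverse i)))
      (ℚ.*-identityˡ (windows (s ++ [])))))
    (1≤windows (s ++ []))
  prob-full i s (c ∷ w) refl occ@(a , b , T≡) = subst (1ℚ ℚ.≤_) eq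
    (1≤* (freq*ratio count≥1 (count-≤ c (following s T)))
         (prob-full (suc i) s′ w (length-drop s) (occurs-tail s c w occ)))
    where
      open ≡-Reasoning
      open +-*-Solver
      s′ = drop 1 (s ++ [ c ])
      P = prob (suc i) s′ w
      f = freq (count c (following s T)) (length (following s T))
      length-drop : ∀ s → length (drop 1 (s ++ [ c ])) ≡ length s
      length-drop []      = refl
      length-drop (x ∷ s) = trans (List.length-++ s) (ℕ.+-comm (length s) 1)
      count≥1 : 1 ≤ count c (following s T)
      count≥1 = subst (λ T → 1 ≤ count c (following s T))
        (sym (trans T≡ (cong (a ++_) (List.++-assoc s (c ∷ w) b)))) (following-occurs s c a (w ++ b))
      eq : (f ℚ.* ratioAt s c) ℚ.* ((P ℚ.* haltFactor (suc i + length w)) ℚ.* windows (s′ ++ w)) ≡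
           (prob i s (c ∷ w) ℚ.* haltFactor (i + suc (length w))) ℚ.* windows (s ++ c ∷ w)
      eq = begin
        (f ℚ.* ratioAt s c) ℚ.* ((P ℚ.* haltFactor (suc i + length w)) ℚ.* windows (s′ ++ w))
          ≡⟨ solve 5 (λ f r P S W → (f :* r) :* ((P :* S) :* W) := ((f :* P) :* S) :* (r :* W)) refl
               f (ratioAt s c) P (haltFactor (suc i + length w)) (windows (s′ ++ w)) ⟩
        ((f ℚ.* P) ℚ.* haltFactor (suc i + length w)) ℚ.* (ratioAt s c ℚ.* windows (s′ ++ w))
          ≡⟨ cong₂ (λ x y → x ℚ.* (y ℚ.* windows (s′ ++ w)))
               (cong₂ (λ x j → x ℚ.* haltFactor j)
                 (cong₂ (λ f s″ → f ℚ.* prob (suc i) s″ w) (sym (proj₂ (full-move {s} refl c))) (sym (proj₁ (full-move {s} refl c))))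
                 (sym (ℕ.+-suc i (length w))))
               (cong (Maybe.maybe′ (λ (W , c) → ratioAt W c) 1ℚ) (sym (window-self s c w))) ⟩
        (prob i s (c ∷ w) ℚ.* haltFactor (i + suc (length w))) ℚ.* (factor (s ++ c ∷ w) ℚ.* windows (s′ ++ w))
          ≡⟨ cong ((prob i s (c ∷ w) ℚ.* haltFactor (i + suc (length w))) ℚ.*_) (tail-shift s c w) ⟨
        (prob i s (c ∷ w) ℚ.* haltFactor (i + suc (length w))) ℚ.* windows (s ++ c ∷ w) ∎

  prob-partial : ∀ r i s w → length s + r ≡ k → Occurs T (s ++ w) →
                 1ℚ ℚ.≤ ((prob i s w ℚ.* haltFactor (i + length w)) ℚ.* windows (s ++ w)) ℚ.* fromℕ σ ^ r
  prob-partial zero i s w s≡k occ = subst (1ℚ ℚ.≤_)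
    (sym (ℚ.*-identityʳ ((prob i s w ℚ.* haltFactor (i + length w)) ℚ.* windows (s ++ w))))
    (prob-full i s w (trans (sym (ℕ.+-identityʳ (length s))) s≡k) occ)
  prob-partial (suc r) i s [] s≡k occ = 1≤* (subst (1ℚ ℚ.≤_)
    (sym (trans (cong (ℚ._* windows (s ++ [])) (trans (cong (λ j → halt i ℚ.* haltFactor j) (ℕ.+-identityʳ i)) (halt-inverse i)))
      (ℚ.*-identityˡ (windows (s ++ [])))))
    (1≤windows (s ++ []))) (1≤^ (fromℕ-mono-≤ (ℕ.>-nonZero⁻¹ σ)) (suc r))
  prob-partial (suc r) i s (c ∷ w) s≡k occ = subst (1ℚ ℚ.≤_) eq
    (prob-partial r (suc i) (s ++ [ c ]) w
      (trans (cong (_+ r) (List.length-++ s)) (trans (ℕ.+-assoc (length s) 1 r) s≡k))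
      (subst (Occurs T) (sym (List.++-assoc s [ c ] w)) occ))
    where
      open ≡-Reasoning
      open +-*-Solver
      s<k : length s < k
      s<k = subst (length s <_) s≡k (ℕ.m<m+n (length s) (s≤s z≤n))
      P = prob (suc i) (s ++ [ c ]) w
      eq : ((P ℚ.* haltFactor (suc i + length w)) ℚ.* windows ((s ++ [ c ]) ++ w)) ℚ.* fromℕ σ ^ r ≡
           ((prob i s (c ∷ w) ℚ.* haltFactor (i + suc (length w))) ℚ.* windows (s ++ c ∷ w)) ℚ.* fromℕ σ ^ suc r
      eq = begin
        ((P ℚ.* haltFactor (suc i + length w)) ℚ.* windows ((s ++ [ c ]) ++ w)) ℚ.* fromℕ σ ^ r
          ≡⟨ cong₂ (λ j u → ((P ℚ.* haltFactor j) ℚ.* windows u) ℚ.* fromℕ σ ^ r)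
               (sym (ℕ.+-suc i (length w))) (List.++-assoc s [ c ] w) ⟩
        ((P ℚ.* haltFactor (i + suc (length w))) ℚ.* windows (s ++ c ∷ w)) ℚ.* fromℕ σ ^ r
          ≡⟨ ℚ.*-identityˡ _ ⟨
        1ℚ ℚ.* (((P ℚ.* haltFactor (i + suc (length w))) ℚ.* windows (s ++ c ∷ w)) ℚ.* fromℕ σ ^ r)
          ≡⟨ cong (ℚ._* (((P ℚ.* haltFactor (i + suc (length w))) ℚ.* windows (s ++ c ∷ w)) ℚ.* fromℕ σ ^ r)) (sym (*-/ 1 σ)) ⟩
        (fromℕ σ ℚ.* 1/σ) ℚ.* (((P ℚ.* haltFactor (i + suc (length w))) ℚ.* windows (s ++ c ∷ w)) ℚ.* fromℕ σ ^ r)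
          ≡⟨ solve 6 (λ σ i P S W R → (σ :* i) :* (((P :* S) :* W) :* R) := (((i :* P) :* S) :* W) :* (σ :* R)) refl
               (fromℕ σ) 1/σ P (haltFactor (i + suc (length w))) (windows (s ++ c ∷ w)) (fromℕ σ ^ r) ⟩
        (((1/σ ℚ.* P) ℚ.* haltFactor (i + suc (length w))) ℚ.* windows (s ++ c ∷ w)) ℚ.* fromℕ σ ^ suc r
          ≡⟨ cong₂ (λ x s′ → (((x ℚ.* prob (suc i) s′ w) ℚ.* haltFactor (i + suc (length w))) ℚ.* windows (s ++ c ∷ w)) ℚ.* fromℕ σ ^ suc r)
               (sym (proj₂ (partial-move s<k c))) (sym (proj₁ (partial-move s<k c))) ⟩
        ((prob i s (c ∷ w) ℚ.* haltFactor (i + suc (length w))) ℚ.* windows (s ++ c ∷ w)) ℚ.* fromℕ σ ^ suc r ∎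

  prob-≥ : ∀ w → Occurs T w → 1ℚ ℚ.≤ ((prob 0 [] w ℚ.* haltFactor (length w)) ℚ.* windows w) ℚ.* fromℕ σ ^ k
  prob-≥ w = prob-partial k 0 [] w refl

-- The number of phrases

module _ {A : Set} where

  prefix⇒++ : ∀ {w u : List A} → w IsPrefixOf u → ∃[ v ] u ≡ w ++ v
  prefix⇒++ []                      = _ , refl
  prefix⇒++ (refl ∷ p) with v , eq ← prefix⇒++ p = v , cong (_ ∷_) eq

  ++⇒prefix : ∀ (w v : List A) → w IsPrefixOf (w ++ v)
  ++⇒prefix []      v = []
  ++⇒prefix (x ∷ w) v = refl ∷ ++⇒prefix w v

  ++-split : ∀ (w w′ : List A) {a b} → length w ≡ length w′ → w ++ a ≡ w′ ++ b → w ≡ w′ × a ≡ b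
  ++-split []      []        _   eq = refl , eq
  ++-split (x ∷ w) (x′ ∷ w′) len eq with refl , eq′ ← List.∷-injective eq
    with w≡ , a≡b ← ++-split w w′ (ℕ.suc-injective len) eq′ = cong (x ∷_) w≡ , a≡b

  drop-++ : ∀ (w : List A) v → drop (length w) (w ++ v) ≡ v
  drop-++ []      v = refl
  drop-++ (x ∷ w) v = drop-++ w v

  drop-past-++ : ∀ (w : List A) v {i} → length w ≤ i → drop i (w ++ v) ≡ drop (i ∸ length w) v
  drop-past-++ []      v _         = refl
  drop-past-++ (x ∷ w) v (s≤s le) = drop-past-++ w v le

  drop-step : ∀ (i : ℕ) (U w : List A) {v} → drop i U ≡ w ++ v → drop (i + length w) U ≡ v
  drop-step i U w {v} eq = trans (sym (List.drop-drop i (length w) U))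
    (trans (cong (drop (length w)) eq) (drop-++ w v))

  1≤length : ∀ {w : List A} → w ≢ [] → 1 ≤ length w
  1≤length {[]}    w≢[] = contradiction refl w≢[]
  1≤length {x ∷ w} _    = s≤s z≤n

  OccursBefore-mono : ∀ {U i j} {w : List A} → i ≤ j → OccursBefore U i w → OccursBefore U j w
  OccursBefore-mono i≤j (x , x<i , p) = x , ℕ.<-≤-trans x<i i≤j , p

  pairs : List (List A) → List (List A)
  pairs (u ∷ v ∷ ws) = (u ++ v) ∷ pairs (v ∷ ws)
  pairs _            = []

  length-pairs : ∀ ws → length ws ≤ suc (length (pairs ws))
  length-pairs []           = z≤n
  length-pairs (u ∷ [])     = s≤s z≤n
  length-pairs (u ∷ v ∷ ws) = s≤s (length-pairs (v ∷ ws))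

  sum-pairs : ∀ ws → sum (map length (pairs ws)) ≤ 2 * length (concat ws)
  sum-pairs []           = z≤n
  sum-pairs (u ∷ [])     = z≤n
  sum-pairs (u ∷ v ∷ ws) = ℕ.≤-trans (ℕ.m≤n+m (sum (map length (pairs (u ∷ v ∷ ws)))) (length u)) (go (u ∷ v ∷ ws))
    where
      open ℕ.≤-Reasoning
      head : List (List A) → ℕ
      head []      = 0
      head (w ∷ _) = length w
      lem : ∀ a s → a + (a + 2 * s) ≡ 2 * (a + s)
      lem = solve-∀
      -- A phrase in the middle lies in two pairs but the first one only in one; adding its length
      -- once more makes the induction go through.
      go : ∀ ws → head ws + sum (map length (pairs ws)) ≤ 2 * length (concat ws)
      go []           = z≤n
      go (u ∷ [])     = begin
        length u + 0                ≤⟨ ℕ.+-monoʳ-≤ (length u) z≤n ⟩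
        length u + (length u + 0)   ≤⟨ ℕ.≤-reflexive (cong (λ w → length w + (length w + 0)) (sym (List.++-identityʳ u))) ⟩
        2 * length (u ++ []) ∎
      go (u ∷ v ∷ ws) = begin
        length u + (length (u ++ v) + sum (map length (pairs (v ∷ ws))))
          ≡⟨ cong (λ l → length u + (l + sum (map length (pairs (v ∷ ws))))) (List.length-++ u) ⟩
        length u + (length u + length v + sum (map length (pairs (v ∷ ws))))
          ≡⟨ cong (λ x → length u + x) (ℕ.+-assoc (length u) (length v) _) ⟩
        length u + (length u + (length v + sum (map length (pairs (v ∷ ws)))))
          ≤⟨ ℕ.+-monoʳ-≤ (length u) (ℕ.+-monoʳ-≤ (length u) (go (v ∷ ws))) ⟩
        length u + (length u + 2 * length (concat (v ∷ ws))) ≡⟨ lem (length u) (length (concat (v ∷ ws))) ⟩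
        2 * (length u + length (concat (v ∷ ws))) ≡⟨ cong (2 *_) (List.length-++ u) ⟨
        2 * length (concat (u ∷ v ∷ ws)) ∎

  greedy-content : ∀ {S i} {u : List A} {ps} → Greedy S i u ps → concat (map content ps) ≡ u
  greedy-content end                            = refl
  greedy-content (copy {w = w} refl _ _ _ rest) = cong (w ++_) (greedy-content rest)
  greedy-content (lit {c = c} _ rest)           = cong (c ∷_) (greedy-content rest)

  greedy-nonempty : ∀ {S i} {u : List A} {ps} → Greedy S i u ps → All (_≢ []) (map content ps)
  greedy-nonempty end                   = []
  greedy-nonempty (copy _ w≢[] _ _ rest) = w≢[] ∷ greedy-nonempty rest
  greedy-nonempty (lit _ rest)          = (λ ()) ∷ greedy-nonempty rest

  greedy-drop : ∀ {S i} {u : List A} {ps} → Greedy S i u ps → ∀ m → ∃[ j ] ∃[ v ] Greedy S j v (drop m ps)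
  greedy-drop g zero                          = _ , _ , g
  greedy-drop end (suc m)                     = 0 , [] , end
  greedy-drop (copy _ _ _ _ rest) (suc m)     = greedy-drop rest m
  greedy-drop (lit _ rest) (suc m)            = greedy-drop rest m

  -- By maximality, a phrase together with the next one has no earlier occurrence.
  NewPairs : List A → ℕ → List (List A) → Set
  NewPairs U i ws = All (λ X → ¬ OccursBefore U i X) (pairs ws) × Unique (pairs ws)

  -- The first pair occurs at i, hence before i + |w|, whereas no later pair has an occurrence
  -- starting before that position. So the first pair differs from all later ones.
  newPairs-∷ : ∀ {U i v} (w : List A) ws → drop i U ≡ w ++ v → w ≢ [] → concat ws ≡ v → All (_≢ []) ws →
               (∀ y → y ≢ [] → (w ++ y) IsPrefixOf (w ++ v) → ¬ OccursBefore U i (w ++ y)) →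
               NewPairs U (i + length w) ws → NewPairs U i (w ∷ ws)
  newPairs-∷ w []       _  _    _  _          _   _            = [] , []
  newPairs-∷ {U} {i} w (y ∷ ws) eq w≢[] refl (y≢[] ∷ _) max (new , unique) =
    (max y y≢[] isPrefix ∷ All.map (λ ¬occ occ → ¬occ (OccursBefore-mono (ℕ.m≤m+n i (length w)) occ)) new) ,
    (All.map (λ ¬occ X≡ → ¬occ (subst (OccursBefore U (i + length w)) X≡ here-i)) new ∷ unique)
    where
      isPrefix : (w ++ y) IsPrefixOf (w ++ y ++ concat ws)
      isPrefix = subst ((w ++ y) IsPrefixOf_) (List.++-assoc w y (concat ws)) (++⇒prefix (w ++ y) (concat ws))
      here-i : OccursBefore U (i + length w) (w ++ y)
      here-i = i , ℕ.m<m+n i (1≤length w≢[]) , subst ((w ++ y) IsPrefixOf_) (sym eq) isPrefix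

  greedy-newPairs : ∀ {U i u ps} → Greedy (OccursBefore U) i u ps → drop i U ≡ u → NewPairs U i (map content ps)
  greedy-newPairs end _ = [] , []
  greedy-newPairs {U} {i} (copy {w = w} {ps = ps} refl w≢[] _ max rest) eq =
    newPairs-∷ w (map content ps) eq w≢[] (greedy-content rest) (greedy-nonempty rest)
      (λ y y≢[] p occ → ℕ.<⇒≱ (ℕ.<-≤-trans (ℕ.m<m+n (length w) (1≤length y≢[]))
        (ℕ.≤-reflexive (sym (List.length-++ w)))) (max p occ))
      (greedy-newPairs rest (drop-step i U w eq))
  greedy-newPairs {U} {i} (lit {c = c} {v = v} {ps = ps} max rest) eq =
    newPairs-∷ [ c ] (map content ps) eq (λ ()) (greedy-content rest) (greedy-nonempty rest)
      (λ y y≢[] p occ → contradiction (max p occ) λ ())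
      (subst (λ j → NewPairs U j (map content ps)) (ℕ.+-comm 1 i)
        (greedy-newPairs rest (subst (λ j → drop j U ≡ v) (ℕ.+-comm i 1) (drop-step i U [ c ] eq))))

  pigeonhole : ∀ {xs ys : List A} → Unique xs → (∀ {x} → x ∈ xs → x ∈ ys) → length xs ≤ length ys
  pigeonhole []                        xs⊆ys = z≤n
  pigeonhole {x ∷ xs} (x∉xs ∷ unique) xs⊆ys with ys₁ , ys₂ , refl ← ∈-∃++ (xs⊆ys (here refl)) =
    subst (suc (length xs) ≤_) (sym (trans (List.length-++ ys₁) (trans (ℕ.+-suc (length ys₁) (length ys₂))
      (cong suc (sym (List.length-++ ys₁))))))
      (s≤s (pigeonhole unique λ {y} y∈ → shrink y∈ (∈-++⁻ ys₁ (xs⊆ys (there y∈)))))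
    where
      shrink : ∀ {y} → y ∈ xs → y ∈ ys₁ ⊎ y ∈ x ∷ ys₂ → y ∈ ys₁ ++ ys₂
      shrink y∈ (inj₁ y∈₁)         = ∈-++⁺ˡ y∈₁
      shrink y∈ (inj₂ (here refl)) = contradiction refl (All.lookup x∉xs y∈)
      shrink y∈ (inj₂ (there y∈₂)) = ∈-++⁺ʳ ys₁ y∈₂

  -- A word of length at least L pays for its L by its own length, so only the shorter words have to
  -- be counted.
  length*L≤ : ∀ L (ws : List (List A)) →
    length ws * L ≤ sum (map length ws) + length (filter (λ w → length w ℕ.<? L) ws) * L
  length*L≤ L []       = z≤n
  length*L≤ L (w ∷ ws) = split (length w ℕ.<? L)
    where
      short? = λ (w : List A) → length w ℕ.<? L
      f = length (filter short? ws) * L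
      lem : ∀ L w s f → L + (w + (s + f)) ≡ (w + s) + (L + f)
      lem = solve-∀
      split : Dec (length w < L) →
              L + length ws * L ≤ length w + sum (map length ws) + length (filter short? (w ∷ ws)) * L
      split (yes w<L) = subst (L + length ws * L ≤_)
        (trans (lem L (length w) (sum (map length ws)) f)
          (cong (λ xs → length w + sum (map length ws) + length xs * L) (sym (List.filter-accept short? w<L))))
        (ℕ.+-monoʳ-≤ L (ℕ.≤-trans (length*L≤ L ws) (ℕ.m≤n+m _ (length w))))
      split (no w≮L) = subst (L + length ws * L ≤_)
        (trans (sym (ℕ.+-assoc (length w) (sum (map length ws)) f))
          (cong (λ xs → length w + sum (map length ws) + length xs * L) (sym (List.filter-reject short? w≮L))))
        (ℕ.+-mono-≤ (ℕ.≮⇒≥ w≮L) (length*L≤ L ws))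

length-cartesianProductWith : ∀ {A B C : Set} (f : A → B → C) xs ys →
                              length (cartesianProductWith f xs ys) ≡ length xs * length ys
length-cartesianProductWith f []       ys = refl
length-cartesianProductWith f (x ∷ xs) ys = trans (List.length-++ (map (f x) ys))
  (cong₂ _+_ (List.length-map (f x) ys) (length-cartesianProductWith f xs ys))

module _ {σ : ℕ} (σ≥2 : 2 ≤ σ) where

  shortWords : ℕ → List (List (Fin σ))
  shortWords zero    = []
  shortWords (suc L) = [] ∷ cartesianProductWith _∷_ (allFin σ) (shortWords L)

  ∈-shortWords : ∀ {L} w → length w < L → w ∈ shortWords L
  ∈-shortWords {suc L} []      _         = here refl
  ∈-shortWords {suc L} (c ∷ w) (s≤s w<L) = there (∈-cartesianProductWith⁺ _∷_ (∈-allFin c) (∈-shortWords w w<L))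

  length-shortWords : ∀ L → length (shortWords L) < σ ℕ.^ L
  length-shortWords zero    = s≤s z≤n
  length-shortWords (suc L) = begin-strict
    suc (length (cartesianProductWith _∷_ (allFin σ) (shortWords L)))
      ≡⟨ cong suc (trans (length-cartesianProductWith _∷_ (allFin σ) (shortWords L))
           (cong (_* length (shortWords L)) (List.length-tabulate {n = σ} (λ c → c)))) ⟩
    suc (σ * length (shortWords L)) <⟨ ℕ.+-monoˡ-< (σ * length (shortWords L)) σ≥2 ⟩
    σ + σ * length (shortWords L)   ≡⟨ ℕ.*-suc σ (length (shortWords L)) ⟨
    σ * suc (length (shortWords L)) ≤⟨ ℕ.*-monoʳ-≤ σ (length-shortWords L) ⟩
    σ * σ ℕ.^ L ∎
    where open ℕ.≤-Reasoning

  -- The pairs have total length at most 2 n. Fewer than σ ^ L distinct words are shorter than L,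
  -- and charging L < σ ^ L to each gives at most σ ^ (2 L) ≤ n. Another L ≤ n accounts for there
  -- being one pair less than phrases.
  parse-length : ∀ {ws n} L → Unique (pairs ws) → length (concat ws) ≤ n → σ ℕ.^ (2 * L) ≤ n → length ws * L ≤ 4 * n
  parse-length {ws} {n} L unique ws≤n σ^2L≤n = begin
    length ws * L                        ≤⟨ ℕ.*-monoˡ-≤ L (length-pairs ws) ⟩
    L + length (pairs ws) * L            ≤⟨ ℕ.+-monoʳ-≤ L (length*L≤ L (pairs ws)) ⟩
    L + (sum (map length (pairs ws)) + length short * L)
      ≤⟨ ℕ.+-mono-≤ L≤n (ℕ.+-mono-≤ (ℕ.≤-trans (sum-pairs ws) (ℕ.*-monoʳ-≤ 2 ws≤n)) short≤n) ⟩
    n + (2 * n + n)                      ≡⟨ lem n ⟩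
    4 * n                                ∎
    where
      open ℕ.≤-Reasoning
      lem : ∀ n → n + (2 * n + n) ≡ 4 * n
      lem = solve-∀
      short = filter (λ w → length w ℕ.<? L) (pairs ws)
      L<σ^L : L < σ ℕ.^ L
      L<σ^L = n<b^n σ {{n>1⇒nonTrivial σ≥2}} L
      square : σ ℕ.^ L * σ ℕ.^ L ≤ n
      square = subst (_≤ n) (trans (cong (σ ℕ.^_) (cong (λ x → L + x) (ℕ.+-identityʳ L))) (ℕ.^-distribˡ-+-* σ L L)) σ^2L≤n
      short≤n : length short * L ≤ n
      short≤n = ℕ.≤-trans (ℕ.*-mono-≤ (ℕ.<⇒≤ (ℕ.≤-<-trans
        (pigeonhole (Unique.filter⁺ (λ w → length w ℕ.<? L) unique)
          (λ {w} w∈ → ∈-shortWords {L} w (proj₂ (∈-filter⁻ (λ w → length w ℕ.<? L) {xs = pairs ws} w∈))))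
        (length-shortWords L))) (ℕ.<⇒≤ L<σ^L)) square
      L≤n : L ≤ n
      L≤n = ℕ.≤-trans (ℕ.<⇒≤ L<σ^L) (ℕ.≤-trans (ℕ.m≤m*n (σ ℕ.^ L) (σ ℕ.^ L) {{ℕ.>-nonZero (ℕ.≤-<-trans z≤n L<σ^L)}}) square)

-- From metasymbols to strings

module _ {A : Set} where

  -- A list of consecutive phrases of the greedy parse with the dictionary S.
  Factor : (List A → Set) → List (List A) → Set
  Factor S Y = ∃[ i ] ∃[ u ] ∃[ ps ] ∃[ Z ] (Greedy (λ _ → S) i u ps × map content ps ≡ Y ++ Z)

  private
    prefix-extend : ∀ {ps : List (Phrase A)} w Y Z {w′} → map content ps ≡ Y ++ Z →
                    w′ IsPrefixOf (w ++ concat Y) → w′ IsPrefixOf (w ++ concat (map content ps))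
    prefix-extend w Y Z {w′} eq p with v , w++Y≡ ← prefix⇒++ p = subst (w′ IsPrefixOf_)
      (trans (sym (List.++-assoc w′ v (concat Z))) (trans (cong (_++ concat Z) (sym w++Y≡))
        (trans (List.++-assoc w (concat Y) (concat Z))
          (cong (w ++_) (trans (List.concat-++ Y Z) (cong concat (sym eq)))))))
      (++⇒prefix w′ (v ++ concat Z))

    -- Puts literal and copying phrases on the same footing: either kind is the longest prefix that
    -- lies in the dictionary or is a single symbol. Restricting the comparison to prefixes of
    -- `w ++ concat Y` makes two factors with the same string comparable, whatever follows them.
    factor-head : ∀ {S w Y} → Factor S (w ∷ Y) → w ≢ [] ×
      (S w ⊎ length w ≡ 1) ×
      (∀ w′ → w′ ≢ [] → S w′ ⊎ length w′ ≡ 1 → w′ IsPrefixOf (w ++ concat Y) → length w′ ≤ length w) ×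
      Factor S Y
    factor-head (_ , _ , [] , _ , end , ())
    factor-head {S} {Y = Y} (_ , _ , copying w ∷ ps , Z , copy refl w≢[] Sw max rest , eq)
      with refl , eq′ ← List.∷-injective eq =
      w≢[] , inj₁ Sw , longest , (_ , _ , ps , Z , rest , eq′)
      where
        longest : ∀ w′ → w′ ≢ [] → S w′ ⊎ length w′ ≡ 1 → w′ IsPrefixOf (w ++ concat Y) → length w′ ≤ length w
        longest w′ w′≢[] (inj₁ Sw′) p = max (subst (λ v → w′ IsPrefixOf (w ++ v)) (greedy-content rest)
          (prefix-extend w Y Z eq′ p)) Sw′
        longest w′ w′≢[] (inj₂ eq) p  = subst (_≤ length w) (sym eq) (1≤length w≢[])
    factor-head {S} {Y = Y} (_ , _ , literal c ∷ ps , Z , lit max rest , eq)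
      with refl , eq′ ← List.∷-injective eq =
      (λ ()) , inj₂ refl , longest , (_ , _ , ps , Z , rest , eq′)
      where
        longest : ∀ w′ → w′ ≢ [] → S w′ ⊎ length w′ ≡ 1 → w′ IsPrefixOf (c ∷ concat Y) → length w′ ≤ 1
        longest w′ w′≢[] (inj₁ Sw′) p = contradiction (max (subst (λ v → w′ IsPrefixOf (c ∷ v)) (greedy-content rest)
          (prefix-extend [ c ] Y Z eq′ p)) Sw′) w′≢[]
        longest w′ w′≢[] (inj₂ eq) p  = ℕ.≤-reflexive eq

  -- Both first phrases are prefixes of the common string, so by maximality neither is longer than the other.
  factor-injective : ∀ {S} Y Y′ → Factor S Y → Factor S Y′ → concat Y ≡ concat Y′ → Y ≡ Y′
  factor-injective [] [] _ _ _ = refl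
  factor-injective [] (w ∷ Y) _ F eq with w≢[] , _ ← factor-head F =
    contradiction (List.++-conicalˡ w (concat Y) (sym eq)) w≢[]
  factor-injective (w ∷ Y) [] F _ eq with w≢[] , _ ← factor-head F =
    contradiction (List.++-conicalˡ w (concat Y) eq) w≢[]
  factor-injective (w ∷ Y) (w′ ∷ Y′) F F′ eq
    with w≢[] , kind , max , rest ← factor-head F | w′≢[] , kind′ , max′ , rest′ ← factor-head F′
    with refl , eq′ ← ++-split w w′ {concat Y} {concat Y′} (ℕ.≤-antisym
      (max′ w w≢[] kind (subst (w IsPrefixOf_) eq (++⇒prefix w (concat Y))))
      (max w′ w′≢[] kind′ (subst (w′ IsPrefixOf_) (sym eq) (++⇒prefix w′ (concat Y′))))) eq
    = cong (w ∷_) (factor-injective Y Y′ rest rest′ eq′)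

  pairs-factor : ∀ {S i u ps} → Greedy (λ _ → S) i u ps → ∀ Ys → concat Ys ≡ map content ps →
                 All (Factor S) (pairs Ys)
  pairs-factor g []           _  = []
  pairs-factor g (X ∷ [])     _  = []
  pairs-factor {ps = ps} g (X ∷ Y ∷ Ys) eq =
    (_ , _ , ps , concat Ys , g , trans (sym eq) (sym (List.++-assoc X Y (concat Ys)))) ∷
    pairs-factor (proj₂ (proj₂ (greedy-drop g (length X)))) (Y ∷ Ys)
      (trans (sym (drop-++ X (Y ++ concat Ys))) (trans (cong (drop (length X)) eq) (List.drop-map (length X) ps)))

  unique-map-concat : ∀ {S} {Ys : List (List (List A))} → All (Factor S) Ys → Unique Ys → Unique (map concat Ys)
  unique-map-concat []       []               = []
  unique-map-concat {S} {Y ∷ Ys} (F ∷ Fs) (Y∉ ∷ unique) = distinct Fs Y∉ ∷ unique-map-concat Fs unique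
    where
      distinct : ∀ {Ys} → All (Factor S) Ys → All (Y ≢_) Ys → All (concat Y ≢_) (map concat Ys)
      distinct []                 []          = []
      distinct {Y′ ∷ _} (F′ ∷ Fs) (Y≢ ∷ Y∉) = (λ eq → Y≢ (factor-injective Y Y′ F F′ eq)) ∷ distinct Fs Y∉

  pairs-concat : ∀ (Ys : List (List (List A))) → pairs (map concat Ys) ≡ map concat (pairs Ys)
  pairs-concat []           = refl
  pairs-concat (X ∷ [])     = refl
  pairs-concat (X ∷ Y ∷ Ys) = cong₂ _∷_ (List.concat-++ X Y) (pairs-concat (Y ∷ Ys))

  -- Phrases are non-empty, so at most a - i of them begin before a. The last of these may reach
  -- beyond a, hence the remaining parse begins at some j ≥ a.
  greedy-cut : ∀ {S i u} {ps : List (Phrase A)} a → Greedy S i u ps →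
    ∃[ ps₁ ] ∃[ ps₂ ] (ps ≡ ps₁ ++ ps₂ × length ps₁ ≤ a ∸ i ×
      (ps₂ ≡ [] ⊎ ∃[ j ] (a ≤ j × i ≤ j × Greedy S j (drop (j ∸ i) u) ps₂)))
  greedy-cut {S} {i} a g with a ℕ.≤? i
  greedy-cut {S} {i} {u} {ps} a g | yes a≤i = [] , ps , refl , z≤n ,
    inj₂ (i , a≤i , ℕ.≤-refl , subst (λ m → Greedy S i (drop m u) ps) (sym (ℕ.n∸n≡0 i)) g)
  greedy-cut a end | no a≰i = [] , [] , refl , z≤n , inj₁ refl
  greedy-cut {S} {i} a (copy {w = w} {v = v} refl w≢[] Sw max rest) | no a≰i
    with ps₁ , ps₂ , refl , len , tail ← greedy-cut a rest =
      copying w ∷ ps₁ , ps₂ , refl , shorter , shift tail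
    where
      i<i+w = ℕ.m<m+n i (1≤length w≢[])
      shorter : suc (length ps₁) ≤ a ∸ i
      shorter = ℕ.≤-trans (s≤s len) (ℕ.≤-trans (s≤s (ℕ.∸-monoʳ-≤ a i<i+w)) (ℕ.≤-reflexive (sym (ℕ.+-∸-assoc 1 (ℕ.≰⇒> a≰i)))))
      shift : ps₂ ≡ [] ⊎ _ → ps₂ ≡ [] ⊎ _
      shift (inj₁ eq)                    = inj₁ eq
      shift (inj₂ (j , a≤j , i+w≤j , g)) = inj₂ (j , a≤j , ℕ.≤-trans (ℕ.m≤m+n i (length w)) i+w≤j ,
        subst (λ u → Greedy S j u ps₂) (sym (trans (drop-past-++ w v w≤j∸i)
          (cong (λ m → drop m v) (ℕ.∸-+-assoc j i (length w))))) g)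
        where w≤j∸i = subst (_≤ j ∸ i) (ℕ.m+n∸m≡n i (length w)) (ℕ.∸-monoˡ-≤ i i+w≤j)
  greedy-cut {S} {i} a (lit {c = c} {v = v} max rest) | no a≰i
    with ps₁ , ps₂ , refl , len , tail ← greedy-cut a rest =
      literal c ∷ ps₁ , ps₂ , refl ,
      ℕ.≤-trans (s≤s len) (ℕ.≤-reflexive (sym (ℕ.+-∸-assoc 1 (ℕ.≰⇒> a≰i)))) , shift tail
    where
      shift : ps₂ ≡ [] ⊎ _ → ps₂ ≡ [] ⊎ _
      shift (inj₁ eq)                  = inj₁ eq
      shift (inj₂ (j , a≤j , i<j , g)) = inj₂ (j , a≤j , ℕ.<⇒≤ i<j ,
        subst (λ m → Greedy S j (drop m (c ∷ v)) ps₂) (sym (ℕ.+-∸-assoc 1 i<j)) g)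

  expand-content : ∀ (mps : List (Phrase (List A))) (ps : List (Phrase A)) → concat (map content mps) ≡ map content ps →
                   map content (expand mps ps) ≡ map concat (map content mps)
  expand-content []                  ps       eq = refl
  expand-content (literal x ∷ mps)   (p ∷ ps) eq with refl , eq′ ← List.∷-injective eq =
    cong₂ _∷_ (sym (List.++-identityʳ x)) (expand-content mps ps eq′)
  expand-content (copying ws ∷ mps)  ps       eq = cong (concat ws ∷_)
    (expand-content mps (drop (length ws) ps)
      (trans (sym (drop-++ ws (concat (map content mps)))) (trans (cong (drop (length ws)) eq) (List.drop-map (length ws) ps))))

  relz-parsing : ∀ {ℓ} {T : List A} {phrases} (r : ReLZ ℓ T phrases) → let open ReLZ r in
    map content phrases ≡ map concat (map content metaPhrases) ×
    concat (map content (prefixPhrases ++ suffixPhrases)) ≡ T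
  relz-parsing {ℓ} {T} r =
    trans (cong (map content) expanded)
      (expand-content metaPhrases (prefixPhrases ++ suffixPhrases) (greedy-content metaParsed)) ,
    (begin
      concat (map content (prefixPhrases ++ suffixPhrases))
        ≡⟨ cong concat (List.map-++ content prefixPhrases suffixPhrases) ⟩
      concat (map content prefixPhrases ++ map content suffixPhrases)
        ≡⟨ List.concat-++ (map content prefixPhrases) (map content suffixPhrases) ⟨
      concat (map content prefixPhrases) ++ concat (map content suffixPhrases)
        ≡⟨ cong₂ _++_ (greedy-content prefixParsed) (greedy-content suffixParsed) ⟩
      take ℓ T ++ drop ℓ T ≡⟨ List.take++drop≡id ℓ T ⟩
      T ∎)
    where
      open ReLZ r
      open ≡-Reasoning

  relz-concat : ∀ {ℓ} {T : List A} {phrases} → ReLZ ℓ T phrases → concat (map content phrases) ≡ T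
  relz-concat {T = T} {phrases} r = begin
    concat (map content phrases)                          ≡⟨ cong concat (proj₁ (relz-parsing r)) ⟩
    concat (map concat (map content metaPhrases))         ≡⟨ List.concat-concat (map content metaPhrases) ⟩
    concat (concat (map content metaPhrases))             ≡⟨ cong concat (greedy-content metaParsed) ⟩
    concat (map content (prefixPhrases ++ suffixPhrases)) ≡⟨ proj₂ (relz-parsing r) ⟩
    T ∎
    where
      open ReLZ r
      open ≡-Reasoning

  relz-nonempty : ∀ {ℓ} {T : List A} {phrases} → ReLZ ℓ T phrases → All (_≢ []) (map content phrases)
  relz-nonempty {phrases = phrases} r = subst (All (_≢ [])) (sym (proj₁ (relz-parsing r)))
    (concats (map content metaPhrases) (greedy-nonempty metaParsed)
      (subst (All (_≢ [])) (sym (trans (greedy-content metaParsed) (List.map-++ content prefixPhrases suffixPhrases)))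
        (All.++⁺ (greedy-nonempty prefixParsed) (greedy-nonempty suffixParsed))))
    where
      open ReLZ r
      concats : ∀ Ys → All (_≢ []) Ys → All (_≢ []) (concat Ys) → All (_≢ []) (map concat Ys)
      concats []              _              _        = []
      concats ([] ∷ Ys)       (Y≢[] ∷ _)     _        = contradiction refl Y≢[]
      concats ((y ∷ Y) ∷ Ys)  (_ ∷ Ys≢[]) (y≢[] ∷ all) =
        (λ eq → y≢[] (List.++-conicalˡ y (concat Y) eq)) ∷ concats Ys Ys≢[] (All.++⁻ʳ Y all)

-- Meta phrases beginning among the prefix phrases are no more numerous than those, which gives the
-- first 4 n by the LZ parse of the prefix. The others consist of suffix phrases only; their pairs
-- are distinct as metastrings, hence as strings by `factor-injective`, which gives the second 4 n.
relz-length : ∀ {σ} → 2 ≤ σ → ∀ {ℓ} {T : List (Fin σ)} {phrases} → ReLZ ℓ T phrases →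
              ∀ L → σ ℕ.^ (2 * L) ≤ length T → length phrases * L ≤ 8 * length T
relz-length {σ} σ≥2 {ℓ} {T} {phrases} r L σ^2L≤n
  with mps₁ , mps₂ , mps≡ , mps₁≤ , tail ← greedy-cut (length (ReLZ.prefixPhrases r)) (ReLZ.metaParsed r) = begin
  length phrases * L
    ≡⟨ cong (_* L) (trans (sym (List.length-map content phrases)) (trans (cong length (proj₁ (relz-parsing r)))
         (trans (List.length-map concat (map content mps)) (trans (List.length-map content mps)
           (trans (cong length mps≡) (List.length-++ mps₁)))))) ⟩
  (length mps₁ + length mps₂) * L      ≡⟨ ℕ.*-distribʳ-+ L (length mps₁) (length mps₂) ⟩
  length mps₁ * L + length mps₂ * L    ≤⟨ ℕ.+-mono-≤ (ℕ.*-monoˡ-≤ L mps₁≤) (suffixBound tail) ⟩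
  length prefixPhrases * L + 4 * n     ≤⟨ ℕ.+-monoˡ-≤ (4 * n) prefixBound ⟩
  4 * n + 4 * n                        ≡⟨ lem n ⟩
  8 * n                                ∎
  where
    open ReLZ r
    open ℕ.≤-Reasoning
    n = length T
    mps = metaPhrases
    M = map content (prefixPhrases ++ suffixPhrases)
    lem : ∀ n → 4 * n + 4 * n ≡ 8 * n
    lem = solve-∀
    length-concat-≤ : ∀ (xs ys : List (List (Fin σ))) → concat (xs ++ ys) ≡ T → length (concat ys) ≤ n
    length-concat-≤ xs ys eq = subst (length (concat ys) ≤_)
      (trans (sym (List.length-++ (concat xs))) (cong length (trans (List.concat-++ xs ys) eq)))
      (ℕ.m≤n+m (length (concat ys)) (length (concat xs)))
    prefixBound : length prefixPhrases * L ≤ 4 * n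
    prefixBound = subst (λ z → z * L ≤ 4 * n) (List.length-map content prefixPhrases)
      (parse-length σ≥2 L (proj₂ (greedy-newPairs prefixParsed refl))
        (subst (λ u → length u ≤ n) (sym (greedy-content prefixParsed))
          (subst (_≤ n) (sym (List.length-take ℓ T)) (ℕ.m⊓n≤n ℓ n)))
        σ^2L≤n)
    suffixBound : mps₂ ≡ [] ⊎ ∃[ j ] (length prefixPhrases ≤ j × 0 ≤ j × Greedy (OccursBefore M) j (drop j M) mps₂) → length mps₂ * L ≤ 4 * n
    suffixBound (inj₁ eq) = subst (λ m → length m * L ≤ 4 * n) (sym eq) z≤n
    suffixBound (inj₂ (j , a≤j , _ , g)) = subst (λ z → z * L ≤ 4 * n)
      (trans (List.length-map concat (map content mps₂)) (List.length-map content mps₂))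
      (parse-length σ≥2 L
        (subst Unique (sym (pairs-concat (map content mps₂)))
          (unique-map-concat
            (pairs-factor (proj₂ (proj₂ (greedy-drop suffixParsed (j ∸ length prefixPhrases)))) (map content mps₂)
              (trans (greedy-content g) M-drop))
            (proj₂ (greedy-newPairs g refl))))
        (length-concat-≤ (map concat (map content mps₁)) (map concat (map content mps₂))
          (trans (cong concat (trans (sym (List.map-++ concat (map content mps₁) (map content mps₂)))
            (trans (cong (map concat) (trans (sym (List.map-++ content mps₁ mps₂)) (cong (map content) (sym mps≡)))) (sym (proj₁ (relz-parsing r))))))
            (relz-concat r)))
        σ^2L≤n)
      where
        M-drop : drop j M ≡ map content (drop (j ∸ length prefixPhrases) suffixPhrases)
        M-drop = trans (cong (drop j) (List.map-++ content prefixPhrases suffixPhrases))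
          (trans (drop-past-++ (map content prefixPhrases) (map content suffixPhrases)
              (subst (_≤ j) (sym (List.length-map content prefixPhrases)) a≤j))
            (trans (cong (λ m → drop (j ∸ m) (map content suffixPhrases)) (List.length-map content prefixPhrases))
              (List.drop-map (j ∸ length prefixPhrases) suffixPhrases)))

-- The distances of the phrases

module _ {σ : ℕ} where

  literalCount : List (Fin σ) → List (Phrase (Fin σ)) → ℕ
  literalCount w []               = 0
  literalCount w (literal c ∷ ps) with List.≡-dec Fin._≟_ [ c ] w
  ... | yes _ = suc (literalCount w ps)
  ... | no  _ = literalCount w ps
  literalCount w (copying _ ∷ ps) = literalCount w ps

  -- A symbol is encoded literally only at its first occurrence as a metasymbol.
  expand-literals : ∀ {M i u mps} → Greedy (OccursBefore M) i u mps → drop i M ≡ u →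
    ∀ ps → concat (map content mps) ≡ map content ps → ∀ w →
    literalCount w (expand mps ps) ≤ 1 ×
    (OccursBefore M i [ w ] → literalCount w (expand mps ps) ≡ 0)
  expand-literals end _ ps _ w = z≤n , λ _ → refl
  expand-literals {M} {i} (copy {w = ws} {ps = mps} refl _ _ _ rest) eq ps content≡ w
    with ≤1 , none ← expand-literals rest (drop-step i M ws eq) (drop (length ws) ps)
      (trans (sym (drop-++ ws (concat (map content mps))))
        (trans (cong (drop (length ws)) content≡) (List.drop-map (length ws) ps))) w
    = ≤1 , λ occ → none (OccursBefore-mono (ℕ.m≤m+n i (length ws)) occ)
  expand-literals {M} {i} (lit {c = x} {v = v} {ps = mps} max rest) eq (p ∷ ps) content≡ w
    with refl , content≡′ ← List.∷-injective content≡
    with ≤1 , none ← expand-literals rest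
      (subst (λ j → drop j M ≡ v) (ℕ.+-comm i 1) (drop-step i M [ x ] eq)) ps content≡′ w
    = byKind p refl
    where
      later : OccursBefore M i [ w ] → OccursBefore M (suc i) [ w ]
      later = OccursBefore-mono (ℕ.n≤1+n i)
      byKind : ∀ q → content q ≡ x → literalCount w (q ∷ expand mps ps) ≤ 1 ×
               (OccursBefore M i [ w ] → literalCount w (q ∷ expand mps ps) ≡ 0)
      byKind (copying _) _ = ≤1 , none ∘ later
      byKind (literal c) c≡x with List.≡-dec Fin._≟_ [ c ] w
      ... | no  _    = ≤1 , none ∘ later
      -- The metasymbol now occurs at i, so `none` excludes further literals; with an occurrence
      -- before i it would have been copied itself.
      ... | yes refl =
        s≤s (ℕ.≤-reflexive (none (i , ℕ.n<1+n i , subst ([ [ c ] ] IsPrefixOf_) (sym eq) (c≡x ∷ [])))) ,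
        λ occ → contradiction (max {[ [ c ] ]} (c≡x ∷ []) occ) λ ()

  tagged : List (Phrase (Fin σ)) → List (Code (Fin σ)) → List (List (Fin σ) × ℕ)
  tagged (p ∷ ps) (e ∷ es) = (content p , distance e) ∷ tagged ps es
  tagged _        _        = []

  Earlier : List (Fin σ) → ℕ → List (Fin σ) → ℕ → Set
  Earlier T i w x = x ≡ 0 ⊎ (x < i × w IsPrefixOf drop x T)

  earlier-mono : ∀ {T i j w x} → i ≤ j → Earlier T i w x → Earlier T j w x
  earlier-mono i≤j (inj₁ eq)        = inj₁ eq
  earlier-mono i≤j (inj₂ (x<i , p)) = inj₂ (ℕ.<-≤-trans x<i i≤j , p)

  -- x is the position of the last occurrence of w that is the start of a phrase, or 0.
  mass-gaps : ∀ {T i phrases codes} → RightmostFrom T i phrases codes →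
    drop i T ≡ concat (map content phrases) → All (_≢ []) (map content phrases) →
    ∀ w x → x ≤ i → Earlier T i w x →
    mass (tagged phrases codes) w + x ≤ (i + length (concat (map content phrases))) + literalCount w phrases * σ
  mass-gaps {i = i} end _ _ w x x≤i _ = ℕ.≤-trans x≤i (ℕ.≤-trans (ℕ.m≤m+n i 0) (ℕ.m≤m+n (i + 0) 0))
  mass-gaps {T} {i} (lit {c = c} {ps = ps} {es = es} rest) eq (_ ∷ nonempty) w x x≤i valid
    with IH ← mass-gaps rest (subst (λ j → drop j T ≡ concat (map content ps)) (ℕ.+-comm i 1) (drop-step i T [ c ] eq))
                nonempty w x (ℕ.m≤n⇒m≤1+n x≤i) (earlier-mono (ℕ.n≤1+n i) valid)
    with List.≡-dec Fin._≟_ [ c ] w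
  ... | yes _ = begin
    (σ + mass (tagged ps es) w) + x     ≡⟨ ℕ.+-assoc σ (mass (tagged ps es) w) x ⟩
    σ + (mass (tagged ps es) w + x)     ≤⟨ ℕ.+-monoʳ-≤ σ IH ⟩
    σ + ((suc i + len) + lits * σ)      ≡⟨ lem σ i len (lits * σ) ⟩
    (i + suc len) + (σ + lits * σ)      ∎
    where
      open ℕ.≤-Reasoning
      len = length (concat (map content ps))
      lits = literalCount w ps
      lem : ∀ s i l m → s + ((suc i + l) + m) ≡ (i + suc l) + (s + m)
      lem = solve-∀
  ... | no _ = subst (λ m → mass (tagged ps es) w + x ≤ m + literalCount w ps * σ)
    (sym (ℕ.+-suc i (length (concat (map content ps))))) IH
  mass-gaps {T} {i} (copy {w = w′} {d = d} {ps = ps} {es = es} (1≤d , d≤i , src) minimal rest) eq (w′≢[] ∷ nonempty) w x x≤i valid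
    with List.≡-dec Fin._≟_ w′ w
  ... | no _ = subst (λ m → mass (tagged ps es) w + x ≤ m + literalCount w ps * σ)
    (trans (ℕ.+-assoc i (length w′) (length (concat (map content ps)))) (cong (λ m → i + m) (sym (List.length-++ w′))))
    (mass-gaps rest (drop-step i T w′ eq) nonempty w x (ℕ.≤-trans x≤i (ℕ.m≤m+n i (length w′))) (earlier-mono (ℕ.m≤m+n i (length w′)) valid))
  ... | yes refl = begin
    (d + mass (tagged ps es) w) + x     ≡⟨ lem d (mass (tagged ps es) w) x ⟩
    mass (tagged ps es) w + (d + x)     ≤⟨ ℕ.+-monoʳ-≤ (mass (tagged ps es) w) (d+x≤i valid) ⟩
    mass (tagged ps es) w + i
      ≤⟨ mass-gaps rest (drop-step i T w eq) nonempty w i (ℕ.m≤m+n i (length w))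
           (inj₂ (ℕ.m<m+n i (1≤length w′≢[]) , subst (w IsPrefixOf_) (sym eq) (++⇒prefix w (concat (map content ps))))) ⟩
    ((i + length w) + len) + literalCount w ps * σ
      ≡⟨ cong (_+ literalCount w ps * σ) (trans (ℕ.+-assoc i (length w) len) (cong (λ m → i + m) (sym (List.length-++ w)))) ⟩
    (i + length (w ++ concat (map content ps))) + literalCount w ps * σ ∎
    where
      open ℕ.≤-Reasoning
      len = length (concat (map content ps))
      lem : ∀ d m x → (d + m) + x ≡ m + (d + x)
      lem = solve-∀
      -- Going back to an earlier phrase at x is an admissible source, and d is minimal, so d ≤ i -
      -- x. These gaps telescope; before the first occurrence d ≤ i suffices.
      d+x≤i : Earlier T i w x → d + x ≤ i
      d+x≤i (inj₁ refl)      = subst (_≤ i) (sym (ℕ.+-identityʳ d)) d≤i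
      d+x≤i (inj₂ (x<i , p)) = ℕ.≤-trans (ℕ.+-monoˡ-≤ x (minimal
        (ℕ.m<n⇒0<n∸m x<i , ℕ.m∸n≤m i x , subst (λ j → w IsPrefixOf drop j T) (sym (ℕ.m∸[m∸n]≡n x≤i)) p)))
        (ℕ.≤-reflexive (ℕ.m∸n+n≡m x≤i))

  encoding-moderate : ∀ {T i h} {phrases : List (Phrase (Fin σ))} {codes : List (Code (Fin σ))} → RightmostFrom T i phrases codes →
    All (_≢ []) (map content phrases) → i + length (concat (map content phrases)) ≤ 2 ℕ.^ (2 ℕ.^ h) →
    1 ≤ σ → σ ≤ 2 ℕ.^ (2 ℕ.^ h) → All (Moderate h) codes
  encoding-moderate end _ _ _ _ = []
  encoding-moderate {i = i} {h = h} (lit {ps = ps} rest) (_ ∷ nonempty) i≤ 1≤σ σ≤ = (1≤σ , σ≤ , s≤s z≤n) ∷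
    encoding-moderate {h = h} rest nonempty (subst (_≤ 2 ℕ.^ (2 ℕ.^ h)) (ℕ.+-suc i (length (concat (map content ps)))) i≤) 1≤σ σ≤
  encoding-moderate {i = i} {h = h} (copy {w = w} {ps = ps} (1≤d , d≤i , _) _ rest) (w≢[] ∷ nonempty) i≤ 1≤σ σ≤ =
    (1≤d , ℕ.≤-trans d≤i (ℕ.≤-trans (ℕ.m≤m+n i _) i≤) , 1≤length w≢[]) ∷
    encoding-moderate {h = h} rest nonempty (subst (_≤ 2 ℕ.^ (2 ℕ.^ h))
      (trans (cong (λ m → i + m) (List.length-++ w)) (sym (ℕ.+-assoc i (length w) (length (concat (map content ps)))))) i≤) 1≤σ σ≤

  encoding-spans : ∀ {T i} {phrases : List (Phrase (Fin σ))} {codes : List (Code (Fin σ))} →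
    RightmostFrom T i phrases codes → map span codes ≡ map length (map content phrases)
  encoding-spans end                    = refl
  encoding-spans (lit rest)             = cong (1 ∷_) (encoding-spans rest)
  encoding-spans (copy {w = w} _ _ rest) = cong (length w ∷_) (encoding-spans rest)

  encoding-tagged : ∀ {T i} {phrases : List (Phrase (Fin σ))} {codes : List (Code (Fin σ))} →
    RightmostFrom T i phrases codes →
    map proj₁ (tagged phrases codes) ≡ map content phrases × map proj₂ (tagged phrases codes) ≡ map distance codes
  encoding-tagged end = refl , refl
  encoding-tagged (lit {c = c} rest) with eq₁ , eq₂ ← encoding-tagged rest =
    cong ([ c ] ∷_) eq₁ , cong (σ ∷_) eq₂
  encoding-tagged (copy {w = w} {d = d} _ _ rest) with eq₁ , eq₂ ← encoding-tagged rest =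
    cong (w ∷_) eq₁ , cong (d ∷_) eq₂

-- The product of the distances

floor : ∀ y → 0ℚ ℚ.≤ y → ∃[ N ] (fromℕ N ℚ.≤ y × y ℚ.≤ fromℕ (suc N))
floor y@(mkℚ (+ a) d _) _ = N ,
  *-cancelʳ (0<fromℕ {D} (s≤s z≤n)) (subst₂ ℚ._≤_ (fromℕ-* N D) (sym (p*↧p≡↥p y))
    (fromℕ-mono-≤ (ℕ.m/n*n≤m a D))) ,
  *-cancelʳ (0<fromℕ {D} (s≤s z≤n)) (subst₂ ℚ._≤_ (sym (p*↧p≡↥p y)) (fromℕ-* (suc N) D)
    (fromℕ-mono-≤ (begin
      a                  ≡⟨ ℕ.m≡m%n+[m/n]*n a D ⟩
      a ℕ.% D + N * D    ≤⟨ ℕ.+-monoˡ-≤ (N * D) (ℕ.<⇒≤ (ℕ.m%n<n a D)) ⟩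
      suc N * D          ∎)))
  where
    open ℕ.≤-Reasoning
    D = suc d
    N = a ℕ./ D
floor (mkℚ -[1+ _ ] _ _) (ℚ.*≤* ())

-- The integer form of log y ≤ t + y / 2 ^ t. The bound on e is linear in y, so the exponents of all
-- phrases can be added.
≤2^[t+e] : ∀ t y → 0ℚ ℚ.≤ y → ∃[ e ] (y ℚ.≤ fromℕ 2 ^ (t + e) × fromℕ (e * 2 ℕ.^ t) ℚ.≤ y)
≤2^[t+e] t y 0≤y =
  let N , N≤y , y≤1+N = floor y 0≤y
  in N /2^ t , ℚ.≤-trans y≤1+N (fromℕ-≤-2^ (t + N /2^ t) (<2^[t+] t N)) ,
     ℚ.≤-trans (fromℕ-mono-≤ (/2^-* N t)) N≤y

-- d is d p times 1 / p, and 1 / p is at most h w g. In the application p is the model probability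
-- of a phrase, h its halting factor, w its windows and g the power of σ for the uniform start.
unfold-bound : ∀ {d p h w g a b c} → 0ℚ ℚ.≤ d → 0ℚ ℚ.≤ p → 0ℚ ℚ.≤ h → 0ℚ ℚ.≤ w → 0ℚ ℚ.≤ g →
               1ℚ ℚ.≤ ((p ℚ.* h) ℚ.* w) ℚ.* g → d ℚ.* p ℚ.≤ a → h ℚ.≤ b → g ℚ.≤ c →
               d ℚ.≤ (a ℚ.* (b ℚ.* c)) ℚ.* w
unfold-bound {d} {p} {h} {w} {g} {a} {b} {c} 0≤d 0≤p 0≤h 0≤w 0≤g 1≤ dp≤a h≤b g≤c = begin
  d                                      ≡⟨ ℚ.*-identityʳ d ⟨
  d ℚ.* 1ℚ                               ≤⟨ *-monoˡ 0≤d 1≤ ⟩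
  d ℚ.* (((p ℚ.* h) ℚ.* w) ℚ.* g)
    ≡⟨ solve 5 (λ d p h w g → d :* (((p :* h) :* w) :* g) := ((d :* p) :* (h :* g)) :* w) refl d p h w g ⟩
  ((d ℚ.* p) ℚ.* (h ℚ.* g)) ℚ.* w
    ≤⟨ *-monoʳ 0≤w (*-mono (0≤* 0≤d 0≤p) dp≤a (0≤* 0≤h 0≤g) (*-mono 0≤h h≤b 0≤g g≤c)) ⟩
  (a ℚ.* (b ℚ.* c)) ℚ.* w                ∎
  where
    open ℚ.≤-Reasoning
    open +-*-Solver

product-bound : ∀ {x d p a b v w} → x ≡ d ℚ.* p → 0ℚ ℚ.≤ d → 0ℚ ℚ.≤ p → d ℚ.≤ a ℚ.* v → p ℚ.≤ b ℚ.* w →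
                x ℚ.≤ (a ℚ.* b) ℚ.* (v ℚ.* w)
product-bound {x} {d} {p} {a} {b} {v} {w} eq 0≤d 0≤p d≤ p≤ = subst₂ ℚ._≤_ (sym eq)
  (solve 4 (λ a v b w → (a :* v) :* (b :* w) := (a :* b) :* (v :* w)) refl a v b w)
  (*-mono 0≤d d≤ 0≤p p≤)
  where open +-*-Solver

module _ {σ : ℕ} .{{_ : ℕ.NonZero σ}} (k : ℕ) (T : List (Fin σ)) (s t : ℕ) (σ≤2^s : σ ≤ 2 ℕ.^ s) where

  open ContextModel k T

  -- The number of bits by which the probability of w may fall short of its windows.
  loss : List (Fin σ) → ℕ
  loss w = 2 * (t + length w /2^ t) + 1 + s * k

  0≤haltFactor : ∀ l → 0ℚ ℚ.≤ haltFactor l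
  0≤haltFactor l = 0≤fromℕ (suc l * suc (suc l))

  haltFactor-≤ : ∀ l → haltFactor l ℚ.≤ fromℕ 2 ^ (2 * (t + l /2^ t) + 1)
  haltFactor-≤ l = fromℕ-≤-2^ (2 * (t + l /2^ t) + 1) (begin
    suc l * suc (suc l)       ≤⟨ ℕ.*-mono-≤ (<2^[t+] t l) 2+l≤ ⟩
    m * (2 * m)               ≡⟨ lem m ⟩
    2 * (m * m)               ≡⟨ cong (2 *_) (ℕ.^-distribˡ-+-* 2 x x) ⟨
    2 * 2 ℕ.^ (x + x)         ≡⟨ cong (λ y → 2 * 2 ℕ.^ (x + y)) (ℕ.+-identityʳ x) ⟨
    2 * 2 ℕ.^ (2 * x)         ≡⟨ cong (2 ℕ.^_) (ℕ.+-comm 1 (2 * x)) ⟩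
    2 ℕ.^ (2 * x + 1)         ∎)
    where
      open ℕ.≤-Reasoning
      x = t + l /2^ t
      m = 2 ℕ.^ x
      lem : ∀ m → m * (2 * m) ≡ 2 * (m * m)
      lem = solve-∀
      2+l≤ : suc (suc l) ≤ 2 * m
      2+l≤ = subst (suc (suc l) ≤_) (cong (λ y → m + y) (sym (ℕ.+-identityʳ m)))
        (ℕ.+-mono-≤ (ℕ.m^n>0 2 x) (<2^[t+] t l))

  σ^k-≤ : fromℕ σ ^ k ℚ.≤ fromℕ 2 ^ (s * k)
  σ^k-≤ = subst (fromℕ σ ^ k ℚ.≤_) (^-assocʳ (fromℕ 2) s k)
    (^-mono-≤ (0≤fromℕ σ) (fromℕ-≤-2^ s σ≤2^s) k)

  -- Here y is the distance times the probability of w. Its exponent e is kept apart from the loss,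
  -- because only the sum of all e, and not a single one, is controlled by the masses.
  word-bound : ∀ w d → Occurs T w → ∃[ e ]
    (fromℕ d ℚ.≤ fromℕ 2 ^ ((t + e) + loss w) ℚ.* windows w × fromℕ (e * 2 ℕ.^ t) ℚ.≤ fromℕ d ℚ.* prob 0 [] w)
  word-bound w d occ =
    let e , y≤ , e≤ = ≤2^[t+e] t (fromℕ d ℚ.* prob 0 [] w) (0≤* (0≤fromℕ d) (0≤prob 0 [] w))
    in e , subst (λ x → fromℕ d ℚ.≤ x ℚ.* windows w) (exponents e)
             (unfold-bound {p = prob 0 [] w} (0≤fromℕ d) (0≤prob 0 [] w) (0≤haltFactor (length w)) (ℚ.≤-trans 0≤1ℚ (1≤windows w))
               (0≤^ (0≤fromℕ σ) k) (prob-≥ w occ) y≤ (haltFactor-≤ (length w)) σ^k-≤) ,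
       e≤
    where
      exponents : ∀ e → fromℕ 2 ^ (t + e) ℚ.* (fromℕ 2 ^ (2 * (t + length w /2^ t) + 1) ℚ.* fromℕ 2 ^ (s * k)) ≡
                        fromℕ 2 ^ ((t + e) + loss w)
      exponents e = trans
        (cong (fromℕ 2 ^ (t + e) ℚ.*_) (sym (^-homo-* (fromℕ 2) (2 * (t + length w /2^ t) + 1) (s * k))))
        (sym (^-homo-* (fromℕ 2) (t + e) (loss w)))

  words-bound : ∀ X → All (λ x → Occurs T (proj₁ x)) X → ∃[ E ]
    (fromℕ (product (map proj₂ X)) ℚ.≤
       fromℕ 2 ^ (E + sum (map (λ x → t + loss (proj₁ x)) X)) ℚ.* foldr (λ w → windows w ℚ.*_) 1ℚ (map proj₁ X) ×
     fromℕ (E * 2 ℕ.^ t) ℚ.≤ weighted [] X)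
  words-bound [] [] = 0 , ℚ.≤-refl , ℚ.≤-refl
  words-bound ((w , d) ∷ X) (occ ∷ occs) =
    let e , d≤ , e≤ = word-bound w d occ
        E , X≤ , E≤ = words-bound X occs
    in E + e ,
       subst (λ a → fromℕ (d * product (map proj₂ X)) ℚ.≤ a ℚ.* (windows w ℚ.* W)) (exponents e E)
         (product-bound {a = fromℕ 2 ^ ((t + e) + loss w)} {b = fromℕ 2 ^ (E + Σκ)} {v = windows w} {w = W} (fromℕ-* d (product (map proj₂ X))) (0≤fromℕ d) (0≤fromℕ (product (map proj₂ X))) d≤ X≤) ,
       subst (ℚ._≤ weighted [] ((w , d) ∷ X))
         (trans (sym (fromℕ-+ (E * 2 ℕ.^ t) (e * 2 ℕ.^ t))) (cong fromℕ (sym (ℕ.*-distribʳ-+ (2 ℕ.^ t) E e))))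
         (ℚ.+-mono-≤ E≤ e≤)
    where
      Σκ = sum (map (λ x → t + loss (proj₁ x)) X)
      W = foldr (λ w → windows w ℚ.*_) 1ℚ (map proj₁ X)
      lem : ∀ t e l E S → ((t + e) + l) + (E + S) ≡ (E + e) + ((t + l) + S)
      lem = solve-∀
      exponents : ∀ e E → fromℕ 2 ^ ((t + e) + loss w) ℚ.* fromℕ 2 ^ (E + Σκ) ≡ fromℕ 2 ^ ((E + e) + ((t + loss w) + Σκ))
      exponents e E = trans (sym (^-homo-* (fromℕ 2) ((t + e) + loss w) (E + Σκ))) (cong (fromℕ 2 ^_) (lem t e (loss w) E Σκ))

-- The cost of an encoding

excess : ℕ → List ℕ → ℕ
excess t ls = sum (map (_/2^ t) ls)

excess-* : ∀ t ls → excess t ls * 2 ℕ.^ t ≤ sum ls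
excess-* t []       = z≤n
excess-* t (l ∷ ls) = subst (_≤ l + sum ls) (sym (ℕ.*-distribʳ-+ (2 ℕ.^ t) (l /2^ t) (excess t ls)))
  (ℕ.+-mono-≤ (/2^-* l t) (excess-* t ls))

module _ {σ : ℕ} where

  sum-overhead : ∀ C h t (codes : List (Code (Fin σ))) →
    sum (map (overhead C h t) codes) ≡ C * (length codes * (1 + h + t) + excess t (map span codes))
  sum-overhead C h t []          = sym (ℕ.*-zeroʳ C)
  sum-overhead C h t (e ∷ codes) = trans (cong (λ x → overhead C h t e + x) (sum-overhead C h t codes))
    (lem C (1 + h) t (length codes * (1 + h + t)) (span e /2^ t) (excess t (map span codes)))
    where
      lem : ∀ C a t z x y → C * (a + (t + x)) + C * (z + y) ≡ C * (((a + t) + z) + (x + y))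
      lem = solve-∀

  length-concat : ∀ (ws : List (List (Fin σ))) → sum (map length ws) ≡ length (concat ws)
  length-concat []       = refl
  length-concat (w ∷ ws) = trans (cong (λ x → length w + x) (length-concat ws)) (sym (List.length-++ w))

  occurs-concat : ∀ {T : List (Fin σ)} a ws → a ++ concat ws ≡ T → All (Occurs T) ws
  occurs-concat a []       eq = []
  occurs-concat a (w ∷ ws) eq = (a , concat ws , sym eq) ∷
    occurs-concat (a ++ w) ws (trans (List.++-assoc a w (concat ws)) eq)

  sum-loss : ∀ {{_ : ℕ.NonZero σ}} k T s t (σ≤2^s : σ ≤ 2 ℕ.^ s) (X : List (List (Fin σ) × ℕ)) →
    sum (map (λ x → t + loss k T s t σ≤2^s (proj₁ x)) X) ≡
    length X * (1 + 3 * t + s * k) + 2 * excess t (map length (map proj₁ X))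
  sum-loss k T s t σ≤2^s []            = refl
  sum-loss k T s t σ≤2^s ((w , d) ∷ X) = trans (cong (λ x → (t + loss k T s t σ≤2^s w) + x) (sum-loss k T s t σ≤2^s X))
    (lem t (length w /2^ t) (s * k) (length X * (1 + 3 * t + s * k)) (excess t (map length (map proj₁ X))))
    where
      lem : ∀ t x a z y → (t + (2 * (t + x) + 1 + a)) + (z + 2 * y) ≡ ((1 + 3 * t + a) + z) + 2 * (x + y)
      lem = solve-∀

  relz-mass : ∀ {ℓ} {T : List (Fin σ)} {phrases codes} → ReLZ ℓ T phrases → RightmostEncoding T phrases codes →
              ∀ w → mass (tagged phrases codes) w ≤ length T + σ
  relz-mass {T = T} {phrases} {codes} r encoding w = begin
    mass (tagged phrases codes) w       ≡⟨ ℕ.+-identityʳ (mass (tagged phrases codes) w) ⟨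
    mass (tagged phrases codes) w + 0
      ≤⟨ mass-gaps encoding (sym (relz-concat r)) (relz-nonempty r) w 0 z≤n (inj₁ refl) ⟩
    length (concat (map content phrases)) + literalCount w phrases * σ
      ≤⟨ ℕ.+-mono-≤ (ℕ.≤-reflexive (cong length (relz-concat r))) (ℕ.*-monoˡ-≤ σ (subst (λ ps → literalCount w ps ≤ 1) (sym expanded)
           (proj₁ (expand-literals metaParsed refl (prefixPhrases ++ suffixPhrases) (greedy-content metaParsed) w)))) ⟩
    length T + 1 * σ                    ≡⟨ cong (λ x → length T + x) (ℕ.*-identityˡ σ) ⟩
    length T + σ ∎
    where
      open ReLZ r
      open ℕ.≤-Reasoning

  module _ {{_ : ℕ.NonZero σ}} (k : ℕ) {T : List (Fin σ)} (T≢[] : 1 ≤ length T) {ℓ phrases codes}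
           (r : ReLZ ℓ T phrases) (encoding : RightmostEncoding T phrases codes)
           {C : ℕ} {bits : Code (Fin σ) → ℝ} (bound : BitBound C σ bits)
           (s h : ℕ) (σ≤2^s : σ ≤ 2 ℕ.^ s) (n≤ : length T ≤ 2 ℕ.^ (2 ℕ.^ h)) (σ≤ : σ ≤ 2 ℕ.^ (2 ℕ.^ h)) where

    private
      open ContextModel k T
      X = tagged phrases codes
      ws = map content phrases
      words≡ = proj₁ (encoding-tagged encoding)
      dists≡ = proj₂ (encoding-tagged encoding)
      z = length phrases
      -- The same h bounds the terms log log d and serves as the threshold t of the linear bounds,
      -- because 2 ^ h will be of the order of log n.
      F = excess h (map length ws)
      Y = entropyProduct (Σ^ k) (λ W → following W T)
      Ov = C * (z * (1 + h + h) + F)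

      length-codes : length codes ≡ z
      length-codes = trans (sym (List.length-map span codes)) (trans (cong length (encoding-spans encoding))
        (trans (List.length-map length ws) (List.length-map content phrases)))

      length-X : length X ≡ z
      length-X = trans (sym (List.length-map proj₁ X)) (trans (cong length words≡) (List.length-map content phrases))

      overhead≡ : sum (map (overhead C h h) codes) ≡ Ov
      overhead≡ = trans (sum-overhead C h h codes) (cong₂ (λ m ls → C * (m * (1 + h + h) + excess h ls))
        length-codes (encoding-spans encoding))

      loss≡ : sum (map (λ x → h + loss k T s h σ≤2^s (proj₁ x)) X) ≡ z * (1 + 3 * h + s * k) + 2 * F
      loss≡ = trans (sum-loss k T s h σ≤2^s X) (cong₂ (λ m us → m * (1 + 3 * h + s * k) + 2 * excess h (map length us))
        length-X words≡)

      wordsBound = words-bound k T s h σ≤2^s X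
        (All.map⁻ (subst (All (Occurs T)) (sym words≡) (occurs-concat [] ws (relz-concat r))))
      E = proj₁ wordsBound

      moderate : All (Moderate h) codes
      moderate = encoding-moderate {h = h} encoding (relz-nonempty r)
        (subst (λ u → length u ≤ 2 ℕ.^ (2 ℕ.^ h)) (sym (relz-concat r)) n≤) (ℕ.>-nonZero⁻¹ σ) σ≤

      -- The leading 1 pays for the factor 2 in `codes-≤`.
      A = 1 + (E + (z * (1 + 3 * h + s * k) + 2 * F))

      product-≤ : fromℕ (2 * product (map distance codes)) ℚ.≤ fromℕ 2 ^ A ℚ.* Y
      product-≤ = begin
        fromℕ (2 * product (map distance codes))          ≡⟨ fromℕ-* 2 (product (map distance codes)) ⟩
        fromℕ 2 ℚ.* fromℕ (product (map distance codes))  ≡⟨ cong (λ ds → fromℕ 2 ℚ.* fromℕ (product ds)) dists≡ ⟨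
        fromℕ 2 ℚ.* fromℕ (product (map proj₂ X))
          ≤⟨ *-monoˡ (0≤fromℕ 2) (proj₁ (proj₂ wordsBound)) ⟩
        fromℕ 2 ℚ.* (fromℕ 2 ^ (E + sum (map (λ x → h + loss k T s h σ≤2^s (proj₁ x)) X)) ℚ.*
          foldr (λ w → windows w ℚ.*_) 1ℚ (map proj₁ X))
          ≡⟨ cong₂ (λ x us → fromℕ 2 ℚ.* (fromℕ 2 ^ (E + x) ℚ.* foldr (λ w → windows w ℚ.*_) 1ℚ us)) loss≡ words≡ ⟩
        fromℕ 2 ℚ.* (fromℕ 2 ^ (E + (z * (1 + 3 * h + s * k) + 2 * F)) ℚ.* foldr (λ w → windows w ℚ.*_) 1ℚ ws)
          ≡⟨ ℚ.*-assoc (fromℕ 2) (fromℕ 2 ^ (E + (z * (1 + 3 * h + s * k) + 2 * F))) (foldr (λ w → windows w ℚ.*_) 1ℚ ws) ⟨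
        fromℕ 2 ^ A ℚ.* foldr (λ w → windows w ℚ.*_) 1ℚ ws
          ≤⟨ *-monoˡ (0≤^ (0≤fromℕ 2) A) (ℚ.≤-trans (windows-concat ws)
               (subst (λ u → windows u ℚ.≤ Y) (sym (relz-concat r)) (windows≤entropyProduct T))) ⟩
        fromℕ 2 ^ A ℚ.* Y ∎
        where open ℚ.≤-Reasoning

    -- E collects the linear parts of the bounds for the distances, F those for the phrase lengths.
    -- The whole error is a natural number, so that its estimate is a matter of natural arithmetic.
    encoding-cost : ∃[ E ] ∃[ F ] (E * 2 ℕ.^ h ≤ length T + σ × F * 2 ℕ.^ h ≤ length T ×
      ∀ {q} → sumʳ (map bits codes) ∋ q → ∃[ a ] ∃[ b ] ((fromℕ (length T) · H k T) ∋ a × q ℚ.< a ℚ.+ b ×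
        b ℚ.< fromℕ ((1 + (E + (length phrases * (1 + 3 * h + s * k) + 2 * F))) +
                     C * (length phrases * (1 + h + h) + F))))
    encoding-cost = E , F ,
      fromℕ-cancel-≤ (ℚ.≤-trans (proj₂ (proj₂ wordsBound)) (weighted-≤ [] X (relz-mass r encoding))) ,
      subst (F * 2 ℕ.^ h ≤_) (trans (length-concat ws) (cong length (relz-concat r))) (excess-* h (map length ws)) ,
      λ q∈ →
        let a , above , q< = LogPlus.bound (codes-≤ C h h bound moderate) q∈
            0<Y , Y≤nH = logBelow-H k T T≢[]
            -- The logarithm of 2 ^ A · Y falls into the error A and n H_k(T).
            a₁ , a₂ , above₁ , above₂ , a< = LogAbove-split (0<^ (0<fromℕ (s≤s z≤n)) A) 0<Y (LogAbove-mono product-≤ above)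
            Ov′ = fromℕ (sum (map (overhead C h h) codes))
        in a₂ , a₁ ℚ.+ Ov′ , Y≤nH above₂ ,
           ℚ.<-trans q< (subst (a ℚ.+ Ov′ ℚ.<_)
             (trans (cong (ℚ._+ Ov′) (ℚ.+-comm a₁ a₂)) (ℚ.+-assoc a₂ a₁ Ov′)) (ℚ.+-monoˡ-< Ov′ a<)) ,
           subst (a₁ ℚ.+ Ov′ ℚ.<_)
             (trans (cong (λ o → fromℕ A ℚ.+ fromℕ o) overhead≡) (sym (fromℕ-+ A Ov)))
             (ℚ.+-monoˡ-< Ov′ (LogAbove-2^ A ℚ.≤-refl above₁))

-- Parameters

-- From ½ k < ε log_σ n with ε = 1 / (2 (M + 1)).
littleO⇒power-≤ : ∀ (σ k : ℕ → ℕ) (σ≥2 : ∀ n → 2 ≤ σ n) →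
  IsLittleO (λ n → fromℚ (fromℕ (k n))) (λ n → logBaseℕ (σ n) {{n>1⇒nonTrivial (σ≥2 n)}} n) →
  ∀ M → ∃[ N ] ∀ n → N ≤ n → 1 ≤ n → σ n ℕ.^ (k n * M) ≤ n
littleO⇒power-≤ σ k σ≥2 k=o M = proj₁ small , λ n N≤n 1≤n → bound n N≤n 1≤n (k n) refl
  where
    ε = unit (M + suc M)
    instance
      ε>0 : Positive ε
      ε>0 = ℚ.1/pos⇒pos (fromℕ (suc (M + suc M)))
    small = k=o ε
    bound : ∀ n → proj₁ small ≤ n → 1 ≤ n → ∀ κ → k n ≡ κ → σ n ℕ.^ (κ * M) ≤ n
    -- Separate because ½ k lies in the cut of k only for k > 0.
    bound n _ 1≤n zero _ = 1≤n
    bound n@(suc _) N≤n _ (suc κ) k≡ = fromℕ-cancel-≤ (begin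
      fromℕ (b ℕ.^ (K * M))          ≡⟨ fromℕ-^ b (K * M) ⟩
      fromℕ b ^ (K * M)              ≤⟨ Pow-rescale b {K * M} {0} {1} {m} {n′} {suc D-1} {r} 0<r exps pow ⟩
      r ^ 1 ℚ.* 1ℚ                   ≡⟨ trans (ℚ.*-identityʳ (r ^ 1)) (ℚ.*-identityʳ r) ⟩
      r                              ≤⟨ ℚ.<⇒≤ r<x ⟩
      fromℕ n                        ∎)
      where
        open ℚ.≤-Reasoning
        open +-*-Solver
        b = σ n
        K = suc κ
        instance _ = ℕ.>-nonZero (ℕ.≤-trans (s≤s z≤n) (σ≥2 n))
                 _ = n>1⇒nonTrivial (σ≥2 n)
        q = ½ ℚ.* fromℕ K
        q<k : q ℚ.< fromℕ (k n)
        q<k = subst (λ x → q ℚ.< fromℕ x) (sym k≡) (subst (q ℚ.<_) (ℚ.*-identityˡ (fromℕ K))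
          (*-monoʳ-< (0<fromℕ {K} (s≤s z≤n)) (from-yes (½ ℚ.<? 1ℚ))))
        member = proj₂ small n N≤n q<k
        a = proj₁ member
        above : LogAbove b (fromℕ n) a
        above = log⇒LogAbove {x>0 = fromℕ-mono-< (s≤s z≤n)} (proj₁ (proj₂ member))
        open LogAbove above renaming (n to n′)
        KM<a : fromℕ (K * M) ℚ.< a
        KM<a = begin-strict
          fromℕ (K * M)                            ≡⟨ fromℕ-* K M ⟩
          fromℕ K ℚ.* fromℕ M                      ≤⟨ *-monoˡ (0≤fromℕ K) (fromℕ-mono-≤ (ℕ.n≤1+n M)) ⟩
          fromℕ K ℚ.* fromℕ (suc M)                ≡⟨ cong (fromℕ K ℚ.*_) (sym (half (fromℕ (suc M)))) ⟩
          fromℕ K ℚ.* (½ ℚ.* (fromℕ (suc M) ℚ.+ fromℕ (suc M)))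
            ≡⟨ cong (λ x → fromℕ K ℚ.* (½ ℚ.* x)) (fromℕ-+ (suc M) (suc M)) ⟨
          fromℕ K ℚ.* (½ ℚ.* J)                    ≡⟨ solve 3 (λ k h j → k :* (h :* j) := (h :* k) :* j) refl (fromℕ K) ½ J ⟩
          q ℚ.* J                                  <⟨ *-monoʳ-< (0<fromℕ {suc (M + suc M)} (s≤s z≤n)) (proj₂ (proj₂ member)) ⟩
          (ε ℚ.* a) ℚ.* J                          ≡⟨ solve 3 (λ e a j → (e :* a) :* j := (e :* j) :* a) refl ε a J ⟩
          (ε ℚ.* J) ℚ.* a                          ≡⟨ cong (ℚ._* a) (unit-inverse (M + suc M)) ⟩
          1ℚ ℚ.* a                                 ≡⟨ ℚ.*-identityˡ a ⟩
          a                                        ∎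
          where
            J = fromℕ (suc (M + suc M))
            half : ∀ x → ½ ℚ.* (x ℚ.+ x) ≡ x
            half x = trans (ℚ.*-distribˡ-+ ½ x x) (trans (sym (ℚ.*-distribʳ-+ x ½ ½)) (ℚ.*-identityˡ x))
        exps : (K * M) * suc D-1 + n′ * 1 ≤ m * 1 + 0 * suc D-1
        exps = subst₂ _≤_ (cong (λ x → (K * M) * suc D-1 + x) (sym (ℕ.*-identityʳ n′)))
          (sym (trans (ℕ.+-identityʳ (m * 1)) (ℕ.*-identityʳ m)))
          (fromℕ-cancel-≤ (begin
            fromℕ ((K * M) * suc D-1 + n′)
              ≡⟨ trans (fromℕ-+ ((K * M) * suc D-1) n′) (cong (ℚ._+ fromℕ n′) (fromℕ-* (K * M) (suc D-1))) ⟩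
            fromℕ (K * M) ℚ.* fromℕ (suc D-1) ℚ.+ fromℕ n′
              ≤⟨ ℚ.+-monoˡ-≤ (fromℕ n′) (*-monoʳ (0≤fromℕ (suc D-1)) (ℚ.<⇒≤ KM<a)) ⟩
            a ℚ.* fromℕ (suc D-1) ℚ.+ fromℕ n′ ≤⟨ ℚ.<⇒≤ below ⟩
            fromℕ m ∎))

-- (3/4 · 2 ^ s)² ≥ 2 ^ s replaces a square root of 2 ^ s.
logAbove-2^ : ∀ {σ s} → 1 ≤ s → 2 ℕ.^ s ≤ σ → LogAbove 2 (fromℕ σ) (fromℕ s ℚ.* (½ ℚ.* ½))
logAbove-2^ {σ} {s@(suc s-1)} _ 2^s≤σ = logAbove {m = s} {n = 0} {D-1 = 1} {r = r}
  (0<* 0<3/4 (0<^ (0<fromℕ (s≤s z≤n)) s))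
  (ℚ.<-≤-trans (subst (r ℚ.<_) (ℚ.*-identityˡ B) (*-monoʳ-< (0<^ (0<fromℕ (s≤s z≤n)) s) (from-yes (3/4 ℚ.<? 1ℚ))))
    (subst (ℚ._≤ fromℕ σ) (fromℕ-^ 2 s) (fromℕ-mono-≤ 2^s≤σ)))
  below
  (begin
    B                                     ≡⟨ ℚ.*-identityʳ B ⟨
    B ℚ.* 1ℚ                              ≤⟨ *-monoˡ (0≤^ (0≤fromℕ 2) s) (from-yes (1ℚ ℚ.≤? (3/4 ℚ.* 3/4) ℚ.* fromℕ 2)) ⟩
    B ℚ.* ((3/4 ℚ.* 3/4) ℚ.* fromℕ 2)
      ≤⟨ *-monoˡ (0≤^ (0≤fromℕ 2) s) (*-monoˡ (ℚ.<⇒≤ (0<* 0<3/4 0<3/4))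
           (subst (ℚ._≤ B) (ℚ.*-identityʳ (fromℕ 2)) (fromℕ^-mono 2 {1} {s} (s≤s z≤n)))) ⟩
    B ℚ.* ((3/4 ℚ.* 3/4) ℚ.* B)           ≡⟨ rearrange B 3/4 ⟩
    r ^ 2 ℚ.* 1ℚ                          ∎)
  where
    open ℚ.≤-Reasoning
    3/4 = + 3 ℚ./ 4
    0<3/4 : 0ℚ ℚ.< 3/4
    0<3/4 = from-yes (0ℚ ℚ.<? 3/4)
    B = fromℕ 2 ^ s
    r = 3/4 ℚ.* B
    rearrange : ∀ B x → B ℚ.* ((x ℚ.* x) ℚ.* B) ≡ (x ℚ.* B) ^ 2 ℚ.* 1ℚ
    rearrange = solve 2 (λ B x → B :* ((x :* x) :* B) := ((x :* B) :* ((x :* B) :* con 1ℚ)) :* con 1ℚ) refl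
      where open +-*-Solver
    below : (fromℕ s ℚ.* (½ ℚ.* ½)) ℚ.* fromℕ 2 ℚ.+ 0ℚ ℚ.< fromℕ s
    below = subst₂ ℚ._<_ (sym (trans (ℚ.+-identityʳ _) (ℚ.*-assoc (fromℕ s) (½ ℚ.* ½) (fromℕ 2)))) (ℚ.*-identityʳ (fromℕ s))
      (*-monoˡ-< {c = fromℕ s} (0<fromℕ (s≤s z≤n)) (from-yes ((½ ℚ.* ½) ℚ.* fromℕ 2 ℚ.<? 1ℚ)))

error-≤ : ∀ ε .{{_ : NonNegative ε}} {M E n σ s} → 1ℚ ℚ.≤ ε ℚ.* fromℕ M → 1 ≤ n → 1 ≤ s → 2 ℕ.^ s ≤ σ →
          8 * (M * E) ≤ n * s → fromℚ (fromℕ E) ≤ʳ ε · (fromℕ n · logℕ σ)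
error-≤ ε {M} {E} {n} {zero}  {s} _ _ _ 2^s≤0 _ = contradiction (ℕ.≤-trans (ℕ.m^n>0 2 s) 2^s≤0) λ ()
error-≤ ε {M} {E} {n} {σ@(suc _)} {s} 1≤εM 1≤n 1≤s 2^s≤σ 8ME≤ns {q} q<E =
  fromℕ n ℚ.* (fromℕ s ℚ.* ⅛) ,
  (fromℕ s ℚ.* (½ ℚ.* ½) , LogAbove⇒log {x>0 = fromℕ-mono-< (s≤s z≤n)} (logAbove-2^ 1≤s 2^s≤σ) ,
    *-monoˡ-< (0<fromℕ 1≤n) (*-monoˡ-< (0<fromℕ 1≤s) (from-yes (⅛ ℚ.<? ½ ℚ.* ½)))) ,
  ℚ.<-≤-trans q<E (begin
    fromℕ E                                     ≡⟨ ℚ.*-identityˡ (fromℕ E) ⟨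
    1ℚ ℚ.* fromℕ E                              ≤⟨ *-monoʳ (0≤fromℕ E) 1≤εM ⟩
    (ε ℚ.* fromℕ M) ℚ.* fromℕ E                 ≡⟨ ℚ.*-assoc ε (fromℕ M) (fromℕ E) ⟩
    ε ℚ.* (fromℕ M ℚ.* fromℕ E)                 ≡⟨ cong (ε ℚ.*_) (trans (sym (eighth (fromℕ M ℚ.* fromℕ E)))
      (cong (ℚ._* ⅛) (trans (cong (fromℕ 8 ℚ.*_) (sym (fromℕ-* M E))) (sym (fromℕ-* 8 (M * E)))))) ⟩
    ε ℚ.* (fromℕ (8 * (M * E)) ℚ.* ⅛)           ≤⟨ *-monoˡ (ℚ.nonNegative⁻¹ ε) (*-monoʳ (from-yes (0ℚ ℚ.≤? ⅛)) (fromℕ-mono-≤ 8ME≤ns)) ⟩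
    ε ℚ.* (fromℕ (n * s) ℚ.* ⅛)                 ≡⟨ cong (ε ℚ.*_) (trans (cong (ℚ._* ⅛) (fromℕ-* n s)) (ℚ.*-assoc (fromℕ n) (fromℕ s) ⅛)) ⟩
    ε ℚ.* (fromℕ n ℚ.* (fromℕ s ℚ.* ⅛))         ∎)
  where
    open ℚ.≤-Reasoning
    ⅛ = + 1 ℚ./ 8
    eighth : ∀ x → (fromℕ 8 ℚ.* x) ℚ.* ⅛ ≡ x
    eighth x = trans (cong (ℚ._* ⅛) (ℚ.*-comm (fromℕ 8) x)) (trans (ℚ.*-assoc x (fromℕ 8) ⅛) (ℚ.*-identityʳ x))

floorLogℕ : ∀ n → 1 ≤ n → ∃[ g ] (2 ℕ.^ g ≤ n × n < 2 ℕ.^ suc g)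
floorLogℕ (suc zero)        _ = 0 , s≤s z≤n , s≤s (s≤s z≤n)
floorLogℕ (suc n@(suc _)) _ with floorLogℕ n (s≤s z≤n)
... | g , lo , hi with suc n ℕ.<? 2 ℕ.^ suc g
...   | yes lt = g , ℕ.m≤n⇒m≤1+n lo , lt
...   | no ¬lt = suc g , ℕ.≮⇒≥ ¬lt , ℕ.≤-<-trans hi (ℕ.^-monoʳ-< 2 (s≤s (s≤s z≤n)) (ℕ.n<1+n (suc g)))

2^-reflects-≤ : ∀ {a g n} → 2 ℕ.^ a ≤ n → n < 2 ℕ.^ suc g → a ≤ g
2^-reflects-≤ {a} {g} lo hi = ℕ.≮⇒≥ λ g<a → ℕ.<⇒≱ hi (ℕ.≤-trans (ℕ.^-monoʳ-≤ 2 g<a) lo)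

triangle-≤-2^ : ∀ n → n * suc n ≤ 2 * 2 ℕ.^ n
triangle-≤-2^ zero    = z≤n
triangle-≤-2^ (suc n) = begin
  suc n * suc (suc n)               ≡⟨ lem n ⟩
  n * suc n + 2 * suc n             ≤⟨ ℕ.+-mono-≤ (triangle-≤-2^ n) (ℕ.*-monoʳ-≤ 2 (n<b^n 2 n)) ⟩
  2 * 2 ℕ.^ n + 2 * 2 ℕ.^ n         ≡⟨ lem′ (2 ℕ.^ n) ⟩
  2 * 2 ℕ.^ suc n                   ∎
  where
    open ℕ.≤-Reasoning
    lem : ∀ n → suc n * suc (suc n) ≡ n * suc n + 2 * suc n
    lem = solve-∀
    lem′ : ∀ x → 2 * x + 2 * x ≡ 2 * (2 * x)
    lem′ = solve-∀

-- The parameter h is log log n + O(1), where g = ⌊log n⌋.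
loglog-parameter : ∀ Q g → 2 ℕ.^ (4 * Q + 2) ≤ g → ∃[ h ] (Q * h ≤ g × 2 * suc g ≤ 2 ℕ.^ h × 1 ≤ h)
loglog-parameter Q g large with x , lo , hi ← floorLogℕ (suc g) (s≤s z≤n) =
  -- With x = ⌊log (g + 1)⌋ the added 2 yields 2 (g + 1) ≤ 2 ^ h. Thus even n², which exceeds σ for
  -- large n, is at most 2 ^ (2 ^ h).
  2 + x , Qh≤g ,
  ℕ.≤-trans (ℕ.*-monoʳ-≤ 2 (ℕ.<⇒≤ hi)) ℕ.≤-refl ,
  s≤s z≤n
  where
    open ℕ.≤-Reasoning
    4Q+2≤x : 4 * Q + 2 ≤ x
    4Q+2≤x = 2^-reflects-≤ (ℕ.m≤n⇒m≤1+n large) hi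
    Qh≤g : Q * (2 + x) ≤ g
    -- The origin of 4 Q + 2: as x is at least this large, 2 Q (2 + x) + 2 ≤ x (x + 1), and the
    -- right side is at most 2 · 2 ^ x ≤ 2 (g + 1).
    Qh≤g = ℕ.*-cancelˡ-≤ 2 (ℕ.+-cancelʳ-≤ 2 (2 * (Q * (2 + x))) (2 * g) (begin
      2 * (Q * (2 + x)) + 2           ≡⟨ lem Q x ⟩
      (2 * Q) * x + (4 * Q + 2)       ≤⟨ ℕ.+-mono-≤ (ℕ.*-monoˡ-≤ x 2Q≤x) 4Q+2≤x ⟩
      x * x + x                       ≡⟨ lem′ x ⟩
      x * suc x                       ≤⟨ triangle-≤-2^ x ⟩
      2 * 2 ℕ.^ x                     ≤⟨ ℕ.*-monoʳ-≤ 2 lo ⟩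
      2 * suc g                       ≡⟨ lem″ g ⟩
      2 * g + 2                       ∎))
      where
        lem : ∀ Q x → 2 * (Q * (2 + x)) + 2 ≡ (2 * Q) * x + (4 * Q + 2)
        lem = solve-∀
        lem′ : ∀ x → x * x + x ≡ x * suc x
        lem′ = solve-∀
        lem″ : ∀ g → 2 * suc g ≡ 2 * g + 2
        lem″ = solve-∀
        2Q≤x : 2 * Q ≤ x
        2Q≤x = ℕ.≤-trans (ℕ.*-monoˡ-≤ Q {2} {4} (s≤s (s≤s z≤n))) (ℕ.≤-trans (ℕ.m≤m+n (4 * Q) 2) 4Q+2≤x)

-- The choice L ≈ ½ log_σ n.
parse-length-log : ∀ {z n σ g s} → (∀ L → σ ℕ.^ (2 * L) ≤ n → z * L ≤ 8 * n) → z ≤ n → 1 ≤ s →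
  2 ℕ.^ g ≤ n → σ ≤ 2 ℕ.^ suc s → z * g ≤ 36 * (n * s)
parse-length-log {z} {n} {σ} {g} {s} zL≤ phrases≤n 1≤s 2^g≤n σ≤ = begin
  z * g                              ≤⟨ ℕ.*-monoʳ-≤ z g≤ ⟩
  z * (suc L * D)                    ≡⟨ lem z L D ⟩
  -- The extra z comes from rounding L down; z ≤ n covers it, also when L = 0.
  (z * L + z) * D                    ≤⟨ ℕ.*-mono-≤ (ℕ.+-mono-≤ (zL≤ L σ^2L≤n) phrases≤n) D≤4s ⟩
  (8 * n + n) * (4 * s)              ≡⟨ lem′ n s ⟩
  36 * (n * s)                       ∎
  where
    open ℕ.≤-Reasoning
    -- From σ ≤ 2 ^ (s + 1) it follows that σ ^ (2 L) ≤ 2 ^ (L D) ≤ 2 ^ g.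
    D = 2 * suc s
    L = g ℕ./ D
    g≤ : g ≤ suc L * D
    g≤ = begin
      g                    ≡⟨ ℕ.m≡m%n+[m/n]*n g D ⟩
      g ℕ.% D + L * D      ≤⟨ ℕ.+-monoˡ-≤ (L * D) (ℕ.<⇒≤ (ℕ.m%n<n g D)) ⟩
      suc L * D            ∎
    D≤4s : D ≤ 4 * s
    D≤4s = begin
      2 * suc s      ≡⟨ lem″ s ⟩
      2 * s + 2 * 1  ≤⟨ ℕ.+-monoʳ-≤ (2 * s) (ℕ.*-monoʳ-≤ 2 1≤s) ⟩
      2 * s + 2 * s  ≡⟨ lem‴ s ⟩
      4 * s          ∎
      where
        lem″ : ∀ s → 2 * suc s ≡ 2 * s + 2 * 1
        lem″ = solve-∀
        lem‴ : ∀ s → 2 * s + 2 * s ≡ 4 * s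
        lem‴ = solve-∀
    σ^2L≤n : σ ℕ.^ (2 * L) ≤ n
    σ^2L≤n = begin
      σ ℕ.^ (2 * L)                ≤⟨ ℕ.^-monoˡ-≤ (2 * L) σ≤ ⟩
      (2 ℕ.^ suc s) ℕ.^ (2 * L)    ≡⟨ ℕ.^-*-assoc 2 (suc s) (2 * L) ⟩
      2 ℕ.^ (suc s * (2 * L))      ≤⟨ ℕ.^-monoʳ-≤ 2 (ℕ.≤-trans (ℕ.≤-reflexive (lem⁗ s L)) (ℕ.m/n*n≤m g D)) ⟩
      2 ℕ.^ g                      ≤⟨ 2^g≤n ⟩
      n                            ∎
      where
        lem⁗ : ∀ s L → suc s * (2 * L) ≡ L * (2 * suc s)
        lem⁗ = solve-∀
    lem : ∀ z L D → z * (suc L * D) ≡ (z * L + z) * D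
    lem = solve-∀
    lem′ : ∀ n s → (8 * n + n) * (4 * s) ≡ 36 * (n * s)
    lem′ = solve-∀

-- The error has four parts: the constant 1, the linear excesses E and F, the O(h) bits per phrase
-- and the (s + 1) k bits per phrase for the uniform start. Each is at most n s after multiplication
-- by 32 M = 4 · 8 M; the numerical constants in the hypotheses are chosen for this.
total-error : ∀ {M C c z n s k h g E F} → 1 ≤ s → 1 ≤ h →
  E * 2 ℕ.^ h ≤ suc c * n → F * 2 ℕ.^ h ≤ n →
  z * g ≤ 36 * (n * s) → (36 * (32 * M * (4 + 3 * C))) * h ≤ g →
  z * (k * (512 * M)) ≤ 8 * n →
  32 * M * suc (c + (2 + C)) ≤ 2 ℕ.^ h → 32 * M ≤ n →
  8 * (M * ((1 + (E + (z * (1 + 3 * h + suc s * k) + 2 * F))) + C * (z * (1 + h + h) + F))) ≤ n * s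
total-error {M} {C} {c} {z} {n} {s} {k} {h} {g} {E} {F} 1≤s 1≤h E≤ F≤ zg≤ Qh≤g zk≤ K≤2^h 32M≤n =
  ℕ.*-cancelˡ-≤ 4 (begin
    4 * (8 * (M * ((1 + (E + (z * (1 + 3 * h + suc s * k) + 2 * F))) + C * (z * (1 + h + h) + F))))
      ≡⟨ regroup M C z s k h E F ⟩
    32 * M + 32 * M * G + 32 * M * (z * ((1 + 3 * h) + C * (1 + h + h))) + 32 * M * (z * (suc s * k))
      ≤⟨ ℕ.+-mono-≤ (ℕ.+-mono-≤ (ℕ.+-mono-≤ (≤n*s 32M≤n) (≤n*s overflow)) phrases) context ⟩
    n * s + n * s + n * s + n * s ≡⟨ four (n * s) ⟩
    4 * (n * s) ∎)
  where
    open ℕ.≤-Reasoning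
    G = E + (2 + C) * F
    K = suc (c + (2 + C))
    four : ∀ x → x + x + x + x ≡ 4 * x
    four = solve-∀
    regroup : ∀ M C z s k h E F →
      4 * (8 * (M * ((1 + (E + (z * (1 + 3 * h + suc s * k) + 2 * F))) + C * (z * (1 + h + h) + F)))) ≡
      32 * M + 32 * M * (E + (2 + C) * F) + 32 * M * (z * ((1 + 3 * h) + C * (1 + h + h))) + 32 * M * (z * (suc s * k))
    regroup = solve-∀
    ≤n*s : ∀ {x} → x ≤ n → x ≤ n * s
    ≤n*s x≤n = ℕ.≤-trans x≤n (subst (_≤ n * s) (ℕ.*-identityʳ n) (ℕ.*-monoʳ-≤ n 1≤s))
    overflow : 32 * M * G ≤ n
    overflow = ℕ.*-cancelˡ-≤ K (begin
      K * (32 * M * G)                         ≡⟨ lem K (32 * M) G ⟩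
      G * (32 * M * K)                         ≤⟨ ℕ.*-monoʳ-≤ G K≤2^h ⟩
      G * 2 ℕ.^ h                              ≡⟨ lem′ E C F (2 ℕ.^ h) ⟩
      E * 2 ℕ.^ h + (2 + C) * (F * 2 ℕ.^ h)    ≤⟨ ℕ.+-mono-≤ E≤ (ℕ.*-monoʳ-≤ (2 + C) F≤) ⟩
      suc c * n + (2 + C) * n                  ≡⟨ ℕ.*-distribʳ-+ n (suc c) (2 + C) ⟨
      K * n                                    ∎)
      where
        lem : ∀ K m G → K * (m * G) ≡ G * (m * K)
        lem = solve-∀
        lem′ : ∀ E C F x → (E + (2 + C) * F) * x ≡ E * x + (2 + C) * (F * x)
        lem′ = solve-∀
    phrases : 32 * M * (z * ((1 + 3 * h) + C * (1 + h + h))) ≤ n * s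
    phrases = ℕ.*-cancelˡ-≤ 36 (begin
      36 * (32 * M * (z * ((1 + 3 * h) + C * (1 + h + h))))
        ≤⟨ ℕ.*-monoʳ-≤ 36 (ℕ.*-monoʳ-≤ (32 * M) (ℕ.*-monoʳ-≤ z (ℕ.+-mono-≤ (ℕ.+-monoˡ-≤ (3 * h) 1≤h)
             (ℕ.*-monoʳ-≤ C (ℕ.+-monoˡ-≤ h (ℕ.+-monoˡ-≤ h 1≤h)))))) ⟩
      36 * (32 * M * (z * ((h + 3 * h) + C * (h + h + h))))   ≡⟨ lem M z h C ⟩
      z * ((36 * (32 * M * (4 + 3 * C))) * h)                 ≤⟨ ℕ.*-monoʳ-≤ z Qh≤g ⟩
      z * g                                                   ≤⟨ zg≤ ⟩
      36 * (n * s)                                            ∎)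
      where
        lem : ∀ M z h C → 36 * (32 * M * (z * ((h + 3 * h) + C * (h + h + h)))) ≡ z * ((36 * (32 * M * (4 + 3 * C))) * h)
        lem = solve-∀
    context : 32 * M * (z * (suc s * k)) ≤ n * s
    context = ℕ.*-cancelˡ-≤ 8 (begin
      8 * (32 * M * (z * (suc s * k)))
        ≤⟨ ℕ.*-monoʳ-≤ 8 (ℕ.*-monoʳ-≤ (32 * M) (ℕ.*-monoʳ-≤ z (ℕ.*-monoˡ-≤ k (ℕ.+-monoˡ-≤ s 1≤s)))) ⟩
      8 * (32 * M * (z * ((s + s) * k)))   ≡⟨ lem M z s k ⟩
      (z * (k * (512 * M))) * s            ≤⟨ ℕ.*-monoˡ-≤ s zk≤ ⟩
      8 * n * s                            ≡⟨ ℕ.*-assoc 8 n s ⟩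
      8 * (n * s)                          ∎)
      where
        lem : ∀ M z s k → 8 * (32 * M * (z * ((s + s) * k))) ≡ (z * (k * (512 * M))) * s
        lem = solve-∀

length≤length-concat : ∀ {A : Set} {ws : List (List A)} → All (_≢ []) ws → length ws ≤ length (concat ws)
length≤length-concat []                       = z≤n
length≤length-concat {ws = w ∷ ws} (w≢[] ∷ all) = subst (suc (length ws) ≤_) (sym (List.length-++ w))
  (ℕ.+-mono-≤ (1≤length w≢[]) (length≤length-concat all))

relz-cost : ∀ {σ n} k {M C c g h s} ε .{{_ : NonNegative ε}} → 2 ≤ σ → 1ℚ ℚ.≤ ε ℚ.* fromℕ M → 1 ≤ n → 1 ≤ s →
  2 ℕ.^ s ≤ σ → σ ≤ 2 ℕ.^ suc s → 2 ℕ.^ g ≤ n → σ ≤ c * n → 1 ≤ h → n ≤ 2 ℕ.^ (2 ℕ.^ h) → σ ≤ 2 ℕ.^ (2 ℕ.^ h) →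
  (36 * (32 * M * (4 + 3 * C))) * h ≤ g → 32 * M * suc (c + (2 + C)) ≤ 2 ℕ.^ h → 32 * M ≤ n →
  σ ℕ.^ (2 * (k * (512 * M))) ≤ n →
  (T : List (Fin σ)) → length T ≡ n → ∀ ℓ → ℓ ≤ n →
  ∀ phrases → ReLZ ℓ T phrases → ∀ codes → RightmostEncoding T phrases codes →
  (bits : Code (Fin σ) → ℝ) → BitBound C σ bits →
  sumʳ (map bits codes) ≤ʳ fromℕ n · H k T +ʳ ε · (fromℕ n · logℕ σ)
relz-cost {σ} {n} k {M} {C} {c} {g} {h} {s} ε σ≥2 1≤εM 1≤n 1≤s 2^s≤σ σ≤2^1+s 2^g≤n σ≤cn 1≤h n≤2^2^h σ≤2^2^h Qh≤g K≤2^h 32M≤n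
  σ^≤n T refl ℓ _ phrases r codes encoding bits bitBound q∈ =
  let E , F , E≤ , F≤ , cost = encoding-cost k {T} 1≤n r encoding {C} {bits} bitBound (suc s) h σ≤2^1+s n≤2^2^h σ≤2^2^h
      a , b , a∈ , q< , b< = cost q∈
  in a , b , a∈ ,
     error-≤ ε {M} 1≤εM 1≤n 1≤s 2^s≤σ
       (total-error {M} {C} {c} {length phrases} {n} {s} {k} {h} {g} {E} {F} 1≤s 1≤h
         (ℕ.≤-trans E≤ (ℕ.+-monoʳ-≤ n σ≤cn)) F≤
         (parse-length-log {length phrases} {n} {σ} {g} {s} z-bound phrases≤n 1≤s 2^g≤n σ≤2^1+s)
         Qh≤g (z-bound (k * (512 * M)) σ^≤n) K≤2^h 32M≤n) b< ,
     q<
  where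
    instance _ = ℕ.>-nonZero (ℕ.≤-trans (s≤s z≤n) σ≥2)
    z-bound : ∀ L → σ ℕ.^ (2 * L) ≤ n → length phrases * L ≤ 8 * n
    z-bound = relz-length σ≥2 r
    phrases≤n : length phrases ≤ n
    phrases≤n = subst₂ _≤_ (List.length-map content phrases) (cong length (relz-concat r))
      (length≤length-concat (relz-nonempty r))

theorem1 : (σ k : ℕ → ℕ) (σ≥2 : ∀ n → 2 ≤ σ n) →
    (∀ {m n} → m ≤ n → σ m ≤ σ n) →
    (∃[ c ] ∃[ N ] ∀ n → N ≤ n → σ n ≤ c * n) →
    IsLittleO (λ n → fromℚ (fromℕ (k n))) (λ n → logBaseℕ (σ n) {{n>1⇒nonTrivial (σ≥2 n)}} n) →
    (C : ℕ) (ε : ℚ) .{{ε>0 : Positive ε}} →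
    ∃[ N ] ∀ n → N ≤ n →
    (T : List (Fin (σ n))) → length T ≡ n →
    ∀ ℓ → ℓ ≤ n →
    ∀ phrases → ReLZ ℓ T phrases →
    ∀ codes → RightmostEncoding T phrases codes →
    (bits : Code (Fin (σ n)) → ℝ) → BitBound C (σ n) bits →
    sumʳ (map bits codes) ≤ʳ
    fromℕ n · H (k n) T +ʳ _·_ ε {{pos⇒nonNeg ε}} (fromℕ n · logℕ (σ n))
theorem1 σ k σ≥2 _ (c , N₁ , σ≤cn) k=o C ε {{ε>0}} =
  N₁ ℕ.⊔ (N₂ ℕ.⊔ N₃) , bound
  where
    slack = archimedean (ℚ.positive⁻¹ ε)
    M = suc (proj₁ slack)
    -- The phrase count is used with L = k · 512 M and then requires σ ^ (2 L) ≤ n.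
    k-small = littleO⇒power-≤ σ k σ≥2 k=o (2 * (512 * M))
    N₂ = proj₁ k-small
    Q = 36 * (32 * M * (4 + 3 * C))
    K = 32 * M * suc (c + (2 + C))
    -- A lower bound for g = ⌊log n⌋: the first entry is the demand of `loglog-parameter`, the
    -- second gives K ≤ g ≤ 2 ^ h.
    G = 2 ℕ.^ (4 * Q + 2) ℕ.⊔ K
    N₅ = 1 ℕ.⊔ 2 ℕ.^ G
    N₄ = 32 * M ℕ.⊔ N₅
    -- For n ≥ c the bound σ ≤ c n becomes σ ≤ n².
    N₃ = c ℕ.⊔ N₄
    bound : ∀ n → N₁ ℕ.⊔ (N₂ ℕ.⊔ N₃) ≤ n →
            (T : List (Fin (σ n))) → length T ≡ n → ∀ ℓ → ℓ ≤ n →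
            ∀ phrases → ReLZ ℓ T phrases → ∀ codes → RightmostEncoding T phrases codes →
            (bits : Code (Fin (σ n)) → ℝ) → BitBound C (σ n) bits →
            sumʳ (map bits codes) ≤ʳ
            fromℕ n · H (k n) T +ʳ _·_ ε {{pos⇒nonNeg ε}} (fromℕ n · logℕ (σ n))
    bound n N≤n = relz-cost (k n) {M = M} {C = C} {c = c} {g = g} {s = s} ε {{pos⇒nonNeg ε}} (σ≥2 n) (proj₂ slack) 1≤n 1≤s 2^s≤σ
      (ℕ.<⇒≤ σ<2^1+s) 2^g≤n (σ≤cn n N₁≤n) 1≤h n≤2^2^h σ≤2^2^h Qh≤g
      (ℕ.≤-trans (ℕ.m⊔n≤o⇒n≤o (2 ℕ.^ (4 * Q + 2)) K G≤g) g≤2^h) 32M≤n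
      (subst (λ x → σ n ℕ.^ x ≤ n) (lem (k n) (512 * M)) (proj₂ k-small n N₂≤n 1≤n))
      where
        N₁≤n = ℕ.m⊔n≤o⇒m≤o N₁ (N₂ ℕ.⊔ N₃) N≤n
        R₁ = ℕ.m⊔n≤o⇒n≤o N₁ (N₂ ℕ.⊔ N₃) N≤n
        N₂≤n = ℕ.m⊔n≤o⇒m≤o N₂ N₃ R₁
        R₂ = ℕ.m⊔n≤o⇒n≤o N₂ N₃ R₁
        c≤n = ℕ.m⊔n≤o⇒m≤o c N₄ R₂
        R₃ = ℕ.m⊔n≤o⇒n≤o c N₄ R₂
        32M≤n = ℕ.m⊔n≤o⇒m≤o (32 * M) N₅ R₃
        R₄ = ℕ.m⊔n≤o⇒n≤o (32 * M) N₅ R₃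
        1≤n = ℕ.m⊔n≤o⇒m≤o 1 (2 ℕ.^ G) R₄
        2^G≤n = ℕ.m⊔n≤o⇒n≤o 1 (2 ℕ.^ G) R₄
        gs = floorLogℕ n 1≤n
        g = proj₁ gs
        2^g≤n = proj₁ (proj₂ gs)
        n<2^1+g = proj₂ (proj₂ gs)
        ss = floorLogℕ (σ n) (ℕ.≤-trans (s≤s z≤n) (σ≥2 n))
        s = proj₁ ss
        2^s≤σ = proj₁ (proj₂ ss)
        σ<2^1+s = proj₂ (proj₂ ss)
        1≤s : 1 ≤ s
        1≤s = 2^-reflects-≤ (σ≥2 n) σ<2^1+s
        G≤g : G ≤ g
        G≤g = 2^-reflects-≤ 2^G≤n n<2^1+g
        hs = loglog-parameter Q g (ℕ.m⊔n≤o⇒m≤o (2 ℕ.^ (4 * Q + 2)) K G≤g)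
        h = proj₁ hs
        Qh≤g = proj₁ (proj₂ hs)
        2+2g≤2^h = proj₁ (proj₂ (proj₂ hs))
        1≤h = proj₂ (proj₂ (proj₂ hs))
        g≤2^h : g ≤ 2 ℕ.^ h
        g≤2^h = ℕ.≤-trans (ℕ.n≤1+n g) (ℕ.≤-trans (ℕ.m≤m+n (suc g) (suc g + 0)) 2+2g≤2^h)
        n*n≤2^2^h : n * n ≤ 2 ℕ.^ (2 ℕ.^ h)
        n*n≤2^2^h = ℕ.≤-trans (ℕ.*-mono-≤ (ℕ.<⇒≤ n<2^1+g) (ℕ.<⇒≤ n<2^1+g))
          (subst (_≤ 2 ℕ.^ (2 ℕ.^ h)) (ℕ.^-distribˡ-+-* 2 (suc g) (suc g))
            (ℕ.^-monoʳ-≤ 2 (subst (λ x → suc g + x ≤ 2 ℕ.^ h) (ℕ.+-identityʳ (suc g)) 2+2g≤2^h)))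
        n≤2^2^h : n ≤ 2 ℕ.^ (2 ℕ.^ h)
        n≤2^2^h = ℕ.≤-trans (subst (_≤ n * n) (ℕ.*-identityʳ n) (ℕ.*-monoʳ-≤ n 1≤n)) n*n≤2^2^h
        σ≤2^2^h : σ n ≤ 2 ℕ.^ (2 ℕ.^ h)
        σ≤2^2^h = ℕ.≤-trans (σ≤cn n N₁≤n) (ℕ.≤-trans (ℕ.*-monoˡ-≤ n c≤n) n*n≤2^2^h)
        lem : ∀ k m → k * (2 * m) ≡ 2 * (k * m)
        lem = solve-∀
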